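{- Let $k\ge2$, $m\ge3$, $3\le g\le m$ and $0<\alpha<1$. Among all $k$-uniform linear unicyclic hypergraphs with $m$ hyperedges and girth $g$, the last hypergraph in $S_\alpha$-order is $C_g^{(k)}\odot S_{m-g}^{(k)}$.
   Context: Hypergraphs are finite; $k$-uniform means every hyperedge has exactly $k$ vertices; linear means any two distinct hyperedges share at most one vertex; unicyclic means connected with exactly one cycle; the girth is the minimum length of a cycle. A cored vertex is a vertex of degree one. A pendant hyperedge is a hyperedge containing $k-1$ cored vertices; "adding a pendant hyperedge to a vertex $v$" means adding a new hyperedge consisting of $v$ and $k-1$ new vertices. The hypercycle $C_g^{(k)}$ is obtained from the cycle graph $C_g$ by inserting $k-2$ new (cored) vertices into each edge. $C_g^{(k)}\odot S_{m-g}^{(k)}$ is obtained from $C_g^{(k)}$ by adding $m-g$ pendant hyperedges to one non-cored vertex of $C_g^{(k)}$. For a $k$-uniform hypergraph $\mathcal{H}$ on $[n]$, $\mathcal{A}(\mathcal{H})$ is the $k$-order $n$-dimensional tensor with entry $\frac1{(k-1)!}$ at $(i_1,\dots,i_k)$ if $\{i_1,\dots,i_k\}\in E(\mathcal{H})$ and $0$ otherwise; $\mathcal{D}(\mathcal{H})$ is the diagonal tensor of vertex degrees; $\mathcal{A}_\alpha(\mathcal{H})=\alpha\mathcal{D}(\mathcal{H})+(1-\alpha)\mathcal{A}(\mathcal{H})$. For a tensor $\mathcal{T}$, $\mathrm{Tr}_d(\mathcal{T})$ is the sum of the $d$-th powers of all $n(k-1)^{n-1}$ eigenvalues of $\mathcal{T}$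 (roots of its characteristic polynomial, with multiplicity); in particular $\mathrm{Tr}_0(\mathcal{T})=n(k-1)^{n-1}$, and for $d\ge1$ $$\mathrm{Tr}_{d}(\mathcal{T})=(k-1)^{n-1}\sum_{d_1+\cdots+d_n=d}\ \prod_{i=1}^{n}\frac{1}{(d_i(k-1))!}\Big(\sum_{\gamma\in[n]^{k-1}}(\mathcal{T})_{i\gamma}\frac{\partial}{\partial a_{i\gamma}}\Big)^{d_i}\mathrm{tr}\big(A^{d(k-1)}\big),$$ with $A=(a_{ij})$ an $n\times n$ matrix of indeterminates, $d_i\ge0$ integers, $\frac{\partial}{\partial a_{i\gamma}}=\frac{\partial}{\partial a_{i i_2}}\cdots\frac{\partial}{\partial a_{i i_k}}$ for $\gamma=i_2\cdots i_k$. $S_\alpha$-order: for $k$-uniform hypergraphs $\mathcal{H}_1,\mathcal{H}_2$ with $n$ vertices, $\mathcal{H}_1\prec_\alpha\mathcal{H}_2$ if there is $d\in\{1,\dots,n(k-1)^{n-1}-1\}$ with $\mathrm{Tr}_t(\mathcal{A}_\alpha(\mathcal{H}_1))=\mathrm{Tr}_t(\mathcal{A}_\alpha(\mathcal{H}_2))$ for $t=0,\dots,d-1$ and $\mathrm{Tr}_d(\mathcal{A}_\alpha(\mathcal{H}_1))<\mathrm{Tr}_d(\mathcal{A}_\alpha(\mathcal{H}_2))$. "$X$ is the last hypergraph in a class" means $X$ is in the class and $\mathcal{H}\prec_\alpha X$ for every $\mathcal{H}$ in the class not isomorphic to $X$. -}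

module Defs where

open import Level using (_⊔_) renaming (suc to lsuc)
open import Algebra.Apartness.Bundles using (HeytingField; HeytingCommutativeRing)
open import Algebra.Bundles using (CommutativeRing)
import Algebra.Apartness.Properties.HeytingCommutativeRing as HeytingProperties
import Algebra.Properties.Group as GroupProperties
import Algebra.Properties.Ring as RingProperties
import Algebra.Properties.Semiring.Mult as SemiringMult
open import Data.Bool.Base using (if_then_else_; _∧_)
import Data.Bool.Properties as Bool
open import Data.Fin.Base using (Fin; zero; suc; toℕ; _↑ˡ_)
open import Data.Fin.Properties using (_≟_; any?; toℕ-fromℕ<; toℕ<n)
open import Data.Fin.Subset
  using (Subset; _∈_; ⁅_⁆; _∪_; _∩_; ⋃; ∣_∣; ⊤; ⊥)
open import Data.Fin.Subset.Properties using (x∈⁅x⁆; x∈⁅y⁆⇒x≡y; x∈p∪q⁺; x∈p∪q⁻)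
open import Data.List.Base as List using (List; []; _∷_; foldr; filter; upTo; allFin; cartesianProductWith)
open import Data.Nat.Base using (ℕ; zero; suc; _+_; _*_; _∸_; _^_; _!; _≤_; _<_; z≤n; s≤s)
import Data.Nat.Properties as ℕ
open import Data.Nat.DivMod using (_mod_; _%_; m<n⇒m%n≡m; m%n<n; %-distribˡ-+; [m+n]%n≡m%n; m%n%n≡m%n)
open import Data.Nat.GeneralisedArithmetic using (fold)
open import Data.Product.Base using (∃-syntax; _×_; _,_; proj₁)
open import Data.Sum.Base using (_⊎_; inj₁; inj₂; [_,_]′)
open import Data.Vec.Base as Vec using (Vec; []; _∷_; _++_; concat; tabulate; lookup)
open import Data.Vec.Properties using (++-injectiveˡ; ++-injectiveʳ; ∷-injectiveˡ; ≡-dec)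
open import Function.Base using (id)
open import Function.Bundles using (_⇔_; _↔_; Inverse)
open import Relation.Binary.Construct.Closure.ReflexiveTransitive using (Star)
open import Relation.Binary.Core using (Rel)
open import Relation.Binary.PropositionalEquality
  using (_≡_; _≢_; refl; sym; trans; cong; subst)
open import Relation.Binary.Structures using (IsStrictPartialOrder)
open import Relation.Nullary.Decidable using (Dec; does)
open import Relation.Nullary.Negation using (¬_; contradiction)

------------------------------------------------------------------------
-- Real numbers

-- An Archimedean, Cauchy complete ordered field.  Classically this
-- determines ℝ up to unique isomorphism; the formulation with apartness
-- and a cotransitive order also admits the constructive Cauchy reals.

record RealNumbers c ℓ₁ ℓ₂ ℓ₃ : Set (lsuc (c ⊔ ℓ₁ ⊔ ℓ₂ ⊔ ℓ₃)) where
  infix 4 _<ᴿ_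

  field
    heytingField : HeytingField c ℓ₁ ℓ₂

  open HeytingField heytingField public
    using (Carrier; _≈_; _#_; 0#; 1#; heytingCommutativeRing)
    renaming (_+_ to _+ᴿ_; _*_ to _*ᴿ_; -_ to -ᴿ_; _-_ to _-ᴿ_)

  commutativeRing : CommutativeRing c ℓ₁
  commutativeRing = HeytingCommutativeRing.commutativeRing heytingCommutativeRing

  fromℕ : ℕ → Carrier
  fromℕ n = SemiringMult._×_ (CommutativeRing.semiring commutativeRing) n 1#

  field
    _<ᴿ_                 : Rel Carrier ℓ₃
    isStrictPartialOrder : IsStrictPartialOrder _≈_ _<ᴿ_
    #⇒<⊎>                : ∀ {x y} → x # y → x <ᴿ y ⊎ y <ᴿ x
    <⇒#                  : ∀ {x y} → x <ᴿ y → x # y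
    +-monoʳ-<            : ∀ x {y z} → y <ᴿ z → (x +ᴿ y) <ᴿ (x +ᴿ z)
    *-pos                : ∀ {x y} → 0# <ᴿ x → 0# <ᴿ y → 0# <ᴿ x *ᴿ y
    archimedean          : ∀ x → ∃[ n ] x <ᴿ fromℕ n

  Close : Carrier → Carrier → Carrier → Set ℓ₃
  Close ε x y = (-ᴿ ε <ᴿ x -ᴿ y) × (x -ᴿ y <ᴿ ε)

  field
    complete : (s : ℕ → Carrier) →
      (∀ ε → 0# <ᴿ ε → ∃[ N ] (∀ i j → N ≤ i → N ≤ j → Close ε (s i) (s j))) →
      ∃[ l ] (∀ ε → 0# <ᴿ ε → ∃[ N ] (∀ i → N ≤ i → Close ε (s i) l))

  private
    module C = CommutativeRing commutativeRing
    module G = GroupProperties C.+-group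
    module P = RingProperties C.ring
    module S = IsStrictPartialOrder isStrictPartialOrder

  0<1 : 0# <ᴿ 1#
  0<1 = [ viaNegative , id ]′ (#⇒<⊎> (HeytingProperties.1#0 heytingCommutativeRing))
    where
    viaNegative : 1# <ᴿ 0# → 0# <ᴿ 1#
    viaNegative 1<0 = S.<-respʳ-≈ -1*-1≈1 (*-pos 0<-1 0<-1)
      where
      0<-1 : 0# <ᴿ -ᴿ 1#
      0<-1 = S.<-respˡ-≈ (C.-‿inverseˡ 1#)
        (S.<-respʳ-≈ (C.+-identityʳ (-ᴿ 1#)) (+-monoʳ-< (-ᴿ 1#) 1<0))
      -1*-1≈1 : (-ᴿ 1#) *ᴿ (-ᴿ 1#) ≈ 1#
      -1*-1≈1 = C.trans (P.-1*x≈-x (-ᴿ 1#)) (G.⁻¹-involutive 1#)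

  0<fromℕ : ∀ n → 1 ≤ n → 0# <ᴿ fromℕ n
  0<fromℕ (suc zero)    _ = S.<-respʳ-≈ (C.sym (C.+-identityʳ 1#)) 0<1
  0<fromℕ (suc (suc n)) _ = S.trans 0<1
    (S.<-respˡ-≈ (C.+-identityʳ 1#) (+-monoʳ-< 1# (0<fromℕ (suc n) (s≤s z≤n))))

  -- 1 / n!
  recip! : ℕ → Carrier
  recip! n = proj₁ (HeytingField.#⇒invertible heytingField n!#0)
    where
    n!#0 : fromℕ (n !) # 0#
    n!#0 = HeytingField.#-sym heytingField (<⇒# (0<fromℕ (n !) (ℕ.1≤n! n)))

------------------------------------------------------------------------
-- Hypergraphs

record Hypergraph : Set where
  field
    order          : ℕ
    size           : ℕ
    edge           : Fin size → Subset order
    edge-injective : ∀ {e f} → edge e ≡ edge f → e ≡ f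

open Hypergraph public

degree : (H : Hypergraph) → Fin (order H) → ℕ
degree H v = ∣ tabulate (λ e → lookup (edge H e) v) ∣

Uniform : ℕ → Hypergraph → Set
Uniform k H = ∀ e → ∣ edge H e ∣ ≡ k

Linear : Hypergraph → Set
Linear H = ∀ e f → e ≢ f → ∣ edge H e ∩ edge H f ∣ ≤ 1

Adjacent : (H : Hypergraph) → Rel (Fin (order H)) _
Adjacent H u v = ∃[ e ] u ∈ edge H e × v ∈ edge H e

Connected : Hypergraph → Set
Connected H = ∀ u v → Star (Adjacent H) u v

-- The cyclic successor i + 1 mod n.
next : ∀ {n} → Fin n → Fin n
next {suc n} i = suc (toℕ i) mod suc n

-- v₀ e₀ v₁ e₁ … v_{l-1} e_{l-1} v₀ with distinct vertices, distinct
-- hyperedges, and v_i , v_{i+1} ∈ e_i.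
record Cycle (H : Hypergraph) (l : ℕ) : Set where
  field
    nontrivial   : 2 ≤ l
    vert         : Fin l → Fin (order H)
    hedge        : Fin l → Fin (size H)
    vert-inj     : ∀ {i j} → vert i ≡ vert j → i ≡ j
    hedge-inj    : ∀ {i j} → hedge i ≡ hedge j → i ≡ j
    vert∈hedge   : ∀ i → vert i ∈ edge H (hedge i)
    next∈hedge   : ∀ i → vert (next i) ∈ edge H (hedge i)

-- v and e are consecutive in the closed sequence c.
Traverses : ∀ {H l} → Cycle H l → Fin (order H) → Fin (size H) → Set
Traverses c v e = ∃[ i ] hedge i ≡ e × (vert i ≡ v ⊎ vert (next i) ≡ v)
  where open Cycle c

-- A closed sequence is determined by its consecutive pairs up to the
-- choice of starting point and direction, which do not matter when
-- cycles are counted.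
SameCycle : ∀ {H l l′} → Cycle H l → Cycle H l′ → Set
SameCycle c c′ = ∀ v e → Traverses c v e ⇔ Traverses c′ v e

record Unicyclic (H : Hypergraph) : Set where
  field
    connected : Connected H
    hasCycle  : ∃[ l ] Cycle H l
    unique    : ∀ {l l′} (c : Cycle H l) (c′ : Cycle H l′) → SameCycle c c′

HasGirth : Hypergraph → ℕ → Set
HasGirth H g = Cycle H g × (∀ {l} → Cycle H l → g ≤ l)

record Isomorphic (H₁ H₂ : Hypergraph) : Set where
  field
    vertices  : Fin (order H₁) ↔ Fin (order H₂)
    edges     : Fin (size H₁) ↔ Fin (size H₂)
    incidence : ∀ v e →
      v ∈ edge H₁ e ⇔ Inverse.to vertices v ∈ edge H₂ (Inverse.to edges e)

record LinearUnicyclic (k m g : ℕ) (H : Hypergraph) : Set where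
  field
    uniform   : Uniform k H
    linear    : Linear H
    unicyclic : Unicyclic H
    size≡m    : size H ≡ m
    girth     : HasGirth H g

------------------------------------------------------------------------
-- The hypergraph C_g ⊙ S_{m-g}

next²-≢ : ∀ {n} → 3 ≤ n → (i : Fin n) → next (next i) ≢ i
next²-≢ {suc n} 3≤n i eq = go (ℕ.<-≤-connex (2 + toℕ i) (suc n))
  where
  toℕ-next : (j : Fin (suc n)) → toℕ (next j) ≡ suc (toℕ j) % suc n
  toℕ-next j = toℕ-fromℕ< (m%n<n (suc (toℕ j)) (suc n))

  -- (a + b) % N depends on b only through b % N.
  reduce : ∀ b → suc (b % suc n) % suc n ≡ suc b % suc n
  reduce b = trans (%-distribˡ-+ 1 (b % suc n) (suc n))
    (trans (cong (λ x → (1 % suc n + x) % suc n) (m%n%n≡m%n b (suc n)))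
      (sym (%-distribˡ-+ 1 b (suc n))))

  2+i%N≡i : (2 + toℕ i) % suc n ≡ toℕ i
  2+i%N≡i = trans (sym (reduce (suc (toℕ i))))
    (trans (cong (λ x → suc x % suc n) (sym (toℕ-next i)))
      (trans (sym (toℕ-next (next i))) (cong toℕ eq)))

  go : 2 + toℕ i < suc n ⊎ suc n ≤ 2 + toℕ i → _
  go (inj₁ lt) = ℕ.1+n≰n (ℕ.≤-trans (ℕ.n≤1+n (suc (toℕ i)))
    (ℕ.≤-reflexive (trans (sym (m<n⇒m%n≡m lt)) 2+i%N≡i)))
  go (inj₂ ge) = ℕ.1+n≰n (ℕ.≤-trans 3≤n (ℕ.≤-reflexive (ℕ.+-cancelˡ-≡ (toℕ i) (suc n) 2
      (trans (cong (_+ suc n) (sym r≡i)) (trans r+N≡2+i (ℕ.+-comm 2 (toℕ i)))))))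
    where
    r = 2 + toℕ i ∸ suc n
    r+N≡2+i : r + suc n ≡ 2 + toℕ i
    r+N≡2+i = ℕ.m∸n+n≡m ge
    r<N : r < suc n
    r<N = ℕ.+-cancelʳ-< (suc n) r (suc n) (ℕ.≤-trans (s≤s (ℕ.≤-reflexive r+N≡2+i))
      (ℕ.≤-trans (ℕ.≤-reflexive (sym (ℕ.+-comm (toℕ i) 3)))
        (ℕ.+-mono-≤ (ℕ.<⇒≤ (toℕ<n i)) 3≤n)))
    r≡i : r ≡ toℕ i
    r≡i = trans (sym (m<n⇒m%n≡m r<N)) (trans (sym ([m+n]%n≡m%n r (suc n)))
      (trans (cong (_% suc n) r+N≡2+i) 2+i%N≡i))

-- Vertices of C_g^(k): the g vertices of the cycle graph, followed by g
-- blocks of k-2 inserted vertices, the i-th block lying on the i-th edge.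
hypercycleEdge : (k g : ℕ) → Fin g → Subset (g + g * (k ∸ 2))
hypercycleEdge k g i =
  (⁅ i ⁆ ∪ ⁅ next i ⁆) ++ concat (tabulate (λ j → if does (i ≟ j) then ⊤ else ⊥))

hypercycle : (k g : ℕ) → 3 ≤ g → Hypergraph
hypercycle k g 3≤g = record
  { order          = g + g * (k ∸ 2)
  ; size           = g
  ; edge           = hypercycleEdge k g
  ; edge-injective = λ {i} {j} eq → injective i j (++-injectiveˡ _ _ eq)
  }
  where
  endpoint : ∀ i j → ⁅ i ⁆ ∪ ⁅ next i ⁆ ≡ ⁅ j ⁆ ∪ ⁅ next j ⁆ → i ≡ j ⊎ i ≡ next j
  endpoint i j eq = [ (λ p → inj₁ (x∈⁅y⁆⇒x≡y j p)) , (λ p → inj₂ (x∈⁅y⁆⇒x≡y (next j) p)) ]′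
    (x∈p∪q⁻ ⁅ j ⁆ ⁅ next j ⁆ (subst (i ∈_) eq (x∈p∪q⁺ (inj₁ (x∈⁅x⁆ i)))))

  injective : ∀ i j → ⁅ i ⁆ ∪ ⁅ next i ⁆ ≡ ⁅ j ⁆ ∪ ⁅ next j ⁆ → i ≡ j
  injective i j eq with endpoint i j eq | endpoint j i (sym eq)
  ... | inj₁ i≡j | _        = i≡j
  ... | inj₂ _   | inj₁ j≡i = sym j≡i
  ... | inj₂ i≡next-j | inj₂ j≡next-i =
    contradiction (sym (trans i≡next-j (cong next j≡next-i))) (next²-≢ 3≤g i)

pendantEdges : ∀ k (H : Hypergraph) → Fin (order H) →
               Fin (suc (size H)) → Subset (order H + (k ∸ 1))
pendantEdges k H v zero    = ⁅ v ⁆ ++ ⊤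
pendantEdges k H v (suc e) = edge H e ++ ⊥

addPendant : ∀ k → 2 ≤ k → (H : Hypergraph) → Fin (order H) → Hypergraph
addPendant k@(suc (suc _)) (s≤s (s≤s _)) H v = record
  { order          = order H + (k ∸ 1)
  ; size           = suc (size H)
  ; edge           = pendantEdges k H v
  ; edge-injective = λ {e} {f} → injective e f
  }
  where
  injective : ∀ e f → pendantEdges k H v e ≡ pendantEdges k H v f → e ≡ f
  injective zero    zero    _  = refl
  injective zero    (suc f) eq with () ← ∷-injectiveˡ (++-injectiveʳ ⁅ v ⁆ (edge H f) eq)
  injective (suc e) zero    eq with () ← ∷-injectiveˡ (++-injectiveʳ (edge H e) ⁅ v ⁆ eq)
  injective (suc e) (suc f) eq = cong suc (edge-injective H (++-injectiveˡ _ _ eq))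

addPendants : ∀ k → 2 ≤ k → ℕ → (H : Hypergraph) → Fin (order H) → Hypergraph
addPendants k 2≤k zero    H v = H
addPendants k@(suc (suc _)) 2≤k@(s≤s (s≤s _)) (suc p) H v =
  addPendants k 2≤k p (addPendant k 2≤k H v) (v ↑ˡ (k ∸ 1))

-- All non-cored vertices of C_g^(k) are equivalent under rotation; the
-- pendant hyperedges are attached to the vertex 0 of the cycle graph.
C[_,_]⊙S[_] : (k g p : ℕ) → 2 ≤ k → 3 ≤ g → Hypergraph
C[ k , g@(suc _) ]⊙S[ p ] 2≤k 3≤g =
  addPendants k 2≤k p (hypercycle k g 3≤g) (zero {n = g ∸ 1} ↑ˡ (g * (k ∸ 2)))

------------------------------------------------------------------------
-- Enumerations

vectors : ∀ {a} {A : Set a} → List A → (n : ℕ) → List (Vec A n)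
vectors xs zero    = [] ∷ []
vectors xs (suc n) = cartesianProductWith _∷_ xs (vectors xs n)

-- All (d₁ , … , dₙ) ∈ ℕⁿ with d₁ + ⋯ + dₙ = d.
weakCompositions : (n d : ℕ) → List (Vec ℕ n)
weakCompositions n d = filter (λ ds → Vec.sum ds ℕ.≟ d) (vectors (upTo (suc d)) n)

------------------------------------------------------------------------
-- Tensors, their traces, and the order

module Spectral {c ℓ₁ ℓ₂ ℓ₃} (R : RealNumbers c ℓ₁ ℓ₂ ℓ₃) where
  open RealNumbers R

  -- Tensors of order k and dimension n, for k ≥ 1; the first index is
  -- separated, so T i γ is the entry with index iγ, γ ∈ [n]^(k-1).
  Tensor : ℕ → ℕ → Set c
  Tensor k n = Fin n → Vec (Fin n) (k ∸ 1) → Carrier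

  support : ∀ {n r} → Vec (Fin n) r → Subset n
  support γ = ⋃ (List.map ⁅_⁆ (Vec.toList γ))

  isEdge? : (H : Hypergraph) (S : Subset (order H)) → Dec (∃[ e ] edge H e ≡ S)
  isEdge? H S = any? (λ e → ≡-dec Bool._≟_ (edge H e) S)

  adjacency : (k : ℕ) (H : Hypergraph) → Tensor k (order H)
  adjacency k H i γ = if does (isEdge? H (support (i ∷ γ))) then recip! (k ∸ 1) else 0#

  degreeTensor : (k : ℕ) (H : Hypergraph) → Tensor k (order H)
  degreeTensor k H i γ =
    if does (≡-dec _≟_ γ (Vec.replicate (k ∸ 1) i)) then fromℕ (degree H i) else 0#

  Aα : Carrier → (k : ℕ) (H : Hypergraph) → Tensor k (order H)
  Aα α k H i γ = (α *ᴿ degreeTensor k H i γ) +ᴿ ((1# -ᴿ α) *ᴿ adjacency k H i γ)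

  -- Polynomial expressions in the indeterminates a_ij (1 ≤ i, j ≤ n).
  data Poly (n : ℕ) : Set c where
    con     : Carrier → Poly n
    var     : Fin n → Fin n → Poly n
    _⊞_ _⊠_ : Poly n → Poly n → Poly n

  ∑ : ∀ {n a} {A : Set a} → List A → (A → Poly n) → Poly n
  ∑ xs f = foldr (λ x p → f x ⊞ p) (con 0#) xs

  -- Partial derivative with respect to a_ij.
  ∂ : ∀ {n} → Fin n → Fin n → Poly n → Poly n
  ∂ i j (con _)   = con 0#
  ∂ i j (var s t) = if does (i ≟ s) ∧ does (j ≟ t) then con 1# else con 0#
  ∂ i j (p ⊞ q)   = ∂ i j p ⊞ ∂ i j q
  ∂ i j (p ⊠ q)   = (∂ i j p ⊠ q) ⊞ (p ⊠ ∂ i j q)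

  -- Value at a_ij = 0, i.e. the constant term.
  constantTerm : ∀ {n} → Poly n → Carrier
  constantTerm (con x)   = x
  constantTerm (var _ _) = 0#
  constantTerm (p ⊞ q)   = constantTerm p +ᴿ constantTerm q
  constantTerm (p ⊠ q)   = constantTerm p *ᴿ constantTerm q

  -- Entries of the N-th power of the generic matrix A = (a_ij).
  genericPower : ∀ {n} → ℕ → Fin n → Fin n → Poly n
  genericPower         zero    i j = if does (i ≟ j) then con 1# else con 0#
  genericPower {n = n} (suc N) i j = ∑ (allFin n) (λ s → var i s ⊠ genericPower N s j)

  tracePower : ∀ n → ℕ → Poly n
  tracePower n N = ∑ (allFin n) (λ i → genericPower N i i)

  -- ∂/∂a_{iγ} = ∂/∂a_{i i₂} ⋯ ∂/∂a_{i i_k}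
  ∂ᵞ : ∀ {n r} → Fin n → Vec (Fin n) r → Poly n → Poly n
  ∂ᵞ i []      p = p
  ∂ᵞ i (j ∷ γ) p = ∂ i j (∂ᵞ i γ p)

  -- ∑_γ T_{iγ} ∂/∂a_{iγ}
  rowOperator : ∀ {k n} → Tensor k n → Fin n → Poly n → Poly n
  rowOperator {k} {n} T i p =
    ∑ (vectors (allFin n) (k ∸ 1)) (λ γ → con (T i γ) ⊠ ∂ᵞ i γ p)

  -- ∏_i 1/(dᵢ(k-1))! (∑_γ T_{iγ} ∂/∂a_{iγ})^{dᵢ}
  productOperator : ∀ {k n} → Tensor k n → Vec ℕ n → Poly n → Poly n
  productOperator {k} {n} T ds p = foldr
    (λ i q → con (recip! (lookup ds i * (k ∸ 1))) ⊠ fold q (rowOperator {k} T i) (lookup ds i))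
    p (allFin n)

  -- The sum of the d-th powers of the eigenvalues of T, given for d = 0 by
  -- the number of eigenvalues and for d ≥ 1 by the differential-operator
  -- formula.  The operators have total order d(k-1), the degree of the form
  -- tr(A^{d(k-1)}), so they turn it into a constant polynomial, whose
  -- value is its constant term.
  Tr : ∀ {k n} → ℕ → Tensor k n → Carrier
  Tr {k} {n} zero T      = fromℕ (n * (k ∸ 1) ^ (n ∸ 1))
  Tr {k} {n} d@(suc _) T = fromℕ ((k ∸ 1) ^ (n ∸ 1)) *ᴿ
    constantTerm (∑ (weakCompositions n d)
      (λ ds → productOperator {k} T ds (tracePower n (d * (k ∸ 1)))))

  Precedes : (k : ℕ) → Carrier → Hypergraph → Hypergraph → Set (ℓ₁ ⊔ ℓ₃)
  Precedes k α H₁ H₂ = order H₁ ≡ order H₂ ×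
    (∃[ d ] 1 ≤ d × d ≤ order H₁ * (k ∸ 1) ^ (order H₁ ∸ 1) ∸ 1 ×
      (∀ t → t < d → Tr {k} t (Aα α k H₁) ≈ Tr {k} t (Aα α k H₂)) ×
      Tr {k} d (Aα α k H₁) <ᴿ Tr {k} d (Aα α k H₂))

-- X is the last member of the class 𝒞 with respect to ≺.
IsLast : ∀ {a b} → (Hypergraph → Set a) → Rel Hypergraph b → Hypergraph → Set _
IsLast 𝒞 _≺_ X = 𝒞 X × (∀ H → 𝒞 H → ¬ Isomorphic H X → H ≺ X)

{-# OPTIONS --safe #-}

-- Evaluated at 0, an iterated derivative of tr(A^N) vanishes unless the arcs
-- (i , j) of the derivatives ∂/∂a_ij can be arranged into a closed walk.  Hence
-- Tr₁ is determined by ∑ d_v, and Tr₂ by ∑ d_v and ∑ d_v²; the latter has the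
-- positive weight α².  A k-uniform unicyclic hypergraph with m hyperedges has
-- m(k-1) vertices, so Tr₀ and Tr₁ are constant on the class, and the order is
-- decided by ∑ d_v².
--
-- Write d_v = 1 + χ_v + f_v, where χ is the indicator function of the vertices
-- of the cycle.  Then ∑ f_v = m - g and ∑ d_v² is a constant plus
-- ∑ f_v (2χ_v + f_v), which is largest exactly when all the excess f sits at one
-- vertex of the cycle.  In that case the hypergraph is the cycle with m - g
-- pendant hyperedges at that vertex.

module Submission where

open import Defs
open import Algebra.Apartness.Bundles using (HeytingField)
open import Algebra.Bundles using (CommutativeMonoid; CommutativeRing)
import Algebra.Properties.CommutativeMonoid.Sum as MonoidSum
import Algebra.Properties.Ring as RingProperties
import Algebra.Properties.Semiring.Mult as SemiringMult
import Algebra.Properties.Semiring.Sum as SemiringSum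
import Algebra.Solver.CommutativeMonoid as CommutativeMonoidSolver
open import Data.Bool.Base using (true; false; if_then_else_)
import Data.Bool.Properties as Bool
open import Data.Fin.Base
  using (Fin; zero; suc; toℕ; fromℕ; inject₁; opposite; punchIn; punchOut; _↑ˡ_; _↑ʳ_; combine; splitAt; join)
open import Data.Fin.Induction using (<-weakInduction; <-weakInduction-startingFrom)
open import Data.Fin.Permutation as Perm using (Permutation; _⟨$⟩ʳ_; _⟨$⟩ˡ_)
open import Data.Fin.Properties
  using ( _≟_; any?; suc-injective; toℕ-injective; toℕ-fromℕ; toℕ-fromℕ<; toℕ-inject₁; toℕ<n; ≤fromℕ
        ; punchIn-punchOut; opposite-involutive; ↑ˡ-injective; join-splitAt; combine-surjective; injective⇒≤ )
open import Data.Fin.Relation.Unary.Top using (View; ‵fromℕ; ‵inj₁; view; view-fromℕ; view-inject₁)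
open import Data.Fin.Subset using (Subset; inside; outside; _∈_; _∉_; _⊆_; ⁅_⁆; _∪_; _∩_; ∣_∣; ⊥; ⊤)
open import Data.Fin.Subset.Properties
  using ( _∈?_; x∈⁅x⁆; x∈⁅y⁆⇒x≡y; x∈p∪q⁺; x∈p∪q⁻; x∈p∩q⁺; x∈p∩q⁻; p⊆q⇒∣p∣≤∣q∣; ⊆-antisym; Empty-unique
        ; ∉⊥; ∈⊤; ∣⁅x⁆∣≡1; ∣⊥∣≡0; ∣⊤∣≡n; ∣p∣≤n )
open import Data.List.Base as List
  using (List; []; _∷_; foldr; filter; upTo; applyUpTo; allFin; cartesianProductWith)
open import Data.List.Membership.Propositional using () renaming (_∈_ to _∈ᴸ_)
open import Data.List.Relation.Binary.Permutation.Propositional as ↭ using (_↭_; ↭-sym)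
open import Data.List.Relation.Binary.Permutation.Propositional.Properties using (All-resp-↭; ∈-resp-↭)
open import Data.List.Relation.Unary.All as All using (All; []; _∷_)
open import Data.List.Relation.Unary.Any using (here; there)
open import Data.Nat.Base using (ℕ; zero; suc; _+_; _*_; _∸_; _^_; _!; _≤_; _<_; z≤n; s≤s)
open import Data.Nat.DivMod using (_%_; m%n<n; m<n⇒m%n≡m; n%n≡0)
open import Data.Nat.GeneralisedArithmetic using (fold)
import Data.Nat.Properties as ℕ
import Data.Nat.Tactic.RingSolver as NatSolver
open import Data.Product.Base using (∃-syntax; _×_; _,_; proj₁; proj₂)
open import Data.Sum.Base using (_⊎_; inj₁; inj₂; [_,_]′)
open import Data.Sum.Properties using () renaming (≡-dec to ⊎-≡-dec)
open import Data.Unit.Base using (tt) renaming (⊤ to Unit)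
import Data.Unit.Properties as Unit
open import Data.Vec.Base as Vec using (Vec; []; _∷_; _++_; concat; lookup; replicate; tabulate)
open import Data.Vec.Membership.Propositional using () renaming (_∈_ to _∈ⱽ_)
open import Data.Vec.Properties
  using (≡-dec; lookup∘tabulate; lookup-++ˡ; lookup-++ʳ; lookup-concat; []=⇒lookup; lookup⇒[]=)
open import Data.Vec.Relation.Unary.All as VAll using ([]; _∷_) renaming (All to Allⱽ)
open import Data.Vec.Relation.Unary.Any using (here; there)
open import Function.Base using (_∘_; id)
open import Function.Bundles using (Equivalence; mk⇔)
open import Relation.Binary.Construct.Closure.ReflexiveTransitive using (Star; ε; _◅_; _◅◅_; gmap)
open import Relation.Binary.Definitions using (DecidableEquality)
open import Relation.Binary.PropositionalEquality
import Relation.Binary.Reasoning.Setoid as SetoidReasoning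
open import Relation.Binary.Structures using (IsStrictPartialOrder)
open import Relation.Nullary.Decidable using (Dec; yes; no; does; dec-true; ¬?; _×-dec_)
open import Relation.Nullary.Negation using (¬_; contradiction)
open import Algebra.Properties.Semiring.Sum ℕ.+-*-semiring
  using (sum; sum-cong-≗; ∑-distrib-+; ∑-comm; sum-remove; *-distribˡ-sum; *-distribʳ-sum)

-- Finite sums

-- Uniqueness of the cycle gives the number of vertices: a connected part is grown by one hyperedge
-- at a time, and a hyperedge meeting it in one vertex too many would create a cycle with a pair
-- that the known cycle does not traverse. So each hyperedge brings `k-1` vertices, except the
-- closing one, which brings `k-2` and so makes up for the initial vertex.
--
-- The delicate point of the second trace is that two rows `i ≠ j` may interact. All arcs then start
-- at `i` or `j`, so a closed walk stays in `{i , j}`, which forces a hyperedge with two vertices.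
-- There is thus no interaction for `k ≥ 3`; for `k = 2` it amounts to `(1-α)² ∑ d_v`, up to the
-- common factor, again a constant on the class.
--
-- With `p = m - g`, excess concentrated at one cycle vertex gives `p(p+2)`; otherwise each factor
-- `2χ_v + f_v` is at most `p+1`. A tie must be turned into an isomorphism knowing only degrees:
-- incidence is shown to depend on labels alone, and the bijections come from counting labels.

module _ {a ℓ} (M : CommutativeMonoid a ℓ) where
  private module M = CommutativeMonoid M
  open MonoidSum M using () renaming (sum to sumᴹ)

  sum-zero : ∀ {n} {f : Fin n → M.Carrier} → (∀ v → f v M.≈ M.ε) → sumᴹ f M.≈ M.ε
  sum-zero {zero}  z = M.refl
  sum-zero {suc n} z = M.trans (M.∙-cong (z zero) (sum-zero (z ∘ suc))) (M.identityˡ M.ε)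

  sum-single : ∀ {n} (f : Fin n → M.Carrier) c → (∀ v → c ≢ v → f v M.≈ M.ε) → sumᴹ f M.≈ f c
  sum-single f zero z =
    M.trans (M.∙-congˡ (sum-zero (λ v → z (suc v) λ ()))) (M.identityʳ (f zero))
  sum-single f (suc c) z = M.trans
    (M.∙-cong (z zero λ ()) (sum-single (f ∘ suc) c (λ v c≢v → z (suc v) (c≢v ∘ suc-injective))))
    (M.identityˡ (f (suc c)))

ind : ∀ {p} {P : Set p} → Dec P → ℕ
ind d = if does d then 1 else 0

ind-yes : ∀ {p} {P : Set p} (d : Dec P) → P → ind d ≡ 1
ind-yes (yes _) _ = refl
ind-yes (no ¬p) p = contradiction p ¬p

ind-no : ∀ {p} {P : Set p} (d : Dec P) → ¬ P → ind d ≡ 0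
ind-no (yes p) ¬p = contradiction p ¬p
ind-no (no _)  _  = refl

ind-cong : ∀ {p q} {P : Set p} {Q : Set q} (d : Dec P) (e : Dec Q) →
           (P → Q) → (Q → P) → ind d ≡ ind e
ind-cong (yes p) e to from = sym (ind-yes e (to p))
ind-cong (no ¬p) e to from = sym (ind-no e (¬p ∘ from))

ind-× : ∀ {p q} {P : Set p} {Q : Set q} (d : Dec P) (e : Dec Q) →
        ind (d ×-dec e) ≡ ind d * ind e
ind-× (yes _) (yes _) = refl
ind-× (yes _) (no _)  = refl
ind-× (no _)  _       = refl

ind-¬ : ∀ {p} {P : Set p} (d : Dec P) → ind d + ind (¬? d) ≡ 1
ind-¬ (yes _) = refl
ind-¬ (no _)  = refl

sum-ones : ∀ n → sum {n} (λ _ → 1) ≡ n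
sum-ones zero    = refl
sum-ones (suc n) = cong suc (sum-ones n)

sum-const : ∀ n c → sum {n} (λ _ → c) ≡ n * c
sum-const zero    c = refl
sum-const (suc n) c = cong (c +_) (sum-const n c)

sum-mono : ∀ {n} {f g : Fin n → ℕ} → (∀ v → f v ≤ g v) → sum f ≤ sum g
sum-mono {zero}  _ = z≤n
sum-mono {suc n} h = ℕ.+-mono-≤ (h zero) (sum-mono (h ∘ suc))

term≤sum : ∀ {n} (f : Fin n → ℕ) v → f v ≤ sum f
term≤sum f zero    = ℕ.m≤m+n _ _
term≤sum f (suc v) = ℕ.≤-trans (term≤sum (f ∘ suc) v) (ℕ.m≤n+m _ _)

sum-δ : ∀ {n} c (h : Fin n → ℕ) → sum (λ v → ind (c ≟ v) * h v) ≡ h c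
sum-δ c h = trans
  (sum-single ℕ.+-0-commutativeMonoid (λ v → ind (c ≟ v) * h v) c
    (λ v c≢v → cong (_* h v) (ind-no (c ≟ v) c≢v)))
  (trans (cong (_* h c) (ind-yes (c ≟ c) refl)) (ℕ.*-identityˡ (h c)))

∣p∣≡sum : ∀ {n} (p : Subset n) → ∣ p ∣ ≡ sum (λ v → ind (v ∈? p))
∣p∣≡sum []            = refl
∣p∣≡sum (inside  ∷ p) = cong suc (∣p∣≡sum p)
∣p∣≡sum (outside ∷ p) = ∣p∣≡sum p

∣p∪q∣+∣p∩q∣ : ∀ {n} (p q : Subset n) → ∣ p ∪ q ∣ + ∣ p ∩ q ∣ ≡ ∣ p ∣ + ∣ q ∣
∣p∪q∣+∣p∩q∣ []            []            = refl
∣p∪q∣+∣p∩q∣ (inside  ∷ p) (inside  ∷ q) = cong suc (trans (ℕ.+-suc _ _)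
  (trans (cong suc (∣p∪q∣+∣p∩q∣ p q)) (sym (ℕ.+-suc _ _))))
∣p∪q∣+∣p∩q∣ (inside  ∷ p) (outside ∷ q) = cong suc (∣p∪q∣+∣p∩q∣ p q)
∣p∪q∣+∣p∩q∣ (outside ∷ p) (inside  ∷ q) =
  trans (cong suc (∣p∪q∣+∣p∩q∣ p q)) (sym (ℕ.+-suc _ _))
∣p∪q∣+∣p∩q∣ (outside ∷ p) (outside ∷ q) = ∣p∪q∣+∣p∩q∣ p q

degree≡sum : ∀ H v → degree H v ≡ sum (λ e → ind (v ∈? edge H e))
degree≡sum H v = trans (∣p∣≡sum (tabulate λ e → lookup (edge H e) v))
  (sum-cong-≗ λ e → ind-cong (e ∈? _) (v ∈? edge H e)
    (λ e∈ → lookup⇒[]= v (edge H e) (trans (sym (lookup∘tabulate _ e)) ([]=⇒lookup e∈)))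
    (λ v∈ → lookup⇒[]= e _ (trans (lookup∘tabulate _ e) ([]=⇒lookup v∈))))

handshake : ∀ k H → Uniform k H → sum (degree H) ≡ size H * k
handshake k H unif = begin
  sum (degree H)                                     ≡⟨ sum-cong-≗ (degree≡sum H) ⟩
  sum (λ v → sum λ e → ind (v ∈? edge H e))          ≡⟨ ∑-comm (λ v e → ind (v ∈? edge H e)) ⟩
  sum (λ e → sum λ v → ind (v ∈? edge H e))          ≡⟨ sum-cong-≗ (λ e → trans (sym (∣p∣≡sum (edge H e))) (unif e)) ⟩
  sum {size H} (λ _ → k)                             ≡⟨ sum-const (size H) k ⟩
  size H * k                                         ∎
  where open ≡-Reasoning

module _ {r n} (c : Fin r → Fin n) (c-inj : ∀ {i j} → c i ≡ c j → i ≡ j) where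

  image? : (v : Fin n) → Dec (∃[ i ] c i ≡ v)
  image? v = any? λ i → c i ≟ v

  sum-image : ∀ v → sum (λ i → ind (c i ≟ v)) ≡ ind (image? v)
  sum-image v with image? v
  ... | yes (i , refl) = trans
    (sum-single ℕ.+-0-commutativeMonoid (λ j → ind (c j ≟ c i)) i
      (λ j i≢j → ind-no (c j ≟ c i) (i≢j ∘ sym ∘ c-inj)))
    (ind-yes (c i ≟ c i) refl)
  ... | no ∉im = sum-zero ℕ.+-0-commutativeMonoid (λ i → ind-no (c i ≟ v) (λ eq → ∉im (i , eq)))

  sum-restrict : ∀ h → sum (λ v → ind (image? v) * h v) ≡ sum (h ∘ c)
  sum-restrict h = begin
    sum (λ v → ind (image? v) * h v)                 ≡⟨ sum-cong-≗ (λ v → cong (_* h v) (sym (sum-image v))) ⟩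
    sum (λ v → sum (λ i → ind (c i ≟ v)) * h v)      ≡⟨ sum-cong-≗ (λ v → *-distribʳ-sum (h v) (λ i → ind (c i ≟ v))) ⟩
    sum (λ v → sum (λ i → ind (c i ≟ v) * h v))      ≡⟨ ∑-comm (λ v i → ind (c i ≟ v) * h v) ⟩
    sum (λ i → sum (λ v → ind (c i ≟ v) * h v))      ≡⟨ sum-cong-≗ (λ i → sum-δ (c i) h) ⟩
    sum (h ∘ c)                                      ∎
    where open ≡-Reasoning

  sum-split : ∀ h → sum h ≡ sum (h ∘ c) + sum (λ v → ind (¬? (image? v)) * h v)
  sum-split h = begin
    sum h                                                              ≡⟨ sum-cong-≗ pointwise ⟩
    sum (λ v → ind (image? v) * h v + ind (¬? (image? v)) * h v)       ≡⟨ ∑-distrib-+ (λ v → ind (image? v) * h v) _ ⟩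
    sum (λ v → ind (image? v) * h v) + sum (λ v → ind (¬? (image? v)) * h v)
                                                                       ≡⟨ cong (_+ sum (λ v → ind (¬? (image? v)) * h v)) (sum-restrict h) ⟩
    sum (h ∘ c) + sum (λ v → ind (¬? (image? v)) * h v)                ∎
    where
    open ≡-Reasoning
    pointwise : ∀ v → h v ≡ ind (image? v) * h v + ind (¬? (image? v)) * h v
    pointwise v = trans (sym (ℕ.*-identityˡ (h v)))
      (trans (cong (_* h v) (sym (ind-¬ (image? v)))) (ℕ.*-distribʳ-+ (h v) (ind (image? v)) _))

  sum-∘≤ : ∀ h → sum (h ∘ c) ≤ sum h
  sum-∘≤ h = ℕ.≤-trans (ℕ.m≤m+n _ _) (ℕ.≤-reflexive (sym (sum-split h)))

  injection⇒≤ : ∀ {p} {P : Fin n → Set p} (P? : ∀ v → Dec (P v)) → (∀ i → P (c i)) →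
                r ≤ sum (λ v → ind (P? v))
  injection⇒≤ P? Pc = ℕ.≤-trans
    (ℕ.≤-reflexive (trans (sym (sum-ones r)) (sum-cong-≗ λ i → sym (ind-yes (P? (c i)) (Pc i)))))
    (sum-∘≤ (λ v → ind (P? v)))

three : ∀ {a} {A : Set a} → A → A → A → Fin 3 → A
three x y z zero             = x
three x y z (suc zero)       = y
three x y z (suc (suc zero)) = z

three-injective : ∀ {a} {A : Set a} {x y z : A} → x ≢ y → x ≢ z → y ≢ z →
                  ∀ {i j} → three x y z i ≡ three x y z j → i ≡ j
three-injective xy xz yz {zero}         {zero}         _  = refl
three-injective xy xz yz {zero}         {suc zero}     eq = contradiction eq xy
three-injective xy xz yz {zero}         {suc (suc zero)} eq = contradiction eq xz
three-injective xy xz yz {suc zero}     {zero}         eq = contradiction (sym eq) xy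
three-injective xy xz yz {suc zero}     {suc zero}     _  = refl
three-injective xy xz yz {suc zero}     {suc (suc zero)} eq = contradiction eq yz
three-injective xy xz yz {suc (suc zero)} {zero}       eq = contradiction (sym eq) xz
three-injective xy xz yz {suc (suc zero)} {suc zero}   eq = contradiction (sym eq) yz
three-injective xy xz yz {suc (suc zero)} {suc (suc zero)} _ = refl

three-distinct⇒3≤ : ∀ {n p} {P : Fin n → Set p} (P? : ∀ v → Dec (P v)) {x y z : Fin n} →
  x ≢ y → x ≢ z → y ≢ z → P x → P y → P z → 3 ≤ sum (λ v → ind (P? v))
three-distinct⇒3≤ {P = P} P? {x} {y} {z} xy xz yz px py pz =
  injection⇒≤ (three x y z) (three-injective xy xz yz) P? all
  where
  all : ∀ i → P (three x y z i)
  all zero             = px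
  all (suc zero)       = py
  all (suc (suc zero)) = pz

two-distinct⇒2≤ : ∀ {n p} {P : Fin n → Set p} (P? : ∀ v → Dec (P v)) {x y : Fin n} →
  x ≢ y → P x → P y → 2 ≤ sum (λ v → ind (P? v))
two-distinct⇒2≤ {n} {P = P} P? {x} {y} x≢y px py = injection⇒≤ c (λ {i} {j} → inj i j) P? all
  where
  c : Fin 2 → Fin n
  c zero       = x
  c (suc zero) = y
  inj : ∀ i j → c i ≡ c j → i ≡ j
  inj zero       zero       _  = refl
  inj zero       (suc zero) eq = contradiction eq x≢y
  inj (suc zero) zero       eq = contradiction (sym eq) x≢y
  inj (suc zero) (suc zero) _  = refl
  all : ∀ i → P (c i)
  all zero       = px
  all (suc zero) = py

-- Pair `zero` with some `j` that has the same label; this removes one occurrence of that label on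
-- both sides, so the counts stay equal. The equality of `n` and `n′` is not assumed but forced by
-- the counts.
labelled-bijection : ∀ {a} {A : Set a} (_≟ᴬ_ : DecidableEquality A) {n n′}
  (f : Fin n → A) (f′ : Fin n′ → A) →
  (∀ a → sum (λ v → ind (f v ≟ᴬ a)) ≡ sum (λ v → ind (f′ v ≟ᴬ a))) →
  ∃[ π ] (∀ v → f′ (π ⟨$⟩ʳ v) ≡ f v)
labelled-bijection _≟ᴬ_ {zero} {zero}  f f′ counts = Perm.id , λ ()
labelled-bijection _≟ᴬ_ {zero} {suc n′} f f′ counts = contradiction
  (ℕ.≤-trans (ℕ.≤-trans (ℕ.≤-reflexive (sym (ind-yes (f′ zero ≟ᴬ f′ zero) refl)))
      (term≤sum (λ v → ind (f′ v ≟ᴬ f′ zero)) zero))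
    (ℕ.≤-reflexive (sym (counts (f′ zero)))))
  λ ()
labelled-bijection _≟ᴬ_ {suc n} {n′} f f′ counts
  with any? (λ j → f′ j ≟ᴬ f zero)
... | no none = contradiction (trans (sym (cong (_+ sum (λ v → ind (f (suc v) ≟ᴬ f zero))) (ind-yes (f zero ≟ᴬ f zero) refl)))
    (trans (counts (f zero))
      (sum-zero ℕ.+-0-commutativeMonoid (λ j → ind-no (f′ j ≟ᴬ f zero) λ eq → none (j , eq)))))
  ℕ.1+n≢0
labelled-bijection _≟ᴬ_ {suc n} {suc n′} f f′ counts | yes (j , f′j≡f0)
  with π , eq ← labelled-bijection _≟ᴬ_ (f ∘ suc) (f′ ∘ punchIn j) (λ a →
      ℕ.+-cancelˡ-≡ (ind (f zero ≟ᴬ a)) _ _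
        (trans (counts a) (trans (sum-remove {i = j} (λ v → ind (f′ v ≟ᴬ a)))
          (cong (λ x → ind (x ≟ᴬ a) + sum (λ v → ind (f′ (punchIn j v) ≟ᴬ a))) f′j≡f0))))
  = Perm.insert zero j π , labels
  where
  labels : ∀ v → f′ (Perm.insert zero j π ⟨$⟩ʳ v) ≡ f v
  labels zero    = f′j≡f0
  labels (suc v) = trans (cong f′ (Perm.insert-punchIn zero j π v)) (eq v)

-- Cycles and the order of a unicyclic hypergraph

next-inject₁ : ∀ {n} (i : Fin n) → next (inject₁ i) ≡ suc i
next-inject₁ {n} i = toℕ-injective (trans (toℕ-fromℕ< (m%n<n (suc (toℕ (inject₁ i))) (suc n)))
  (trans (m<n⇒m%n≡m (s≤s (subst (_< n) (sym (toℕ-inject₁ i)) (toℕ<n i)))) (cong suc (toℕ-inject₁ i))))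

next-fromℕ : ∀ n → next (fromℕ n) ≡ zero
next-fromℕ n = toℕ-injective (trans (toℕ-fromℕ< (m%n<n (suc (toℕ (fromℕ n))) (suc n)))
  (trans (cong (λ x → suc x % suc n) (toℕ-fromℕ n)) (n%n≡0 (suc n))))

-- The case distinction that fits `next`: it wraps round at the top index and is `suc` on all the
-- others.
top-elim : ∀ {p n} (P : Fin (suc n) → Set p) → P (fromℕ n) → (∀ i → P (inject₁ i)) → ∀ i → P i
top-elim P Pn Pi i with view i
... | ‵fromℕ          = Pn
... | ‵inj₁ {i = j} _ = Pi j

next-injective : ∀ {n} {i j : Fin n} → next i ≡ next j → i ≡ j
next-injective {suc n} {i} {j} = top-elim (λ i → ∀ j → next i ≡ next j → i ≡ j)
  (top-elim (λ j → next (fromℕ n) ≡ next j → fromℕ n ≡ j) (λ _ → refl)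
    (λ j eq → contradiction (trans (sym (next-fromℕ n)) (trans eq (next-inject₁ j))) λ ()))
  (λ i → top-elim (λ j → next (inject₁ i) ≡ next j → inject₁ i ≡ j)
    (λ eq → contradiction (trans (sym (next-fromℕ n)) (trans (sym eq) (next-inject₁ i))) λ ())
    (λ j eq → cong inject₁ (suc-injective (trans (sym (next-inject₁ i)) (trans eq (next-inject₁ j))))))
  i j

next-surjective : ∀ {n} (i : Fin n) → ∃[ j ] next j ≡ i
next-surjective {suc n} zero    = fromℕ n , next-fromℕ n
next-surjective {suc n} (suc i) = inject₁ i , next-inject₁ i

next≢ : ∀ {n} → 2 ≤ n → (i : Fin n) → next i ≢ i
next≢ {suc (suc n)} _ = top-elim (λ i → next i ≢ i)
  (λ eq → contradiction (trans (sym (next-fromℕ (suc n))) eq) λ ())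
  (λ i eq → ℕ.1+n≢n (trans (cong toℕ (trans (sym (next-inject₁ i)) eq)) (toℕ-inject₁ i)))
next≢ {suc zero} (s≤s ())

opposite-inject₁ : ∀ {n} (i : Fin n) → opposite (inject₁ i) ≡ suc (opposite i)
opposite-inject₁ zero    = refl
opposite-inject₁ (suc i) = cong inject₁ (opposite-inject₁ i)

opposite-fromℕ : ∀ n → opposite (fromℕ n) ≡ zero
opposite-fromℕ zero    = refl
opposite-fromℕ (suc n) = cong inject₁ (opposite-fromℕ n)

opposite-injective : ∀ {n} {i j : Fin n} → opposite i ≡ opposite j → i ≡ j
opposite-injective {i = i} {j} eq =
  trans (sym (opposite-involutive i)) (trans (cong opposite eq) (opposite-involutive j))

∣p∣≡1 : ∀ {n} {p : Subset n} {x} → x ∈ p → (∀ {y} → y ∈ p → y ≡ x) → ∣ p ∣ ≡ 1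
∣p∣≡1 {p = p} {x} x∈p only = trans (cong ∣_∣ (⊆-antisym
    (λ y∈p → subst (_∈ ⁅ x ⁆) (sym (only y∈p)) (x∈⁅x⁆ x))
    (λ y∈ → subst (_∈ p) (sym (x∈⁅y⁆⇒x≡y x y∈)) x∈p)))
  (∣⁅x⁆∣≡1 x)

∣p∪⁅x⁆∣ : ∀ {n} {p : Subset n} {x} → x ∉ p → ∣ p ∪ ⁅ x ⁆ ∣ ≡ suc ∣ p ∣
∣p∪⁅x⁆∣ {n} {p} {x} x∉p = begin
  ∣ p ∪ ⁅ x ⁆ ∣                        ≡⟨ ℕ.+-identityʳ _ ⟨
  ∣ p ∪ ⁅ x ⁆ ∣ + 0                    ≡⟨ cong (∣ p ∪ ⁅ x ⁆ ∣ +_) (trans (cong ∣_∣ disjoint) (∣⊥∣≡0 n)) ⟨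
  ∣ p ∪ ⁅ x ⁆ ∣ + ∣ p ∩ ⁅ x ⁆ ∣        ≡⟨ ∣p∪q∣+∣p∩q∣ p ⁅ x ⁆ ⟩
  ∣ p ∣ + ∣ ⁅ x ⁆ ∣                    ≡⟨ cong (∣ p ∣ +_) (∣⁅x⁆∣≡1 x) ⟩
  ∣ p ∣ + 1                            ≡⟨ ℕ.+-comm ∣ p ∣ 1 ⟩
  suc ∣ p ∣                            ∎
  where
  open ≡-Reasoning
  disjoint : p ∩ ⁅ x ⁆ ≡ ⊥
  disjoint = Empty-unique λ (y , y∈) → let y∈p , y∈x = x∈p∩q⁻ p ⁅ x ⁆ y∈ in
    x∉p (subst (_∈ p) (x∈⁅y⁆⇒x≡y x y∈x) y∈p)

∣p∣≡2 : ∀ {n} {p : Subset n} {x y} → x ∈ p → y ∈ p → y ≢ x →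
        (∀ {z} → z ∈ p → z ≡ x ⊎ z ≡ y) → ∣ p ∣ ≡ 2
∣p∣≡2 {p = p} {x} {y} x∈p y∈p y≢x only = trans (cong ∣_∣ (⊆-antisym p⊆ ⊆p))
  (trans (∣p∪⁅x⁆∣ (y≢x ∘ x∈⁅y⁆⇒x≡y x)) (cong suc (∣⁅x⁆∣≡1 x)))
  where
  p⊆ : p ⊆ ⁅ x ⁆ ∪ ⁅ y ⁆
  p⊆ z∈p with only z∈p
  ... | inj₁ refl = x∈p∪q⁺ (inj₁ (x∈⁅x⁆ x))
  ... | inj₂ refl = x∈p∪q⁺ (inj₂ (x∈⁅x⁆ y))
  ⊆p : ⁅ x ⁆ ∪ ⁅ y ⁆ ⊆ p
  ⊆p z∈ with x∈p∪q⁻ ⁅ x ⁆ ⁅ y ⁆ z∈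
  ... | inj₁ z∈x = subst (_∈ p) (sym (x∈⁅y⁆⇒x≡y x z∈x)) x∈p
  ... | inj₂ z∈y = subst (_∈ p) (sym (x∈⁅y⁆⇒x≡y y z∈y)) y∈p

-- Growing a connected part hyperedge by hyperedge

module _ (H : Hypergraph) where
  private
    V E : Set
    V = Fin (order H)
    E = Fin (size H)

  -- Vertices are confined to `U` and hyperedges to `F`, so that a vertex outside `U` or a hyperedge
  -- outside `F` can be attached without breaking injectivity.
  record Path (F : Subset (size H)) (U : Subset (order H)) (u w : V) : Set where
    field
      len       : ℕ
      vert      : Fin (suc len) → V
      hedge     : Fin len → E
      vert-inj  : ∀ {i j} → vert i ≡ vert j → i ≡ j
      hedge-inj : ∀ {i j} → hedge i ≡ hedge j → i ≡ j
      vert∈U    : ∀ i → vert i ∈ U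
      hedge∈F   : ∀ i → hedge i ∈ F
      start     : vert zero ≡ u
      end       : vert (fromℕ len) ≡ w
      left∈     : ∀ i → vert (inject₁ i) ∈ edge H (hedge i)
      right∈    : ∀ i → vert (suc i) ∈ edge H (hedge i)

  weaken : ∀ {F F′ U U′ u w} → F ⊆ F′ → U ⊆ U′ → Path F U u w → Path F′ U′ u w
  weaken F⊆ U⊆ p = record
    { len = len ; vert = vert ; hedge = hedge ; vert-inj = vert-inj ; hedge-inj = hedge-inj
    ; vert∈U = U⊆ ∘ vert∈U ; hedge∈F = F⊆ ∘ hedge∈F
    ; start = start ; end = end ; left∈ = left∈ ; right∈ = right∈ }
    where open Path p

  reverse : ∀ {F U u w} → Path F U u w → Path F U w u
  reverse p = record
    { len = len ; vert = vert ∘ opposite ; hedge = hedge ∘ opposite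
    ; vert-inj = opposite-injective ∘ vert-inj ; hedge-inj = opposite-injective ∘ hedge-inj
    ; vert∈U = vert∈U ∘ opposite ; hedge∈F = hedge∈F ∘ opposite
    ; start = end ; end = trans (cong vert (opposite-fromℕ len)) start
    ; left∈ = λ i → subst (λ j → vert j ∈ edge H (hedge (opposite i)))
                      (sym (opposite-inject₁ i)) (right∈ (opposite i))
    ; right∈ = left∈ ∘ opposite }
    where open Path p

  module _ {F : Subset (size H)} {U : Subset (order H)} {e : E} (e∉F : e ∉ F) where

    F⊆ : F ⊆ F ∪ ⁅ e ⁆
    F⊆ f∈ = x∈p∪q⁺ (inj₁ f∈)

    e∈ : e ∈ F ∪ ⁅ e ⁆
    e∈ = x∈p∪q⁺ (inj₂ (x∈⁅x⁆ e))

    U⊆ : U ⊆ U ∪ edge H e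
    U⊆ u∈ = x∈p∪q⁺ (inj₁ u∈)

    edge⊆ : edge H e ⊆ U ∪ edge H e
    edge⊆ u∈ = x∈p∪q⁺ (inj₂ u∈)

    extend : ∀ {x y w} → x ∈ edge H e → y ∈ edge H e → y ∉ U → Path F U x w →
             Path (F ∪ ⁅ e ⁆) (U ∪ edge H e) y w
    extend {x} {y} {w} x∈e y∈e y∉U p = record
      { len = suc len ; vert = vert′ ; hedge = hedge′
      ; vert-inj = λ {i} {j} → vert′-inj i j ; hedge-inj = λ {i} {j} → hedge′-inj i j
      ; vert∈U = vert′∈U ; hedge∈F = hedge′∈F
      ; start = refl ; end = end ; left∈ = left′∈ ; right∈ = right′∈ }
      where
      open Path p
      vert′ : Fin (suc (suc len)) → V
      vert′ zero    = y
      vert′ (suc i) = vert i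
      hedge′ : Fin (suc len) → E
      hedge′ zero    = e
      hedge′ (suc i) = hedge i
      vert′-inj : ∀ i j → vert′ i ≡ vert′ j → i ≡ j
      vert′-inj zero    zero    _  = refl
      vert′-inj zero    (suc j) eq = contradiction (subst (_∈ U) (sym eq) (vert∈U j)) y∉U
      vert′-inj (suc i) zero    eq = contradiction (subst (_∈ U) eq (vert∈U i)) y∉U
      vert′-inj (suc i) (suc j) eq = cong suc (vert-inj eq)
      hedge′-inj : ∀ i j → hedge′ i ≡ hedge′ j → i ≡ j
      hedge′-inj zero    zero    _  = refl
      hedge′-inj zero    (suc j) eq = contradiction (subst (_∈ F) (sym eq) (hedge∈F j)) e∉F
      hedge′-inj (suc i) zero    eq = contradiction (subst (_∈ F) eq (hedge∈F i)) e∉F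
      hedge′-inj (suc i) (suc j) eq = cong suc (hedge-inj eq)
      vert′∈U : ∀ i → vert′ i ∈ U ∪ edge H e
      vert′∈U zero    = edge⊆ y∈e
      vert′∈U (suc i) = U⊆ (vert∈U i)
      hedge′∈F : ∀ i → hedge′ i ∈ F ∪ ⁅ e ⁆
      hedge′∈F zero    = e∈
      hedge′∈F (suc i) = F⊆ (hedge∈F i)
      left′∈ : ∀ i → vert′ (inject₁ i) ∈ edge H (hedge′ i)
      left′∈ zero    = y∈e
      left′∈ (suc i) = left∈ i
      right′∈ : ∀ i → vert′ (suc i) ∈ edge H (hedge′ i)
      right′∈ zero    = subst (_∈ edge H e) (sym start) x∈e
      right′∈ (suc i) = right∈ i

    single : ∀ {u w} → u ∈ edge H e → w ∈ edge H e → u ≢ w → Path (F ∪ ⁅ e ⁆) (U ∪ edge H e) u w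
    single {u} {w} u∈e w∈e u≢w = record
      { len = 1 ; vert = vert′ ; hedge = λ _ → e
      ; vert-inj = λ {i} {j} → vert′-inj i j ; hedge-inj = λ { {zero} {zero} _ → refl }
      ; vert∈U = edge⊆ ∘ vert′∈e ; hedge∈F = λ _ → e∈
      ; start = refl ; end = refl ; left∈ = vert′∈e ∘ inject₁ ; right∈ = vert′∈e ∘ suc }
      where
      vert′ : Fin 2 → V
      vert′ zero       = u
      vert′ (suc zero) = w
      vert′∈e : ∀ i → vert′ i ∈ edge H e
      vert′∈e zero       = u∈e
      vert′∈e (suc zero) = w∈e
      vert′-inj : ∀ i j → vert′ i ≡ vert′ j → i ≡ j
      vert′-inj zero       zero       _  = refl
      vert′-inj zero       (suc zero) eq = contradiction eq u≢w
      vert′-inj (suc zero) zero       eq = contradiction (sym eq) u≢w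
      vert′-inj (suc zero) (suc zero) _  = refl

    -- A path inside `F` is closed to a cycle by the outside hyperedge `e`, which becomes the
    -- hyperedge at the top index and leads from `w` back to `u`.
    module Closing {u w} (p : Path F U u w) (u≢w : u ≢ w) (u∈e : u ∈ edge H e) (w∈e : w ∈ edge H e) where
      open Path p

      private
        hedgeAt : ∀ {i} → View {suc len} i → E
        hedgeAt ‵fromℕ          = e
        hedgeAt (‵inj₁ {i = i} _) = hedge i

        hedge′ : Fin (suc len) → E
        hedge′ i = hedgeAt (view i)

        hedge′-fromℕ : hedge′ (fromℕ len) ≡ e
        hedge′-fromℕ = cong hedgeAt (view-fromℕ len)

        hedge′-inject₁ : ∀ i → hedge′ (inject₁ i) ≡ hedge i
        hedge′-inject₁ i = cong hedgeAt (view-inject₁ i)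

        hedge≢e : ∀ i → hedge i ≢ e
        hedge≢e i eq = e∉F (subst (_∈ F) eq (hedge∈F i))

        hedge′-inj : ∀ i j → hedge′ i ≡ hedge′ j → i ≡ j
        hedge′-inj = top-elim _
          (top-elim _ (λ _ → refl) (λ j eq → contradiction
            (trans (sym (hedge′-inject₁ j)) (trans (sym eq) hedge′-fromℕ)) (hedge≢e j)))
          (λ i → top-elim _
            (λ eq → contradiction (trans (sym (hedge′-inject₁ i)) (trans eq hedge′-fromℕ)) (hedge≢e i))
            (λ j eq → cong inject₁ (hedge-inj (trans (sym (hedge′-inject₁ i)) (trans eq (hedge′-inject₁ j))))))

        1≤len : 1 ≤ len
        1≤len = ℕ.n≢0⇒n>0 λ len≡0 → u≢w (trans (sym start) (trans
          (cong vert (toℕ-injective (trans (sym len≡0) (sym (toℕ-fromℕ len))))) end))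

      cycle : Cycle H (suc len)
      cycle = record
        { nontrivial = s≤s 1≤len
        ; vert = vert ; hedge = hedge′ ; vert-inj = vert-inj ; hedge-inj = λ {i} {j} → hedge′-inj i j
        ; vert∈hedge = top-elim _
            (subst₂ (λ v f → v ∈ edge H f) (sym end) (sym hedge′-fromℕ) w∈e)
            (λ i → subst (λ f → vert (inject₁ i) ∈ edge H f) (sym (hedge′-inject₁ i)) (left∈ i))
        ; next∈hedge = top-elim _
            (subst₂ (λ v f → v ∈ edge H f) (sym (trans (cong vert (next-fromℕ len)) start)) (sym hedge′-fromℕ) u∈e)
            (λ i → subst₂ (λ j f → vert j ∈ edge H f) (sym (next-inject₁ i)) (sym (hedge′-inject₁ i)) (right∈ i)) }

      traverses : Traverses cycle w e
      traverses = fromℕ len , hedge′-fromℕ , inj₁ end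

      -- This lets uniqueness of the cycle be applied: two cycles closed by the same `e` at
      -- different end vertices traverse different pairs.
      traverses-only : ∀ {x} → Traverses cycle x e → x ≡ u ⊎ x ≡ w
      traverses-only {x} (i , hedge≡e , x≡) = top-elim
        (λ i → hedge′ i ≡ e → vert i ≡ x ⊎ vert (next i) ≡ x → x ≡ u ⊎ x ≡ w)
        (λ _ → [ (λ eq → inj₂ (trans (sym eq) end))
               , (λ eq → inj₁ (trans (sym eq) (trans (cong vert (next-fromℕ len)) start))) ]′)
        (λ i eq → contradiction (trans (sym (hedge′-inject₁ i)) eq) (hedge≢e i))
        i hedge≡e x≡

      hedge-cycle∈ : ∀ i → Cycle.hedge cycle i ∈ F ∪ ⁅ e ⁆
      hedge-cycle∈ = top-elim _ (subst (_∈ F ∪ ⁅ e ⁆) (sym hedge′-fromℕ) e∈)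
        (λ i → subst (_∈ F ∪ ⁅ e ⁆) (sym (hedge′-inject₁ i)) (F⊆ (hedge∈F i)))

  -- Connectedness of the part is kept as paths rather than walks, because `Closing` needs distinct
  -- vertices and hyperedges.
  record Grown (F : Subset (size H)) (U : Subset (order H)) : Set where
    field
      edges⊆ : ∀ {e} → e ∈ F → edge H e ⊆ U
      paths  : ∀ {u w} → u ∈ U → w ∈ U → u ≢ w → Path F U u w

  -- A new vertex reaches the old ones through `e` and then from `x`; two new vertices are joined by
  -- `e` alone.
  grow : ∀ {F U e x} → Grown F U → e ∉ F → x ∈ edge H e → x ∈ U → Grown (F ∪ ⁅ e ⁆) (U ∪ edge H e)
  grow {F} {U} {e} {x} G e∉F x∈e x∈U = record { edges⊆ = edges⊆′ ; paths = paths′ }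
    where
    open Grown G
    edges⊆′ : ∀ {f} → f ∈ F ∪ ⁅ e ⁆ → edge H f ⊆ U ∪ edge H e
    edges⊆′ f∈ with x∈p∪q⁻ F ⁅ e ⁆ f∈
    ... | inj₁ f∈F = U⊆ e∉F ∘ edges⊆ f∈F
    ... | inj₂ f∈e with refl ← x∈⁅y⁆⇒x≡y e f∈e = edge⊆ e∉F

    toOld : ∀ {y w} → y ∈ edge H e → y ∉ U → w ∈ U → Path (F ∪ ⁅ e ⁆) (U ∪ edge H e) y w
    toOld {y} {w} y∈e y∉U w∈U with x ≟ w
    ... | yes refl = single e∉F y∈e x∈e (λ { refl → y∉U x∈U })
    ... | no x≢w   = extend e∉F x∈e y∈e y∉U (paths x∈U w∈U x≢w)

    new : ∀ {y} → y ∈ U ∪ edge H e → y ∉ U → y ∈ edge H e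
    new y∈ y∉U = [ (λ y∈U → contradiction y∈U y∉U) , id ]′ (x∈p∪q⁻ U (edge H e) y∈)

    paths′ : ∀ {u w} → u ∈ U ∪ edge H e → w ∈ U ∪ edge H e → u ≢ w → Path (F ∪ ⁅ e ⁆) (U ∪ edge H e) u w
    paths′ {u} {w} u∈ w∈ u≢w with u ∈? U | w ∈? U
    ... | yes u∈U | yes w∈U = weaken (F⊆ {U = U} e∉F) (U⊆ e∉F) (paths u∈U w∈U u≢w)
    ... | no u∉U  | yes w∈U = toOld (new u∈ u∉U) u∉U w∈U
    ... | yes u∈U | no w∉U  = reverse (toOld (new w∈ w∉U) w∉U u∈U)
    ... | no u∉U  | no w∉U  = single e∉F (new u∈ u∉U) (new w∈ w∉U) u≢w

  module _ (r : ℕ) (unif : Uniform (suc r) H) (uni : Unicyclic H) where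
    open Unicyclic uni

    -- Hyperedges are added one at a time to a connected part F with vertex set U.
    -- A new one meets U in a single vertex, except once, when it closes the cycle.
    Acyclic : Subset (size H) → Subset (order H) → Set
    Acyclic F U = ∣ U ∣ ≡ suc (∣ F ∣ * r)

    -- The cycle inside `F` is part of the state: all cycles traverse the same pairs, so from then
    -- on no cycle can use a hyperedge outside `F`.
    Cyclic : Subset (size H) → Subset (order H) → Set
    Cyclic F U = ∣ U ∣ ≡ ∣ F ∣ * r × (∃[ l ] ∃[ c ] ∀ i → Cycle.hedge {H} {l} c i ∈ F)

    module _ {F U e x} (G : Grown F U) (e∉F : e ∉ F) (x∈e : x ∈ edge H e) (x∈U : x ∈ U) where
      open Grown G

      private
        -- Inclusion and exclusion: with `suc s` common vertices, `r - s` vertices are new. The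
        -- additive form avoids truncated subtraction.
        ∣U∪e∣-meet : ∀ s → ∣ U ∩ edge H e ∣ ≡ suc s → ∣ U ∪ edge H e ∣ + s ≡ ∣ U ∣ + r
        ∣U∪e∣-meet s meet = ℕ.suc-injective (begin
          suc (∣ U ∪ edge H e ∣ + s)                   ≡⟨ ℕ.+-suc _ s ⟨
          ∣ U ∪ edge H e ∣ + suc s                     ≡⟨ cong (∣ U ∪ edge H e ∣ +_) meet ⟨
          ∣ U ∪ edge H e ∣ + ∣ U ∩ edge H e ∣          ≡⟨ trans (∣p∪q∣+∣p∩q∣ U (edge H e)) (cong (∣ U ∣ +_) (unif e)) ⟩
          ∣ U ∣ + suc r                                ≡⟨ ℕ.+-suc _ r ⟩
          suc (∣ U ∣ + r)                              ∎)
          where open ≡-Reasoning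

        otherMeet? : Dec (∃[ w ] (w ∈ U × w ∈ edge H e) × w ≢ x)
        otherMeet? = any? λ w → ((w ∈? U) ×-dec (w ∈? edge H e)) ×-dec ¬? (w ≟ x)

        ∣F∪e∣*r : ∣ F ∪ ⁅ e ⁆ ∣ * r ≡ r + ∣ F ∣ * r
        ∣F∪e∣*r = cong (_* r) (∣p∪⁅x⁆∣ e∉F)

        one-meet : ¬ (∃[ w ] (w ∈ U × w ∈ edge H e) × w ≢ x) → ∣ U ∪ edge H e ∣ ≡ ∣ U ∣ + r
        one-meet none = trans (sym (ℕ.+-identityʳ _)) (∣U∪e∣-meet 0 (∣p∣≡1 (x∈p∩q⁺ (x∈U , x∈e))
          (λ {y} y∈ → only y (x∈p∩q⁻ U (edge H e) y∈))))
          where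
          only : ∀ y → y ∈ U × y ∈ edge H e → y ≡ x
          only y y∈ with y ≟ x
          ... | yes y≡x = y≡x
          ... | no y≢x  = contradiction (y , y∈ , y≢x) none

      -- The new hyperedge meets `U` in exactly `x` and `w`: a third common vertex `z` would close
      -- another cycle, traversing `(z , e)`, while the first one traverses `e` only at `x` and `w`.
      -- One vertex fewer than in the acyclic case is gained.
      acyclic-close : Acyclic F U → ∀ {w} → w ∈ U → w ∈ edge H e → w ≢ x → Cyclic (F ∪ ⁅ e ⁆) (U ∪ edge H e)
      acyclic-close acyc {w} w∈U w∈e w≢x = ℕ.suc-injective count , _ , C.cycle , C.hedge-cycle∈
        where
        module C = Closing e∉F (paths x∈U w∈U (w≢x ∘ sym)) (w≢x ∘ sym) x∈e w∈e
        only : ∀ {z} → z ∈ U ∩ edge H e → z ≡ x ⊎ z ≡ w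
        only {z} z∈ with z ≟ x | z ≟ w | x∈p∩q⁻ U (edge H e) z∈
        ... | yes z≡x | _       | _ = inj₁ z≡x
        ... | no _    | yes z≡w | _ = inj₂ z≡w
        ... | no z≢x  | no z≢w  | z∈U , z∈e =
          C.traverses-only (Equivalence.from (unique C.cycle C′.cycle z e) C′.traverses)
          where module C′ = Closing e∉F (paths x∈U z∈U (z≢x ∘ sym)) (z≢x ∘ sym) x∈e z∈e
        count : suc ∣ U ∪ edge H e ∣ ≡ suc (∣ F ∪ ⁅ e ⁆ ∣ * r)
        count = begin
          suc ∣ U ∪ edge H e ∣       ≡⟨ ℕ.+-comm 1 _ ⟩
          ∣ U ∪ edge H e ∣ + 1       ≡⟨ ∣U∪e∣-meet 1 (∣p∣≡2 (x∈p∩q⁺ (x∈U , x∈e)) (x∈p∩q⁺ (w∈U , w∈e)) w≢x only) ⟩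
          ∣ U ∣ + r                  ≡⟨ cong (_+ r) acyc ⟩
          suc (∣ F ∣ * r + r)        ≡⟨ cong suc (trans (ℕ.+-comm _ r) (sym ∣F∪e∣*r)) ⟩
          suc (∣ F ∪ ⁅ e ⁆ ∣ * r)    ∎
          where open ≡-Reasoning

      acyclic-grow : Acyclic F U → Acyclic (F ∪ ⁅ e ⁆) (U ∪ edge H e) ⊎ Cyclic (F ∪ ⁅ e ⁆) (U ∪ edge H e)
      acyclic-grow acyc with otherMeet?
      ... | yes (w , (w∈U , w∈e) , w≢x) = inj₂ (acyclic-close acyc w∈U w∈e w≢x)
      ... | no none = inj₁ (trans (one-meet none) (trans (cong (_+ r) acyc)
        (cong suc (trans (ℕ.+-comm _ r) (sym ∣F∪e∣*r)))))

      -- A second common vertex would close a cycle through `e`; by uniqueness `e` would then belong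
      -- to the cycle already inside `F`.
      cyclic-grow : Cyclic F U → Cyclic (F ∪ ⁅ e ⁆) (U ∪ edge H e)
      cyclic-grow (count , l , c , hedge∈F) with otherMeet?
      ... | no none = trans (one-meet none) (trans (cong (_+ r) count) (trans (ℕ.+-comm _ r) (sym ∣F∪e∣*r)))
        , l , c , F⊆ {U = U} e∉F ∘ hedge∈F
      ... | yes (w , (w∈U , w∈e) , w≢x) = contradiction
        (let i , hedge≡e , _ = Equivalence.from (unique c C.cycle w e) C.traverses in
          subst (_∈ F) hedge≡e (hedge∈F i))
        e∉F
        where module C = Closing e∉F (paths x∈U w∈U (w≢x ∘ sym)) (w≢x ∘ sym) x∈e w∈e

    private
      module _ {l} (c : Cycle H (suc l)) where
        open Cycle c

        -- Growth starts along a given cycle, so that a closing hyperedge is certain to be met. The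
        -- last clause keeps the next hyperedge of the cycle outside `F`, and `vert zero ∈ U` is
        -- what the final hyperedge needs.
        AlongCycle : Fin (suc l) → Set
        AlongCycle i = ∃[ F ] ∃[ U ] Grown F U × (Acyclic F U ⊎ Cyclic F U) × vert zero ∈ U × vert i ∈ U ×
          (∀ {e} → e ∈ F → ∃[ j ] hedge j ≡ e × toℕ j < toℕ i)

        new-hedge : ∀ {F : Subset (size H)} i → (∀ {e} → e ∈ F → ∃[ j ] hedge j ≡ e × toℕ j < toℕ i) → hedge i ∉ F
        new-hedge i earlier hedge∈F with j , eq , j<i ← earlier hedge∈F = ℕ.<⇒≢ j<i (cong toℕ (hedge-inj eq))

        along-cycle : ∀ i → AlongCycle i
        along-cycle = <-weakInduction AlongCycle base step
          where
          base : AlongCycle zero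
          base = ⊥ , ⁅ vert zero ⁆ ,
            record { edges⊆ = λ e∈⊥ → contradiction e∈⊥ ∉⊥
                   ; paths = λ u∈ w∈ u≢w → contradiction
                       (trans (x∈⁅y⁆⇒x≡y _ u∈) (sym (x∈⁅y⁆⇒x≡y _ w∈))) u≢w } ,
            inj₁ (trans (∣⁅x⁆∣≡1 (vert zero)) (cong (λ s → suc (s * r)) (sym (∣⊥∣≡0 (size H))))) ,
            x∈⁅x⁆ _ , x∈⁅x⁆ _ , λ e∈⊥ → contradiction e∈⊥ ∉⊥

          step : ∀ i → AlongCycle (inject₁ i) → AlongCycle (suc i)
          step i (F , U , G , state , v₀∈U , vᵢ∈U , earlier) =
            F ∪ ⁅ e ⁆ , U ∪ edge H e , grow G e∉F vᵢ∈e vᵢ∈U ,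
            [ acyclic-grow G e∉F vᵢ∈e vᵢ∈U , inj₂ ∘ cyclic-grow G e∉F vᵢ∈e vᵢ∈U ]′ state ,
            U⊆ e∉F v₀∈U ,
            edge⊆ e∉F (subst (λ j → vert j ∈ edge H e) (next-inject₁ i) (next∈hedge (inject₁ i))) ,
            earlier′
            where
            e = hedge (inject₁ i)
            vᵢ∈e = vert∈hedge (inject₁ i)
            e∉F = new-hedge (inject₁ i) earlier
            earlier′ : ∀ {f} → f ∈ F ∪ ⁅ e ⁆ → ∃[ j ] hedge j ≡ f × toℕ j < suc (toℕ i)
            earlier′ f∈ with x∈p∪q⁻ F ⁅ e ⁆ f∈
            ... | inj₁ f∈F with j , eq , j<i ← earlier f∈F =
              j , eq , ℕ.m≤n⇒m≤1+n (ℕ.≤-trans j<i (ℕ.≤-reflexive (toℕ-inject₁ i)))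
            ... | inj₂ f∈e = inject₁ i , sym (x∈⁅y⁆⇒x≡y e f∈e) , s≤s (ℕ.≤-reflexive (toℕ-inject₁ i))

        around-cycle : ∃[ F ] ∃[ U ] Grown F U × Cyclic F U × vert zero ∈ U
        around-cycle with F , U , G , state , v₀∈U , vₗ∈U , earlier ← along-cycle (fromℕ l) =
          F ∪ ⁅ e ⁆ , U ∪ edge H e , grow G e∉F vₗ∈e vₗ∈U ,
          -- The last hyperedge contains two distinct vertices of `U`, the last one and `vert zero`,
          -- so an acyclic part becomes cyclic here.
          [ (λ acyc → acyclic-close G e∉F vₗ∈e vₗ∈U acyc v₀∈U v₀∈e v₀≢vₗ) , cyclic-grow G e∉F vₗ∈e vₗ∈U ]′ state ,
          U⊆ e∉F v₀∈U
          where
          e = hedge (fromℕ l)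
          e∉F = new-hedge (fromℕ l) earlier
          vₗ∈e = vert∈hedge (fromℕ l)
          v₀∈e = subst (λ j → vert j ∈ edge H e) (next-fromℕ l) (next∈hedge (fromℕ l))
          v₀≢vₗ : vert zero ≢ vert (fromℕ l)
          v₀≢vₗ eq = ℕ.<⇒≢ (ℕ.≤-pred nontrivial) (trans (cong toℕ (vert-inj eq)) (toℕ-fromℕ l))

      -- `fuel` bounds the number of hyperedges outside `F`. When none of these meets `U`,
      -- connectedness makes `U` everything; as hyperedges are nonempty by uniformity, `F` is
      -- everything as well.
      exhaust : ∀ fuel {F U v} → size H ≤ ∣ F ∣ + fuel → Grown F U → Cyclic F U → v ∈ U →
                order H ≡ size H * r
      exhaust fuel {F} {U} {v} enough G cyc v∈U
        with any? (λ e → ¬? (e ∈? F) ×-dec any? (λ x → (x ∈? edge H e) ×-dec (x ∈? U)))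
      exhaust zero {F} enough G cyc v∈U | yes (e , e∉F , x , x∈e , x∈U) = contradiction
        (ℕ.≤-trans (ℕ.≤-reflexive (sym (∣p∪⁅x⁆∣ e∉F))) (ℕ.≤-trans (∣p∣≤n (F ∪ ⁅ e ⁆))
          (ℕ.≤-trans enough (ℕ.≤-reflexive (ℕ.+-identityʳ _)))))
        ℕ.1+n≰n
      exhaust (suc fuel) {F} enough G cyc v∈U | yes (e , e∉F , x , x∈e , x∈U) =
        exhaust fuel (ℕ.≤-trans enough (ℕ.≤-reflexive
            (trans (ℕ.+-suc ∣ F ∣ fuel) (cong (_+ fuel) (sym (∣p∪⁅x⁆∣ e∉F))))))
          (grow G e∉F x∈e x∈U) (cyclic-grow G e∉F x∈e x∈U cyc) (U⊆ e∉F v∈U)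
      exhaust fuel {F} {U} {v} enough G cyc v∈U | no closed = begin
        order H       ≡⟨ ∣⊤∣≡n (order H) ⟨
        ∣ ⊤ {order H} ∣ ≡⟨ cong ∣_∣ (⊆-antisym (λ {u} _ → all-vertices u) (λ _ → ∈⊤)) ⟩
        ∣ U ∣         ≡⟨ proj₁ cyc ⟩
        ∣ F ∣ * r     ≡⟨ cong (λ p → ∣ p ∣ * r) (⊆-antisym (λ _ → ∈⊤) (λ {e} _ → all-edges e)) ⟩
        ∣ ⊤ {size H} ∣ * r ≡⟨ cong (_* r) (∣⊤∣≡n (size H)) ⟩
        size H * r    ∎
        where
        open ≡-Reasoning
        meets⇒∈F : ∀ e {x} → x ∈ edge H e → x ∈ U → e ∈ F
        meets⇒∈F e x∈e x∈U with e ∈? F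
        ... | yes e∈F = e∈F
        ... | no e∉F  = contradiction (e , e∉F , _ , x∈e , x∈U) closed

        reachable : ∀ {u w} → u ∈ U → Star (Adjacent H) u w → w ∈ U
        reachable u∈U ε = u∈U
        reachable u∈U ((e , u∈e , w∈e) ◅ rest) = reachable (Grown.edges⊆ G (meets⇒∈F e u∈e u∈U) w∈e) rest

        all-vertices : ∀ u → u ∈ U
        all-vertices u = reachable v∈U (connected v u)

        all-edges : ∀ e → e ∈ F
        all-edges e with any? (λ x → x ∈? edge H e)
        ... | yes (x , x∈e) = meets⇒∈F e x∈e (all-vertices x)
        ... | no empty = contradiction
          (trans (sym (unif e)) (trans (cong ∣_∣ (Empty-unique empty)) (∣⊥∣≡0 (order H)))) λ ()

    unicyclic-order : order H ≡ size H * r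
    unicyclic-order with hasCycle
    ... | suc l , c with F , U , G , cyc , v₀∈U ← around-cycle c =
      exhaust (size H) (ℕ.m≤n+m (size H) ∣ F ∣) G cyc v₀∈U
    ... | zero , c with () ← Cycle.nontrivial c

-- The hypergraph C_g ⊙ S_{m-g}

module _ {m n} (p : Subset m) (q : Subset n) where

  ∈-++⁺ˡ : ∀ {v} → v ∈ p → (v ↑ˡ n) ∈ p ++ q
  ∈-++⁺ˡ {v} v∈p = lookup⇒[]= _ _ (trans (lookup-++ˡ p q v) ([]=⇒lookup v∈p))

  ∈-++⁻ˡ : ∀ {v} → (v ↑ˡ n) ∈ p ++ q → v ∈ p
  ∈-++⁻ˡ {v} v∈ = lookup⇒[]= _ _ (trans (sym (lookup-++ˡ p q v)) ([]=⇒lookup v∈))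

  ∈-++⁺ʳ : ∀ {w} → w ∈ q → (m ↑ʳ w) ∈ p ++ q
  ∈-++⁺ʳ {w} w∈q = lookup⇒[]= _ _ (trans (lookup-++ʳ p q w) ([]=⇒lookup w∈q))

  ∈-++⁻ʳ : ∀ {w} → (m ↑ʳ w) ∈ p ++ q → w ∈ q
  ∈-++⁻ʳ {w} w∈ = lookup⇒[]= _ _ (trans (sym (lookup-++ʳ p q w)) ([]=⇒lookup w∈))

∣p++q∣ : ∀ {m n} (p : Subset m) (q : Subset n) → ∣ p ++ q ∣ ≡ ∣ p ∣ + ∣ q ∣
∣p++q∣ []            q = refl
∣p++q∣ (inside  ∷ p) q = cong suc (∣p++q∣ p q)
∣p++q∣ (outside ∷ p) q = ∣p++q∣ p q

∣concat∣ : ∀ {m n} (f : Fin m → Subset n) → ∣ concat (tabulate f) ∣ ≡ sum (λ j → ∣ f j ∣)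
∣concat∣ {zero}  f = refl
∣concat∣ {suc m} f = trans (∣p++q∣ (f zero) _) (cong (∣ f zero ∣ +_) (∣concat∣ (f ∘ suc)))

data Split (m n : ℕ) : Fin (m + n) → Set where
  left  : ∀ v → Split m n (v ↑ˡ n)
  right : ∀ w → Split m n (m ↑ʳ w)

split : ∀ m n (x : Fin (m + n)) → Split m n x
split m n x = subst (Split m n) (join-splitAt m n x) (go (splitAt m x))
  where
  go : ∀ s → Split m n (join m n s)
  go (inj₁ v) = left v
  go (inj₂ w) = right w

all-equal⇒∣p∣≤1 : ∀ {n} (p : Subset n) → (∀ {x y} → x ∈ p → y ∈ p → y ≡ x) → ∣ p ∣ ≤ 1
all-equal⇒∣p∣≤1 {n} p equal with any? (_∈? p)
... | yes (x , x∈p) = ℕ.≤-reflexive (∣p∣≡1 x∈p (equal x∈p))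
... | no empty      = ℕ.≤-trans (ℕ.≤-reflexive (trans (cong ∣_∣ (Empty-unique empty)) (∣⊥∣≡0 n))) z≤n

∣p∣≤1⇒all-equal : ∀ {n} (p : Subset n) → ∣ p ∣ ≤ 1 → ∀ {x y} → x ∈ p → y ∈ p → y ≡ x
∣p∣≤1⇒all-equal p ≤1 {x} {y} x∈p y∈p with y ≟ x
... | yes y≡x = y≡x
... | no y≢x  = contradiction
  (ℕ.≤-trans (two-distinct⇒2≤ (_∈? p) y≢x y∈p x∈p) (ℕ.≤-trans (ℕ.≤-reflexive (sym (∣p∣≡sum p))) ≤1))
  ℕ.1+n≰n

Adjacent-sym : ∀ H {u v} → Adjacent H u v → Adjacent H v u
Adjacent-sym H (e , u∈e , v∈e) = e , v∈e , u∈e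

rooted⇒connected : ∀ H root → (∀ v → Star (Adjacent H) root v) → Connected H
rooted⇒connected H root reach u v = back (reach u) ε ◅◅ reach v
  where
  back : ∀ {u v w} → Star (Adjacent H) u v → Star (Adjacent H) u w → Star (Adjacent H) v w
  back ε          acc = acc
  back (a ◅ rest) acc = back rest (Adjacent-sym H a ◅ acc)

module _ {H l} (c : Cycle H l) where
  open Cycle c

  -- A vertex of the cycle lies in its own hyperedge and in that of its predecessor; they differ
  -- because `next` has no fixed point on a cycle of length at least two.
  cycle-vertex-edges : ∀ i → ∃[ j ] next j ≡ i × hedge j ≢ hedge i × vert i ∈ edge H (hedge j)
  cycle-vertex-edges i with j , refl ← next-surjective i =
    j , refl , (λ eq → next≢ nontrivial j (sym (hedge-inj eq))) , next∈hedge j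

  cored-not-on-cycle : ∀ i → ¬ (∀ {e f} → vert i ∈ edge H e → vert i ∈ edge H f → e ≡ f)
  cored-not-on-cycle i cored with j , _ , distinct , ∈j ← cycle-vertex-edges i =
    distinct (cored ∈j (vert∈hedge i))

-- A lower bound on the degree suffices, because the total excess is m - g.
record Anchored (k m g d : ℕ) (H : Hypergraph) (v : Fin (order H)) : Set where
  field
    linearUnicyclic : LinearUnicyclic k m g H
    cycle           : Cycle H g
    position        : Fin g
    anchor          : Cycle.vert cycle position ≡ v
    degree≥         : d ≤ degree H v

-- Induction around a ring from an arbitrary start: advance from `i₀` to the top index, wrap to
-- `zero`, and advance once more through all indices.
next-closed⇒all : ∀ {n p} (P : Fin n → Set p) → (∀ i → P i → P (next i)) → ∀ i₀ → P i₀ → ∀ i → P i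
next-closed⇒all {suc n} P closed i₀ Pi₀ = <-weakInduction P
  (subst P (next-fromℕ n) (closed (fromℕ n)
    (<-weakInduction-startingFrom P Pi₀ advance (≤fromℕ i₀))))
  advance
  where
  advance : ∀ j → P (inject₁ j) → P (suc j)
  advance j Pj = subst P (next-inject₁ j) (closed (inject₁ j) Pj)

-- The hypercycle belongs to the class

module HypercycleProperties (q g′ : ℕ) (3≤g : 3 ≤ suc g′) where
  private
    k g N : ℕ
    k = suc (suc q)
    g = suc g′
    N = g * q

    C : Hypergraph
    C = hypercycle k g 3≤g

    blocks : Fin g → Fin g → Subset q
    blocks i j = if does (i ≟ j) then ⊤ else ⊥

    inserted : Fin g → Subset N
    inserted i = concat (tabulate (blocks i))

    2≤g : 2 ≤ g
    2≤g = ℕ.≤-trans (ℕ.n≤1+n 2) 3≤g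

  core : Fin g → Fin (order C)
  core i = i ↑ˡ N

  core∈⁺ : ∀ {i w} → w ≡ i ⊎ w ≡ next i → core w ∈ edge C i
  core∈⁺ {i} (inj₁ refl) = ∈-++⁺ˡ (⁅ i ⁆ ∪ ⁅ next i ⁆) (inserted i) (x∈p∪q⁺ (inj₁ (x∈⁅x⁆ i)))
  core∈⁺ {i} (inj₂ refl) = ∈-++⁺ˡ (⁅ i ⁆ ∪ ⁅ next i ⁆) (inserted i) (x∈p∪q⁺ (inj₂ (x∈⁅x⁆ (next i))))

  core∈⁻ : ∀ i {w} → core w ∈ edge C i → w ≡ i ⊎ w ≡ next i
  core∈⁻ i w∈ with x∈p∪q⁻ ⁅ i ⁆ ⁅ next i ⁆ (∈-++⁻ˡ (⁅ i ⁆ ∪ ⁅ next i ⁆) (inserted i) w∈)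
  ... | inj₁ w∈i = inj₁ (x∈⁅y⁆⇒x≡y i w∈i)
  ... | inj₂ w∈n = inj₂ (x∈⁅y⁆⇒x≡y (next i) w∈n)

  lookup-inserted : ∀ i j x → lookup (inserted i) (combine j x) ≡ lookup (blocks i j) x
  lookup-inserted i j x = trans (lookup-concat (tabulate (blocks i)) j x)
    (cong (λ p → lookup p x) (lookup∘tabulate (blocks i) j))

  inserted∈⁺ : ∀ j x → (g ↑ʳ combine j x) ∈ edge C j
  inserted∈⁺ j x = ∈-++⁺ʳ (⁅ j ⁆ ∪ ⁅ next j ⁆) (inserted j)
    (lookup⇒[]= _ _ (trans (lookup-inserted j j x) on-diagonal))
    where
    on-diagonal : lookup (blocks j j) x ≡ inside
    on-diagonal with j ≟ j
    ... | yes _  = []=⇒lookup (∈⊤ {x = x})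
    ... | no j≢j = contradiction refl j≢j

  inserted∈⁻ : ∀ i j x → (g ↑ʳ combine j x) ∈ edge C i → i ≡ j
  inserted∈⁻ i j x x∈ = off-diagonal
    (trans (sym (lookup-inserted i j x)) ([]=⇒lookup (∈-++⁻ʳ (⁅ i ⁆ ∪ ⁅ next i ⁆) (inserted i) x∈)))
    where
    off-diagonal : lookup (blocks i j) x ≡ inside → i ≡ j
    off-diagonal eq with i ≟ j
    ... | yes i≡j = i≡j
    ... | no _    = contradiction (lookup⇒[]= x ⊥ eq) ∉⊥

  data Vertex : Fin (order C) → Set where
    coreVertex     : ∀ w → Vertex (core w)
    insertedVertex : ∀ (j : Fin g) (x : Fin q) → Vertex (g ↑ʳ combine j x)

  vertexView : ∀ v → Vertex v
  vertexView v with split g N v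
  ... | left w  = coreVertex w
  ... | right y with j , x , refl ← combine-surjective {g} {q} y = insertedVertex j x

  C-uniform : Uniform k C
  C-uniform i = trans (∣p++q∣ (⁅ i ⁆ ∪ ⁅ next i ⁆) (inserted i)) (cong₂ _+_ ends block)
    where
    ends : ∣ ⁅ i ⁆ ∪ ⁅ next i ⁆ ∣ ≡ 2
    ends = trans (∣p∪⁅x⁆∣ (next≢ 2≤g i ∘ x∈⁅y⁆⇒x≡y i)) (cong suc (∣⁅x⁆∣≡1 i))
    block-size : ∀ j → ∣ blocks i j ∣ ≡ (if does (i ≟ j) then q else 0)
    block-size j with i ≟ j
    ... | yes _ = ∣⊤∣≡n q
    ... | no _  = ∣⊥∣≡0 q
    block : ∣ inserted i ∣ ≡ q
    block = trans (∣concat∣ (blocks i)) (trans (sum-cong-≗ block-size)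
      (trans (sum-single ℕ.+-0-commutativeMonoid (λ j → if does (i ≟ j) then q else 0) i off) on))
      where
      off : ∀ j → i ≢ j → (if does (i ≟ j) then q else 0) ≡ 0
      off j i≢j with i ≟ j
      ... | yes i≡j = contradiction i≡j i≢j
      ... | no _    = refl
      on : (if does (i ≟ i) then q else 0) ≡ q
      on with i ≟ i
      ... | yes _  = refl
      ... | no i≢i = contradiction refl i≢i

  common : ∀ {e f w : Fin g} → e ≢ f → w ≡ e ⊎ w ≡ next e → w ≡ f ⊎ w ≡ next f →
           (w ≡ e × e ≡ next f) ⊎ (w ≡ f × f ≡ next e)
  common e≢f (inj₁ refl) (inj₁ e≡f)  = contradiction e≡f e≢f
  common e≢f (inj₁ refl) (inj₂ e≡nf) = inj₁ (refl , e≡nf)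
  common e≢f (inj₂ refl) (inj₁ ne≡f) = inj₂ (ne≡f , sym ne≡f)
  common e≢f (inj₂ refl) (inj₂ eq)   = contradiction (next-injective eq) e≢f

  -- Distinct hyperedges share no inserted vertex, and two different common core vertices would give
  -- `e ≡ next f` and `f ≡ next e`, which `g ≥ 3` excludes.
  C-linear : Linear C
  C-linear e f e≢f = all-equal⇒∣p∣≤1 (edge C e ∩ edge C f) (λ {x} {y} x∈ y∈ →
    equal (vertexView x) (vertexView y) (x∈p∩q⁻ (edge C e) (edge C f) x∈) (x∈p∩q⁻ (edge C e) (edge C f) y∈))
    where
    equal : ∀ {x y} → Vertex x → Vertex y → x ∈ edge C e × x ∈ edge C f → y ∈ edge C e × y ∈ edge C f → y ≡ x
    equal (insertedVertex j x) _ (x∈e , x∈f) _ =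
      contradiction (trans (inserted∈⁻ e j x x∈e) (sym (inserted∈⁻ f j x x∈f))) e≢f
    equal (coreVertex _) (insertedVertex j x) _ (x∈e , x∈f) =
      contradiction (trans (inserted∈⁻ e j x x∈e) (sym (inserted∈⁻ f j x x∈f))) e≢f
    equal (coreVertex u) (coreVertex w) (u∈e , u∈f) (w∈e , w∈f)
      with common e≢f (core∈⁻ e u∈e) (core∈⁻ f u∈f) | common e≢f (core∈⁻ e w∈e) (core∈⁻ f w∈f)
    ... | inj₁ (refl , _) | inj₁ (refl , _) = refl
    ... | inj₂ (refl , _) | inj₂ (refl , _) = refl
    ... | inj₁ (_ , e≡nf) | inj₂ (_ , f≡ne) =
      contradiction (sym (trans e≡nf (cong next f≡ne))) (next²-≢ 3≤g e)
    ... | inj₂ (_ , f≡ne) | inj₁ (_ , e≡nf) =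
      contradiction (sym (trans e≡nf (cong next f≡ne))) (next²-≢ 3≤g e)

  C-connected : Connected C
  C-connected = rooted⇒connected C (core zero) (reach ∘ vertexView)
    where
    reach-core : ∀ i → Star (Adjacent C) (core zero) (core i)
    reach-core = next-closed⇒all _ (λ i path → path ◅◅ ((i , core∈⁺ (inj₁ refl) , core∈⁺ (inj₂ refl)) ◅ ε)) zero ε
    reach : ∀ {v} → Vertex v → Star (Adjacent C) (core zero) v
    reach (coreVertex i)       = reach-core i
    reach (insertedVertex j x) = reach-core j ◅◅ ((j , core∈⁺ (inj₁ refl) , inserted∈⁺ j x) ◅ ε)

  C-cycle : Cycle C g
  C-cycle = record
    { nontrivial = 2≤g ; vert = core ; hedge = id
    ; vert-inj = ↑ˡ-injective N _ _ ; hedge-inj = id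
    ; vert∈hedge = λ i → core∈⁺ (inj₁ refl) ; next∈hedge = λ i → core∈⁺ (inj₂ refl) }

  module _ {l} (c : Cycle C l) where
    open Cycle c

    vert-core : ∀ i → ∃[ w ] vert i ≡ core w
    vert-core i = go (vertexView (vert i)) refl
      where
      go : ∀ {v} → Vertex v → vert i ≡ v → ∃[ w ] vert i ≡ core w
      go (coreVertex w)       eq = w , eq
      go (insertedVertex j x) eq = contradiction
        (λ {e} {f} v∈e v∈f → trans (inserted∈⁻ e j x (subst (_∈ edge C e) eq v∈e))
          (sym (inserted∈⁻ f j x (subst (_∈ edge C f) eq v∈f))))
        (cored-not-on-cycle c i)

    vert-end : ∀ i {e} → vert i ∈ edge C e → ∃[ w ] vert i ≡ core w × (w ≡ e ⊎ w ≡ next e)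
    vert-end i {e} v∈e with w , eq ← vert-core i = w , eq , core∈⁻ e (subst (_∈ edge C e) eq v∈e)

    -- `hedge i` has only two core vertices, and `vert i` and `vert (next i)` are two distinct core
    -- vertices in it.
    both-ends : ∀ i {w} → w ≡ hedge i ⊎ w ≡ next (hedge i) → vert i ≡ core w ⊎ vert (next i) ≡ core w
    both-ends i {w} w-end with vert-end i (vert∈hedge i) | vert-end (next i) (next∈hedge i)
    ... | a , va , a-end | b , vb , b-end = go a-end b-end w-end
      where
      a≢b : a ≢ b
      a≢b a≡b = next≢ nontrivial i (vert-inj (trans vb (trans (cong core (sym a≡b)) (sym va))))
      go : a ≡ hedge i ⊎ a ≡ next (hedge i) → b ≡ hedge i ⊎ b ≡ next (hedge i) →
           w ≡ hedge i ⊎ w ≡ next (hedge i) → vert i ≡ core w ⊎ vert (next i) ≡ core w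
      go (inj₁ p) (inj₁ r) _        = contradiction (trans p (sym r)) a≢b
      go (inj₂ p) (inj₂ r) _        = contradiction (trans p (sym r)) a≢b
      go (inj₁ p) (inj₂ r) (inj₁ s) = inj₁ (trans va (cong core (trans p (sym s))))
      go (inj₁ p) (inj₂ r) (inj₂ s) = inj₂ (trans vb (cong core (trans r (sym s))))
      go (inj₂ p) (inj₁ r) (inj₁ s) = inj₂ (trans vb (cong core (trans r (sym s))))
      go (inj₂ p) (inj₁ r) (inj₂ s) = inj₁ (trans va (cong core (trans p (sym s))))

    Used : Fin g → Set
    Used e = ∃[ i ] hedge i ≡ e

    -- A cycle through `core (next e)` uses two distinct hyperedges there, and only `e` and `next e`
    -- contain that vertex. Hence every cycle uses all hyperedges, which gives both the girth and
    -- uniqueness.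
    used-next : ∀ e → Used e → Used (next e)
    used-next e (i , refl) = [ through i , through (next i) ]′ (both-ends i (inj₂ refl))
      where
      through : ∀ j → vert j ≡ core (next e) → Used (next e)
      through j eq with j′ , _ , distinct , ∈j′ ← cycle-vertex-edges c j
        with core∈⁻ (hedge j′) (subst (_∈ edge C (hedge j′)) eq ∈j′)
           | core∈⁻ (hedge j) (subst (_∈ edge C (hedge j)) eq (vert∈hedge j))
      ... | inj₁ p | _      = j′ , sym p
      ... | inj₂ _ | inj₁ p = j , sym p
      ... | inj₂ p | inj₂ r = contradiction (next-injective (trans (sym p) r)) distinct

    all-used : ∀ e → Used e
    all-used = next-closed⇒all Used used-next (hedge (first nontrivial)) (first nontrivial , refl)
      where
      first : ∀ {n} → 2 ≤ n → Fin n
      first (s≤s _) = zero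

    girth≤ : g ≤ l
    girth≤ = injective⇒≤ {f = proj₁ ∘ all-used} λ {e} {f} eq →
      trans (sym (proj₂ (all-used e))) (trans (cong hedge eq) (proj₂ (all-used f)))

    -- The right-hand side does not mention `c`; together with `traverses⁺` this shows that all
    -- cycles traverse the same pairs.
    traverses⁻ : ∀ {v e} → Traverses c v e → ∃[ w ] v ≡ core w × (w ≡ e ⊎ w ≡ next e)
    traverses⁻ (i , refl , inj₁ refl) = vert-end i (vert∈hedge i)
    traverses⁻ (i , refl , inj₂ refl) = vert-end (next i) (next∈hedge i)

    traverses⁺ : ∀ {v e} → ∃[ w ] v ≡ core w × (w ≡ e ⊎ w ≡ next e) → Traverses c v e
    traverses⁺ {e = e} (w , refl , w-end) with i , refl ← all-used e = i , refl , both-ends i w-end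

  C-unicyclic : Unicyclic C
  C-unicyclic = record
    { connected = C-connected ; hasCycle = g , C-cycle
    ; unique = λ c c′ v e → mk⇔ (traverses⁺ c′ ∘ traverses⁻ c) (traverses⁺ c ∘ traverses⁻ c′) }

  hypercycle-anchored : Anchored k g g 2 C (core zero)
  hypercycle-anchored = record
    { linearUnicyclic = record
      { uniform = C-uniform ; linear = C-linear ; unicyclic = C-unicyclic
      ; size≡m = refl ; girth = C-cycle , girth≤ }
    ; cycle = C-cycle ; position = zero ; anchor = refl
    -- The two hyperedges at `core zero` have the index `zero` and the top index, whose successor
    -- wraps round to `zero`.
    ; degree≥ = ℕ.≤-trans
        (two-distinct⇒2≤ (λ e → core zero ∈? edge C e) {zero} {fromℕ g′} (λ eq → ℕ.<⇒≢
            (ℕ.≤-pred 2≤g) (trans (cong toℕ eq) (toℕ-fromℕ g′)))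
          (core∈⁺ (inj₁ refl)) (core∈⁺ (inj₂ (sym (next-fromℕ g′)))))
        (ℕ.≤-reflexive (sym (degree≡sum C (core zero)))) }

-- Adding a pendant hyperedge preserves the class

module PendantProperties (q : ℕ) (H : Hypergraph) (v : Fin (order H)) where
  private
    k : ℕ
    k = suc (suc q)

    H⁺ : Hypergraph
    H⁺ = addPendant k (s≤s (s≤s z≤n)) H v

    old : Fin (order H) → Fin (order H⁺)
    old u = u ↑ˡ suc q

    new : Fin (suc q) → Fin (order H⁺)
    new x = order H ↑ʳ x

  old∈suc⁺ : ∀ {u e} → u ∈ edge H e → old u ∈ edge H⁺ (suc e)
  old∈suc⁺ {e = e} = ∈-++⁺ˡ (edge H e) ⊥

  old∈suc⁻ : ∀ {u} e → old u ∈ edge H⁺ (suc e) → u ∈ edge H e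
  old∈suc⁻ e = ∈-++⁻ˡ (edge H e) ⊥

  new∉suc : ∀ {x} e → new x ∉ edge H⁺ (suc e)
  new∉suc e x∈ = ∉⊥ (∈-++⁻ʳ (edge H e) ⊥ x∈)

  old∈zero⁻ : ∀ {u} → old u ∈ edge H⁺ zero → u ≡ v
  old∈zero⁻ u∈ = x∈⁅y⁆⇒x≡y v (∈-++⁻ˡ ⁅ v ⁆ ⊤ u∈)

  v∈zero : old v ∈ edge H⁺ zero
  v∈zero = ∈-++⁺ˡ ⁅ v ⁆ ⊤ (x∈⁅x⁆ v)

  new∈zero : ∀ x → new x ∈ edge H⁺ zero
  new∈zero x = ∈-++⁺ʳ ⁅ v ⁆ ⊤ ∈⊤

  new-cored : ∀ {x e f} → new x ∈ edge H⁺ e → new x ∈ edge H⁺ f → e ≡ f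
  new-cored {e = zero}  {zero}  _  _  = refl
  new-cored {e = suc e} {f}     x∈ _  = contradiction x∈ (new∉suc e)
  new-cored {e = zero}  {suc f} _  x∈ = contradiction x∈ (new∉suc f)

  ∈suc⇒old : ∀ {x} e → x ∈ edge H⁺ (suc e) → ∃[ u ] x ≡ old u × u ∈ edge H e
  ∈suc⇒old {x} e x∈ = go (split (order H) (suc q) x) x∈
    where
    go : ∀ {x} → Split (order H) (suc q) x → x ∈ edge H⁺ (suc e) → ∃[ u ] x ≡ old u × u ∈ edge H e
    go (left u)  u∈ = u , refl , old∈suc⁻ e u∈
    go (right x) x∈ = contradiction x∈ (new∉suc e)

  module _ {m g d} (A : Anchored k m g d H v) where
    open Anchored A
    open LinearUnicyclic linearUnicyclic
    open Unicyclic unicyclic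

    H⁺-uniform : Uniform k H⁺
    H⁺-uniform zero    = trans (∣p++q∣ ⁅ v ⁆ ⊤) (cong₂ _+_ (∣⁅x⁆∣≡1 v) (∣⊤∣≡n (suc q)))
    H⁺-uniform (suc e) = trans (∣p++q∣ (edge H e) ⊥)
      (trans (cong₂ _+_ (uniform e) (∣⊥∣≡0 (suc q))) (ℕ.+-identityʳ k))

    private
      only-v : ∀ {x} e → x ∈ edge H⁺ zero → x ∈ edge H⁺ (suc e) → x ≡ old v
      only-v e x∈zero x∈suc with u , refl , _ ← ∈suc⇒old e x∈suc = cong old (old∈zero⁻ x∈zero)

    H⁺-linear : Linear H⁺
    H⁺-linear e f e≢f = all-equal⇒∣p∣≤1 (edge H⁺ e ∩ edge H⁺ f) λ x∈ y∈ →
      equal e f e≢f (x∈p∩q⁻ (edge H⁺ e) (edge H⁺ f) x∈) (x∈p∩q⁻ (edge H⁺ e) (edge H⁺ f) y∈)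
      where
      equal : ∀ e f → e ≢ f → ∀ {x y} → x ∈ edge H⁺ e × x ∈ edge H⁺ f → y ∈ edge H⁺ e × y ∈ edge H⁺ f → y ≡ x
      equal zero    zero    e≢f _ _ = contradiction refl e≢f
      equal zero    (suc f) e≢f (x∈e , x∈f) (y∈e , y∈f) = trans (only-v f y∈e y∈f) (sym (only-v f x∈e x∈f))
      equal (suc e) zero    e≢f (x∈e , x∈f) (y∈e , y∈f) = trans (only-v e y∈f y∈e) (sym (only-v e x∈f x∈e))
      equal (suc e) (suc f) e≢f (x∈e , x∈f) (y∈e , y∈f)
        with u , refl , u∈e ← ∈suc⇒old e x∈e | w , refl , w∈e ← ∈suc⇒old e y∈e =
        cong old (∣p∣≤1⇒all-equal (edge H e ∩ edge H f) (linear e f (e≢f ∘ cong suc))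
          (x∈p∩q⁺ (u∈e , old∈suc⁻ f x∈f)) (x∈p∩q⁺ (w∈e , old∈suc⁻ f y∈f)))

    H⁺-connected : Connected H⁺
    H⁺-connected = rooted⇒connected H⁺ (old v) (λ x → reach (split (order H) (suc q) x))
      where
      reach : ∀ {x} → Split (order H) (suc q) x → Star (Adjacent H⁺) (old v) x
      reach (left u)  = gmap old (λ (e , a∈ , b∈) → suc e , old∈suc⁺ a∈ , old∈suc⁺ b∈) (connected v u)
      reach (right x) = (zero , v∈zero , new∈zero x) ◅ ε

    lift : ∀ {l} → Cycle H l → Cycle H⁺ l
    lift c = record
      { nontrivial = nontrivial ; vert = old ∘ vert ; hedge = suc ∘ hedge
      ; vert-inj = vert-inj ∘ ↑ˡ-injective (suc q) _ _ ; hedge-inj = hedge-inj ∘ suc-injective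
      ; vert∈hedge = old∈suc⁺ ∘ vert∈hedge ; next∈hedge = old∈suc⁺ ∘ next∈hedge }
      where open Cycle c

    module Projection {l} (c : Cycle H⁺ l) where
      open Cycle c

      -- Apart from `old v` the new hyperedge consists of cored vertices, which lie on no cycle; so
      -- both consecutive vertices in it would be `old v`.
      hedge≢zero : ∀ i → hedge i ≢ zero
      hedge≢zero i eq = next≢ nontrivial i (vert-inj (trans
        (at-v (next i) (subst (λ e → vert (next i) ∈ edge H⁺ e) eq (next∈hedge i)))
        (sym (at-v i (subst (λ e → vert i ∈ edge H⁺ e) eq (vert∈hedge i))))))
        where
        at-v : ∀ j → vert j ∈ edge H⁺ zero → vert j ≡ old v
        at-v j = go (split (order H) (suc q) (vert j)) refl
          where
          go : ∀ {x} → Split (order H) (suc q) x → vert j ≡ x → vert j ∈ edge H⁺ zero → vert j ≡ old v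
          go (left u)  eq v∈ = trans eq (cong old (old∈zero⁻ (subst (_∈ edge H⁺ zero) eq v∈)))
          go (right x) eq v∈ = contradiction
            (λ {e} {f} ∈e ∈f → new-cored {x} (subst (_∈ edge H⁺ e) eq ∈e) (subst (_∈ edge H⁺ f) eq ∈f))
            (cored-not-on-cycle c j)

      hedge-suc : ∀ i → ∃[ e ] hedge i ≡ suc e
      hedge-suc i with hedge i in eq
      ... | zero  = contradiction eq (hedge≢zero i)
      ... | suc e = e , refl

      hedge₀ : Fin l → Fin (size H)
      hedge₀ i = proj₁ (hedge-suc i)

      hedge≡ : ∀ i → hedge i ≡ suc (hedge₀ i)
      hedge≡ i = proj₂ (hedge-suc i)

      private
        vert-old : ∀ i → ∃[ u ] vert i ≡ old u × u ∈ edge H (hedge₀ i)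
        vert-old i = ∈suc⇒old (hedge₀ i) (subst (λ e → vert i ∈ edge H⁺ e) (hedge≡ i) (vert∈hedge i))

      vert₀ : Fin l → Fin (order H)
      vert₀ i = proj₁ (vert-old i)

      vert≡ : ∀ i → vert i ≡ old (vert₀ i)
      vert≡ i = proj₁ (proj₂ (vert-old i))

      project : Cycle H l
      project = record
        { nontrivial = nontrivial ; vert = vert₀ ; hedge = hedge₀
        ; vert-inj = λ {i} {j} eq → vert-inj (trans (vert≡ i) (trans (cong old eq) (sym (vert≡ j))))
        ; hedge-inj = λ {i} {j} eq → hedge-inj (trans (hedge≡ i) (trans (cong suc eq) (sym (hedge≡ j))))
        ; vert∈hedge = λ i → proj₂ (proj₂ (vert-old i))
        ; next∈hedge = λ i → old∈suc⁻ (hedge₀ i)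
            (subst₂ (λ x e → x ∈ edge H⁺ e) (vert≡ (next i)) (hedge≡ i) (next∈hedge i)) }

      traverses⁻ : ∀ {x e} → Traverses c x e → ∃[ u ] ∃[ f ] x ≡ old u × e ≡ suc f × Traverses project u f
      traverses⁻ (i , refl , inj₁ refl) = vert₀ i , hedge₀ i , vert≡ i , hedge≡ i , i , refl , inj₁ refl
      traverses⁻ (i , refl , inj₂ refl) = vert₀ (next i) , hedge₀ i , vert≡ (next i) , hedge≡ i , i , refl , inj₂ refl

      traverses⁺ : ∀ {u f} → Traverses project u f → Traverses c (old u) (suc f)
      traverses⁺ (i , refl , inj₁ refl) = i , hedge≡ i , inj₁ (vert≡ i)
      traverses⁺ (i , refl , inj₂ refl) = i , hedge≡ i , inj₂ (vert≡ (next i))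

    same : ∀ {l l′} (c : Cycle H⁺ l) (c′ : Cycle H⁺ l′) → ∀ {x e} → Traverses c x e → Traverses c′ x e
    same c c′ t with u , f , refl , refl , t₀ ← Projection.traverses⁻ c t =
      Projection.traverses⁺ c′ (Equivalence.to (unique (Projection.project c) (Projection.project c′) u f) t₀)

    pendant-anchored : Anchored k (suc m) g (suc d) H⁺ (old v)
    pendant-anchored = record
      { linearUnicyclic = record
        { uniform = H⁺-uniform ; linear = H⁺-linear
        ; unicyclic = record
          { connected = H⁺-connected ; hasCycle = g , lift cycle
          ; unique = λ c c′ x e → mk⇔ (same c c′) (same c′ c) }
        ; size≡m = cong suc size≡m
        ; girth = lift cycle , λ c → proj₂ girth (Projection.project c) }
      ; cycle = lift cycle ; position = position ; anchor = cong old anchor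
      ; degree≥ = ℕ.≤-trans (s≤s degree≥) (ℕ.≤-reflexive (sym new-degree)) }
      where
      new-degree : degree H⁺ (old v) ≡ suc (degree H v)
      new-degree = trans (degree≡sum H⁺ (old v)) (cong₂ _+_ (ind-yes (old v ∈? edge H⁺ zero) v∈zero)
        (trans (sum-cong-≗ (λ e → ind-cong (old v ∈? edge H⁺ (suc e)) (v ∈? edge H e) (old∈suc⁻ e) old∈suc⁺))
          (sym (degree≡sum H v))))

-- The final anchor is given existentially because every added hyperedge re-embeds the vertices by
-- `_↑ˡ_`.
pendants-anchored : ∀ q p {m g d H v} → Anchored (2 + q) m g d H v →
  ∃[ v′ ] Anchored (2 + q) (p + m) g (p + d) (addPendants (2 + q) (s≤s (s≤s z≤n)) p H v) v′
pendants-anchored q zero    {v = v} A = v , A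
pendants-anchored q (suc p) {m} {g} {d} {H} {v} A
  with v′ , A′ ← pendants-anchored q p (PendantProperties.pendant-anchored q H v A) =
  v′ , subst₂ (λ m d → Anchored (2 + q) m g d (addPendants (2 + q) (s≤s (s≤s z≤n)) (suc p) H v) v′)
    (ℕ.+-suc p m) (ℕ.+-suc p d) A′

C⊙S-anchored : ∀ q g′ p (3≤g : 3 ≤ suc g′) → ∃[ v ] Anchored (2 + q) (p + suc g′) (suc g′) (p + 2)
  (C[ 2 + q , suc g′ ]⊙S[ p ] (s≤s (s≤s z≤n)) 3≤g) v
C⊙S-anchored q g′ p 3≤g = pendants-anchored q p (HypercycleProperties.hypercycle-anchored q g′ 3≤g)

-- Degrees in a unicyclic hypergraph

sum≤term⇒others≡0 : ∀ {n} (f : Fin n → ℕ) c → sum f ≤ f c → ∀ v → c ≢ v → f v ≡ 0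
sum≤term⇒others≡0 {suc n} f c sum≤ v c≢v = ℕ.n≤0⇒n≡0 (ℕ.≤-trans
  (ℕ.≤-reflexive (cong f (sym (punchIn-punchOut c≢v))))
  (ℕ.≤-trans (term≤sum (f ∘ punchIn c) (punchOut c≢v))
    (ℕ.+-cancelˡ-≤ (f c) _ _ (ℕ.≤-trans (ℕ.≤-reflexive (sym (sum-remove {i = c} f)))
      (ℕ.≤-trans sum≤ (ℕ.≤-reflexive (sym (ℕ.+-identityʳ (f c)))))))))

rotate : ∀ {H l} → Cycle H l → Cycle H l
rotate c = record
  { nontrivial = nontrivial ; vert = vert ∘ next ; hedge = hedge ∘ next
  ; vert-inj = next-injective ∘ vert-inj ; hedge-inj = next-injective ∘ hedge-inj
  ; vert∈hedge = vert∈hedge ∘ next ; next∈hedge = next∈hedge ∘ next }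
  where open Cycle c

rotate-to : ∀ {H l} (i : Fin (suc l)) (c : Cycle H (suc l)) →
            ∃[ c′ ] Cycle.vert {H} {suc l} c′ zero ≡ Cycle.vert c i
rotate-to {H} {l} = <-weakInduction
  (λ i → ∀ (c : Cycle H (suc l)) → ∃[ c′ ] Cycle.vert {H} {suc l} c′ zero ≡ Cycle.vert c i)
  (λ c → c , refl)
  (λ i rotate-toᵢ c → let c′ , eq = rotate-toᵢ (rotate c) in
    c′ , trans eq (cong (Cycle.vert c) (next-inject₁ i)))

-- Square of `1 + χ + f`, simplified with `χ² = χ`; the first summand adds up to a constant, as does
-- `2f`.
square-expansion : ∀ {a} {A : Set a} (d : Dec A) f →
  suc (ind d + f) * suc (ind d + f) ≡ (1 + 3 * ind d) + (2 * f + f * (2 * ind d + f))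
square-expansion (yes _) = NatSolver.solve-∀
square-expansion (no _)  = NatSolver.solve-∀

module DegreeExcess (H : Hypergraph) (r p g′ : ℕ) (unif : Uniform (suc r) H) (uni : Unicyclic H)
  (size≡ : size H ≡ p + suc g′) (c : Cycle H (suc g′)) where
  open Cycle c

  private
    g : ℕ
    g = suc g′

    incident? : ∀ v e → Dec (v ∈ edge H e)
    incident? v e = v ∈? edge H e

  onCycle? : ∀ v → Dec (∃[ i ] vert i ≡ v)
  onCycle? = image? vert vert-inj

  edgeAt : ∀ v → ∃[ e ] v ∈ edge H e
  edgeAt v with Unicyclic.connected uni v (vert zero)
  ... | ε                   = hedge zero , vert∈hedge zero
  ... | (e , v∈e , _) ◅ _   = e , v∈e

  2-edges⇒2≤degree : ∀ {v e f} → e ≢ f → v ∈ edge H e → v ∈ edge H f → 2 ≤ degree H v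
  2-edges⇒2≤degree {v} e≢f v∈e v∈f = ℕ.≤-trans (two-distinct⇒2≤ (incident? v) e≢f v∈e v∈f)
    (ℕ.≤-reflexive (sym (degree≡sum H v)))

  3-edges⇒3≤degree : ∀ {v e f h} → e ≢ f → e ≢ h → f ≢ h → v ∈ edge H e → v ∈ edge H f → v ∈ edge H h →
                     3 ≤ degree H v
  3-edges⇒3≤degree {v} ef eh fh v∈e v∈f v∈h = ℕ.≤-trans
    (three-distinct⇒3≤ (incident? v) ef eh fh v∈e v∈f v∈h) (ℕ.≤-reflexive (sym (degree≡sum H v)))

  -- The subtraction never truncates, by `degree≡`: vertices of the cycle have degree at least two,
  -- and connectedness gives every other vertex degree at least one.
  excess : Fin (order H) → ℕ
  excess v = degree H v ∸ suc (ind (onCycle? v))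

  degree≡ : ∀ v → degree H v ≡ suc (ind (onCycle? v) + excess v)
  degree≡ v = sym (ℕ.m+[n∸m]≡n (lower (onCycle? v)))
    where
    lower : (d : Dec (∃[ i ] vert i ≡ v)) → suc (ind d) ≤ degree H v
    lower (yes (i , refl)) with j , _ , distinct , ∈j ← cycle-vertex-edges c i =
      2-edges⇒2≤degree distinct ∈j (vert∈hedge i)
    lower (no _) with e , v∈e ← edgeAt v = ℕ.≤-trans
      (ℕ.≤-trans (ℕ.≤-reflexive (sym (ind-yes (incident? v e) v∈e)))
        (term≤sum (λ e → ind (incident? v e)) e))
      (ℕ.≤-reflexive (sym (degree≡sum H v)))

  sum-onCycle : sum (λ v → ind (onCycle? v)) ≡ g
  sum-onCycle = trans (sum-cong-≗ (λ v → sym (ℕ.*-identityʳ (ind (onCycle? v)))))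
    (trans (sum-restrict vert vert-inj (λ _ → 1)) (sum-ones g))

  -- The total degree is `m(r+1) = m + n`, since there are `n = mr` vertices. Taking away one for
  -- each vertex and one for each vertex of the cycle leaves `m - g = p`.
  sum-excess : sum excess ≡ p
  sum-excess = ℕ.+-cancelˡ-≡ (order H + g) _ _ (begin
    order H + g + sum excess
      ≡⟨ ℕ.+-assoc (order H) g _ ⟩
    order H + (g + sum excess)
      ≡⟨ cong₂ (λ a b → a + (b + sum excess)) (sum-ones (order H)) sum-onCycle ⟨
    sum {order H} (λ _ → 1) + (sum (λ v → ind (onCycle? v)) + sum excess)
      ≡⟨ cong (sum {order H} (λ _ → 1) +_) (∑-distrib-+ (λ v → ind (onCycle? v)) excess) ⟨
    sum {order H} (λ _ → 1) + sum (λ v → ind (onCycle? v) + excess v)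
      ≡⟨ ∑-distrib-+ (λ _ → 1) (λ v → ind (onCycle? v) + excess v) ⟨
    sum (λ v → suc (ind (onCycle? v) + excess v))
      ≡⟨ sum-cong-≗ degree≡ ⟨
    sum (degree H)
      ≡⟨ handshake (suc r) H unif ⟩
    size H * suc r
      ≡⟨ ℕ.*-suc (size H) r ⟩
    size H + size H * r
      ≡⟨ cong₂ _+_ size≡ (sym (unicyclic-order H r unif uni)) ⟩
    p + g + order H
      ≡⟨ rearrange p g (order H) ⟩
    order H + g + p ∎)
    where
    open ≡-Reasoning
    rearrange : ∀ p g n → p + g + n ≡ n + g + p
    rearrange = NatSolver.solve-∀

  concentration : ℕ
  concentration = sum (λ v → excess v * (2 * ind (onCycle? v) + excess v))

  sum-degree² : sum (λ v → degree H v * degree H v) ≡ (order H + 3 * g) + (2 * p + concentration)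
  sum-degree² = begin
    sum (λ v → degree H v * degree H v)
      ≡⟨ sum-cong-≗ (λ v → trans (cong (λ d → d * d) (degree≡ v)) (square-expansion (onCycle? v) (excess v))) ⟩
    sum (λ v → (1 + 3 * χ v) + (2 * excess v + excess v * (2 * χ v + excess v)))
      ≡⟨ ∑-distrib-+ (λ v → 1 + 3 * χ v) _ ⟩
    sum (λ v → 1 + 3 * χ v) + sum (λ v → 2 * excess v + excess v * (2 * χ v + excess v))
      ≡⟨ cong₂ _+_ (∑-distrib-+ (λ _ → 1) (λ v → 3 * χ v)) (∑-distrib-+ (λ v → 2 * excess v) _) ⟩
    (sum {order H} (λ _ → 1) + sum (λ v → 3 * χ v)) + (sum (λ v → 2 * excess v) + concentration)
      ≡⟨ cong₂ (λ a b → a + (b + concentration))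
           (cong₂ _+_ (sum-ones (order H)) (trans (sym (*-distribˡ-sum 3 χ)) (cong (3 *_) sum-onCycle)))
           (trans (sym (*-distribˡ-sum 2 excess)) (cong (2 *_) sum-excess)) ⟩
    (order H + 3 * g) + (2 * p + concentration) ∎
    where
    open ≡-Reasoning
    χ : Fin (order H) → ℕ
    χ v = ind (onCycle? v)

  degree-vert : ∀ i → degree H (vert i) ≡ 2 + excess (vert i)
  degree-vert i = trans (degree≡ (vert i))
    (cong (λ x → suc (x + excess (vert i))) (ind-yes (onCycle? (vert i)) (i , refl)))

  concentration≥ : ∀ i → p + 2 ≤ degree H (vert i) → p * (2 + p) ≤ concentration
  concentration≥ i deg≥ = ℕ.≤-trans
    (ℕ.≤-trans (ℕ.*-mono-≤ p≤ (ℕ.+-mono-≤ (ℕ.≤-refl {2}) p≤))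
      (ℕ.≤-reflexive (cong (λ x → excess (vert i) * (2 * x + excess (vert i)))
        (sym (ind-yes (onCycle? (vert i)) (i , refl))))))
    (term≤sum (λ v → excess v * (2 * ind (onCycle? v) + excess v)) (vert i))
    where
    p≤ : p ≤ excess (vert i)
    p≤ = ℕ.+-cancelˡ-≤ 2 _ _ (ℕ.≤-trans (ℕ.≤-reflexive (ℕ.+-comm 2 p))
      (ℕ.≤-trans deg≥ (ℕ.≤-reflexive (degree-vert i))))

  -- Each vertex contributes at most excess · (p + 1) unless all the excess
  -- sits at a single vertex of the cycle.
  concentration-dichotomy : (∃[ i ] p + 2 ≤ degree H (vert i)) ⊎ concentration < p * (2 + p)
  concentration-dichotomy with any? (λ i → p ℕ.≤? excess (vert i))
  ... | yes (i , p≤) = inj₁ (i , ℕ.≤-trans (ℕ.≤-reflexive (ℕ.+-comm p 2))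
    (ℕ.≤-trans (ℕ.+-monoʳ-≤ 2 p≤) (ℕ.≤-reflexive (sym (degree-vert i)))))
  ... | no none = inj₂ (ℕ.≤-<-trans bound (strict p 1≤p))
    where
    -- For `p = 0` any vertex of the cycle would have satisfied the first alternative.
    1≤p : 1 ≤ p
    1≤p = ℕ.n≢0⇒n>0 (λ p≡0 → none (zero , ℕ.≤-trans (ℕ.≤-reflexive p≡0) z≤n))

    strict : ∀ p → 1 ≤ p → p * suc p < p * (2 + p)
    strict (suc p) _ = ℕ.*-monoʳ-< (suc p) ℕ.≤-refl

    factor≤ : ∀ v → 2 * ind (onCycle? v) + excess v ≤ suc p
    factor≤ v = go (onCycle? v)
      where
      -- On the cycle the excess is below `p`, so two plus the excess is at most `p + 1`; off the
      -- cycle the factor is the excess alone, at most `p`.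
      go : (d : Dec (∃[ i ] vert i ≡ v)) → 2 * ind d + excess v ≤ suc p
      go (yes (i , refl)) = s≤s (ℕ.≰⇒> (λ p≤ → none (i , p≤)))
      go (no _) = ℕ.m≤n⇒m≤1+n (ℕ.≤-trans (term≤sum excess v) (ℕ.≤-reflexive sum-excess))

    bound : concentration ≤ p * suc p
    bound = ℕ.≤-trans (sum-mono (λ v → ℕ.*-monoʳ-≤ (excess v) (factor≤ v)))
      (ℕ.≤-reflexive (trans (sym (*-distribʳ-sum (suc p) excess)) (cong (_* suc p) sum-excess)))

  module Concentrated (deg≥ : p + 2 ≤ degree H (vert zero)) where

    excess-zero : ∀ v → vert zero ≢ v → excess v ≡ 0
    excess-zero = sum≤term⇒others≡0 excess (vert zero) (ℕ.≤-trans (ℕ.≤-reflexive sum-excess)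
      (ℕ.+-cancelˡ-≤ 2 _ _ (ℕ.≤-trans (ℕ.≤-reflexive (ℕ.+-comm 2 p))
        (ℕ.≤-trans deg≥ (ℕ.≤-reflexive (degree-vert zero))))))

    excess-vert-zero : excess (vert zero) ≤ p
    excess-vert-zero = ℕ.≤-trans (term≤sum excess (vert zero)) (ℕ.≤-reflexive sum-excess)

    cored : ∀ {v} → ¬ (∃[ i ] vert i ≡ v) → ∀ {e f} → v ∈ edge H e → v ∈ edge H f → e ≡ f
    cored {v} off {e} {f} v∈e v∈f with e ≟ f
    ... | yes e≡f = e≡f
    ... | no e≢f  = contradiction (ℕ.≤-trans (2-edges⇒2≤degree e≢f v∈e v∈f)
      (ℕ.≤-reflexive (trans (degree≡ v) (cong suc (cong₂ _+_ (ind-no (onCycle? v) off)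
        (excess-zero v (λ eq → off (zero , eq))))))))
      ℕ.1+n≰n

    -- The excess is used up at vert zero, so the other vertices of the cycle have
    -- degree two.
    non-anchor-edges : ∀ {i} → zero ≢ i → ∀ {e} → vert i ∈ edge H e → ∃[ j ] hedge j ≡ e × (i ≡ j ⊎ i ≡ next j)
    non-anchor-edges {i} 0≢i {e} v∈e with j , refl , distinct , ∈j ← cycle-vertex-edges c i
      with e ≟ hedge i | e ≟ hedge j
    ... | yes e≡ | _      = i , sym e≡ , inj₁ refl
    ... | no _   | yes e≡ = j , sym e≡ , inj₂ refl
    ... | no e≢i | no e≢j = contradiction
      (ℕ.≤-trans (3-edges⇒3≤degree e≢i e≢j (distinct ∘ sym) v∈e (vert∈hedge i) ∈j)
        (ℕ.≤-reflexive (trans (degree-vert i) (cong (2 +_) (excess-zero (vert i) (0≢i ∘ vert-inj))))))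
      ℕ.1+n≰n

    -- Follow a walk from a vertex of `e` to the anchor. As long as it is off the cycle, the current
    -- vertex is cored, so the walk stays in `e`. The first vertex of the cycle that it meets is the
    -- anchor, as the others lie only in hyperedges of the cycle.
    pendant-anchor : ∀ {e} → ¬ (∃[ j ] hedge j ≡ e) → vert zero ∈ edge H e
    pendant-anchor {e} off = go (proj₁ member) (proj₂ member) (Unicyclic.connected uni (proj₁ member) (vert zero))
      where
      member : ∃[ u ] u ∈ edge H e
      member with any? (λ u → u ∈? edge H e)
      ... | yes found = found
      ... | no empty  = contradiction
        (trans (sym (unif e)) (trans (∣p∣≡sum (edge H e)) (sum-zero ℕ.+-0-commutativeMonoid
          (λ u → ind-no (u ∈? edge H e) (λ u∈ → empty (u , u∈))))))
        λ ()
      go : ∀ u → u ∈ edge H e → Star (Adjacent H) u (vert zero) → vert zero ∈ edge H e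
      go u u∈e ε = u∈e
      go u u∈e ((f , u∈f , w∈f) ◅ rest) with onCycle? u
      ... | no off-cycle with refl ← cored off-cycle u∈e u∈f = go _ w∈f rest
      ... | yes (i , refl) with zero ≟ i
      ...   | yes refl = u∈e
      ...   | no 0≢i with j , hedge≡e , _ ← non-anchor-edges 0≢i u∈e = contradiction (j , hedge≡e) off

    pendants : sum (λ e → ind (¬? (image? hedge hedge-inj e))) ≡ p
    pendants = ℕ.+-cancelˡ-≡ g _ _ (begin
      g + sum (λ e → ind (¬? (image? hedge hedge-inj e)))
        ≡⟨ cong₂ _+_ (sum-ones g) (sum-cong-≗ (λ e → ℕ.*-identityʳ (ind (¬? (image? hedge hedge-inj e))))) ⟨
      sum {g} (λ _ → 1) + sum (λ e → ind (¬? (image? hedge hedge-inj e)) * 1)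
        ≡⟨ sum-split hedge hedge-inj (λ _ → 1) ⟨
      sum {size H} (λ _ → 1)
        ≡⟨ sum-ones (size H) ⟩
      size H
        ≡⟨ trans size≡ (ℕ.+-comm p g) ⟩
      g + p ∎)
      where open ≡-Reasoning

    -- The anchor has degree at most `2 + p`, and the `p` hyperedges off the cycle all contain it.
    anchor-hedges : sum (λ j → ind (incident? (vert zero) (hedge j))) ≤ 2
    anchor-hedges = ℕ.+-cancelʳ-≤ p _ _ (begin
      sum (λ j → ind (incident? (vert zero) (hedge j))) + p
        ≡⟨ cong (sum (λ j → ind (incident? (vert zero) (hedge j))) +_) (trans (sym pendants) (sum-cong-≗ (λ e → sym (at-pendant e (image? hedge hedge-inj e))))) ⟩
      sum (λ j → ind (incident? (vert zero) (hedge j))) +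
        sum (λ e → ind (¬? (image? hedge hedge-inj e)) * ind (incident? (vert zero) e))
        ≡⟨ sum-split hedge hedge-inj (λ e → ind (incident? (vert zero) e)) ⟨
      sum (λ e → ind (incident? (vert zero) e))
        ≡⟨ trans (sym (degree≡sum H (vert zero))) (degree-vert zero) ⟩
      2 + excess (vert zero)
        ≤⟨ ℕ.+-monoʳ-≤ 2 excess-vert-zero ⟩
      2 + p ∎)
      where
      open ℕ.≤-Reasoning
      at-pendant : ∀ e (d : Dec (∃[ j ] hedge j ≡ e)) → ind (¬? d) * ind (incident? (vert zero) e) ≡ ind (¬? d)
      at-pendant e (yes _)  = refl
      at-pendant e (no off) = trans (ℕ.*-identityˡ _) (ind-yes (incident? (vert zero) e) (pendant-anchor off))

    -- Away from the anchor this is `non-anchor-edges`. At the anchor a third hyperedge of the cycle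
    -- would exceed the bound of `anchor-hedges`.
    vert∈hedge⁻ : ∀ {i j} → vert i ∈ edge H (hedge j) → i ≡ j ⊎ i ≡ next j
    vert∈hedge⁻ {i} {j} v∈ with zero ≟ i
    ... | no 0≢i with j′ , eq , ends ← non-anchor-edges 0≢i v∈ with refl ← hedge-inj eq = ends
    vert∈hedge⁻ {i} {j} v∈ | yes refl with j₀ , eq , distinct , ∈j₀ ← cycle-vertex-edges c zero
      with zero ≟ j | zero ≟ next j
    ... | yes 0≡j | _       = inj₁ 0≡j
    ... | no _    | yes 0≡n = inj₂ 0≡n
    ... | no 0≢j  | no 0≢n  = contradiction
      (ℕ.≤-trans (three-distinct⇒3≤ (λ j → incident? (vert zero) (hedge j)) 0≢j
          (λ 0≡j₀ → distinct (cong hedge (sym 0≡j₀))) (λ { refl → 0≢n (sym eq) })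
          (vert∈hedge zero) v∈ ∈j₀)
        anchor-hedges)
      ℕ.1+n≰n

-- Reconstruction up to isomorphism from labels

module Labelling {r n b} {B : Set b} (_≟ᴮ_ : DecidableEquality B)
  (c : Fin r → Fin n) (c-inj : ∀ {i j} → c i ≡ c j → i ≡ j) (β : Fin n → B) where

  _≟ᴸ_ : DecidableEquality (Fin r ⊎ B)
  _≟ᴸ_ = ⊎-≡-dec _≟_ _≟ᴮ_

  private
    labelBy : ∀ v → Dec (∃[ i ] c i ≡ v) → Fin r ⊎ B
    labelBy v (yes (i , _)) = inj₁ i
    labelBy v (no _)        = inj₂ (β v)

    labelBy-inj₁ : ∀ {v i} (d : Dec (∃[ i ] c i ≡ v)) → labelBy v d ≡ inj₁ i → c i ≡ v
    labelBy-inj₁ (yes (i , eq)) refl = eq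

    labelBy-inj₂ : ∀ {v y} (d : Dec (∃[ i ] c i ≡ v)) → labelBy v d ≡ inj₂ y → ¬ (∃[ i ] c i ≡ v) × β v ≡ y
    labelBy-inj₂ (no off) refl = off , refl

    on-image : ∀ {v i} (d : Dec (∃[ i ] c i ≡ v)) → c i ≡ v → labelBy v d ≡ inj₁ i
    on-image (yes (j , cj≡v)) ci≡v = cong inj₁ (c-inj (trans cj≡v (sym ci≡v)))
    on-image (no off)         ci≡v = contradiction (_ , ci≡v) off

    off-image : ∀ {v} (d : Dec (∃[ i ] c i ≡ v)) → ¬ (∃[ i ] c i ≡ v) → labelBy v d ≡ inj₂ (β v)
    off-image (yes on) off = contradiction on off
    off-image (no _)   off = refl

  label : Fin n → Fin r ⊎ B
  label v = labelBy v (image? c c-inj v)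

  label-on : ∀ {v i} → c i ≡ v → label v ≡ inj₁ i
  label-on {v} = on-image (image? c c-inj v)

  label-off : ∀ {v} → ¬ (∃[ i ] c i ≡ v) → label v ≡ inj₂ (β v)
  label-off {v} = off-image (image? c c-inj v)

  label-inj₁ : ∀ {v i} → label v ≡ inj₁ i → c i ≡ v
  label-inj₁ {v} = labelBy-inj₁ (image? c c-inj v)

  label-inj₂ : ∀ {v y} → label v ≡ inj₂ y → ¬ (∃[ i ] c i ≡ v) × β v ≡ y
  label-inj₂ {v} = labelBy-inj₂ (image? c c-inj v)

  count-inj₁ : ∀ i → sum (λ v → ind (label v ≟ᴸ inj₁ i)) ≡ 1
  count-inj₁ i = trans
    (sum-cong-≗ λ v → trans (ind-cong (label v ≟ᴸ inj₁ i) (c i ≟ v) label-inj₁ label-on)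
      (sym (ℕ.*-identityʳ (ind (c i ≟ v)))))
    (sum-δ (c i) (λ _ → 1))

  count-inj₂ : ∀ y → sum (λ v → ind (label v ≟ᴸ inj₂ y)) ≡
                     sum (λ v → ind (¬? (image? c c-inj v)) * ind (β v ≟ᴮ y))
  count-inj₂ y = sum-cong-≗ λ v → trans
    (ind-cong (label v ≟ᴸ inj₂ y) (¬? (image? c c-inj v) ×-dec (β v ≟ᴮ y))
      label-inj₂ (λ (off , eq) → trans (label-off off) (cong inj₂ eq)))
    (ind-× (¬? (image? c c-inj v)) (β v ≟ᴮ y))

-- What determines the hypergraph up to isomorphism: the incidence of cycle vertices with all
-- hyperedges is prescribed, and every other vertex is cored. Degrees no longer occur.
record PendantCycle (k p g′ : ℕ) (H : Hypergraph) : Set where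
  field
    cycle : Cycle H (suc g′)
  open Cycle cycle public
  field
    uniform        : Uniform k H
    edgeAt         : ∀ v → ∃[ e ] v ∈ edge H e
    pendants       : sum (λ e → ind (¬? (image? hedge hedge-inj e))) ≡ p
    cored          : ∀ {v} → ¬ (∃[ i ] vert i ≡ v) → ∀ {e f} → v ∈ edge H e → v ∈ edge H f → e ≡ f
    vert∈hedge⁻    : ∀ {i j} → vert i ∈ edge H (hedge j) → i ≡ j ⊎ i ≡ next j
    pendant-anchor : ∀ {e} → ¬ (∃[ j ] hedge j ≡ e) → vert zero ∈ edge H e
    pendant-only   : ∀ {i e} → ¬ (∃[ j ] hedge j ≡ e) → vert i ∈ edge H e → i ≡ zero

  module EdgeLabels = Labelling Unit._≟_ hedge hedge-inj (λ _ → tt)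

  Meets : Fin (suc g′) → Fin (suc g′) ⊎ Unit → Set
  Meets i (inj₁ j) = i ≡ j ⊎ i ≡ next j
  Meets i (inj₂ _) = i ≡ zero

  meets⁺ : ∀ {i e} → vert i ∈ edge H e → Meets i (EdgeLabels.label e)
  meets⁺ {i} {e} v∈e with EdgeLabels.label e in eq
  ... | inj₁ j with refl ← EdgeLabels.label-inj₁ eq = vert∈hedge⁻ v∈e
  ... | inj₂ _ = pendant-only (proj₁ (EdgeLabels.label-inj₂ eq)) v∈e

  meets⁻ : ∀ {i e} → Meets i (EdgeLabels.label e) → vert i ∈ edge H e
  meets⁻ {i} {e} meets with EdgeLabels.label e in eq
  ... | inj₁ j with refl ← EdgeLabels.label-inj₁ eq =
    [ (λ { refl → vert∈hedge j }) , (λ { refl → next∈hedge j }) ]′ meets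
  meets⁻ {e = e} refl | inj₂ _ = pendant-anchor (proj₁ (EdgeLabels.label-inj₂ {e} eq))

  count-pendants : sum (λ e → ind (EdgeLabels.label e EdgeLabels.≟ᴸ inj₂ tt)) ≡ p
  count-pendants = trans (EdgeLabels.count-inj₂ tt)
    (trans (sum-cong-≗ (λ e → ℕ.*-identityʳ (ind (¬? (image? hedge hedge-inj e))))) pendants)

  cored-count : ∀ e → sum (λ i → ind (vert i ∈? edge H e)) +
    sum (λ v → ind (¬? (image? vert vert-inj v)) * ind (v ∈? edge H e)) ≡ k
  cored-count e = trans (sym (sum-split vert vert-inj (λ v → ind (v ∈? edge H e))))
    (trans (sym (∣p∣≡sum (edge H e))) (uniform e))

-- Incidence depends only on labels, and the two hypergraphs have equally many
-- hyperedges, hence also equally many vertices, with each label.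
module _ {k p g′ H H′} (D : PendantCycle k p g′ H) (D′ : PendantCycle k p g′ H′) where
  private
    module D = PendantCycle D
    module D′ = PendantCycle D′

    edge-bijection : ∃[ π ] ∀ e → D′.EdgeLabels.label (π ⟨$⟩ʳ e) ≡ D.EdgeLabels.label e
    edge-bijection = labelled-bijection D.EdgeLabels._≟ᴸ_ D.EdgeLabels.label D′.EdgeLabels.label
      λ { (inj₁ i) → trans (D.EdgeLabels.count-inj₁ i) (sym (D′.EdgeLabels.count-inj₁ i))
        ; (inj₂ tt) → trans D.count-pendants (sym D′.count-pendants) }

    πᴱ : Permutation (size H) (size H′)
    πᴱ = proj₁ edge-bijection

    label-πᴱ : ∀ e → D′.EdgeLabels.label (πᴱ ⟨$⟩ʳ e) ≡ D.EdgeLabels.label e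
    label-πᴱ = proj₂ edge-bijection

    meets-π⁺ : ∀ {i e} → D.vert i ∈ edge H e → D′.vert i ∈ edge H′ (πᴱ ⟨$⟩ʳ e)
    meets-π⁺ {i} {e} v∈e = D′.meets⁻ (subst (D.Meets i) (sym (label-πᴱ e)) (D.meets⁺ v∈e))

    meets-π⁻ : ∀ {i e} → D′.vert i ∈ edge H′ (πᴱ ⟨$⟩ʳ e) → D.vert i ∈ edge H e
    meets-π⁻ {i} {e} v∈e = D.meets⁻ (subst (D.Meets i) (label-πᴱ e) (D′.meets⁺ v∈e))

    -- A vertex off the cycle is labelled by its only hyperedge, carried over by `πᴱ` so that the
    -- vertices of both hypergraphs take labels among the hyperedges of `H′`.
    home : Fin (order H) → Fin (size H′)
    home v = πᴱ ⟨$⟩ʳ proj₁ (D.edgeAt v)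

    home′ : Fin (order H′) → Fin (size H′)
    home′ v = proj₁ (D′.edgeAt v)

    module L = Labelling _≟_ D.vert D.vert-inj home
    module L′ = Labelling _≟_ D′.vert D′.vert-inj home′

    home⇒∈ : ∀ {v e} → home v ≡ πᴱ ⟨$⟩ʳ e → v ∈ edge H e
    home⇒∈ {v} {e} eq = subst (λ f → v ∈ edge H f)
      (trans (sym (Perm.inverseˡ πᴱ)) (trans (cong (πᴱ ⟨$⟩ˡ_) eq) (Perm.inverseˡ πᴱ))) (proj₂ (D.edgeAt v))

    ∈⇒home : ∀ {v e} → ¬ (∃[ i ] D.vert i ≡ v) → v ∈ edge H e → home v ≡ πᴱ ⟨$⟩ʳ e
    ∈⇒home off v∈e = cong (πᴱ ⟨$⟩ʳ_) (D.cored off (proj₂ (D.edgeAt _)) v∈e)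

    home′⇒∈ : ∀ {v e} → home′ v ≡ e → v ∈ edge H′ e
    home′⇒∈ {v} refl = proj₂ (D′.edgeAt v)

    ∈⇒home′ : ∀ {v e} → ¬ (∃[ i ] D′.vert i ≡ v) → v ∈ edge H′ e → home′ v ≡ e
    ∈⇒home′ off v∈e = D′.cored off (proj₂ (D′.edgeAt _)) v∈e

    masked-cong : ∀ {a b c} {A : Set a} {B : Set b} {C : Set c} (d : Dec A) (x : Dec B) (y : Dec C) →
      (¬ A → B → C) → (C → B) → ind (¬? d) * ind x ≡ ind (¬? d) * ind y
    masked-cong (yes _) x y to from = refl
    masked-cong (no ¬a) x y to from = cong (_+ 0) (ind-cong x y (to ¬a) from)

    -- The vertices of `e` off the cycle number `k` minus those on the cycle, and the latter are
    -- equally many on both sides because `πᴱ` respects `Meets`.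
    count-home : ∀ e → sum (λ v → ind (L.label v L.≟ᴸ inj₂ (πᴱ ⟨$⟩ʳ e))) ≡
                       sum (λ v → ind (L′.label v L′.≟ᴸ inj₂ (πᴱ ⟨$⟩ʳ e)))
    count-home e = begin
      sum (λ v → ind (L.label v L.≟ᴸ inj₂ (πᴱ ⟨$⟩ʳ e)))
        ≡⟨ L.count-inj₂ (πᴱ ⟨$⟩ʳ e) ⟩
      sum (λ v → ind (¬? (image? D.vert D.vert-inj v)) * ind (home v ≟ πᴱ ⟨$⟩ʳ e))
        ≡⟨ sum-cong-≗ (λ v → sym (masked-cong (image? D.vert D.vert-inj v) (v ∈? edge H e) (home v ≟ πᴱ ⟨$⟩ʳ e) ∈⇒home home⇒∈)) ⟩
      sum (λ v → ind (¬? (image? D.vert D.vert-inj v)) * ind (v ∈? edge H e))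
        ≡⟨ ℕ.+-cancelˡ-≡ (sum (λ i → ind (D.vert i ∈? edge H e))) _ _
             (trans (D.cored-count e) (trans (sym (D′.cored-count (πᴱ ⟨$⟩ʳ e))) (cong (_+ rest′) cores))) ⟩
      rest′
        ≡⟨ sum-cong-≗ (λ v → masked-cong (image? D′.vert D′.vert-inj v) (v ∈? edge H′ (πᴱ ⟨$⟩ʳ e)) (home′ v ≟ πᴱ ⟨$⟩ʳ e) ∈⇒home′ home′⇒∈) ⟩
      sum (λ v → ind (¬? (image? D′.vert D′.vert-inj v)) * ind (home′ v ≟ πᴱ ⟨$⟩ʳ e))
        ≡⟨ L′.count-inj₂ (πᴱ ⟨$⟩ʳ e) ⟨
      sum (λ v → ind (L′.label v L′.≟ᴸ inj₂ (πᴱ ⟨$⟩ʳ e))) ∎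
      where
      open ≡-Reasoning
      rest′ = sum (λ v → ind (¬? (image? D′.vert D′.vert-inj v)) * ind (v ∈? edge H′ (πᴱ ⟨$⟩ʳ e)))
      cores : sum (λ i → ind (D′.vert i ∈? edge H′ (πᴱ ⟨$⟩ʳ e))) ≡ sum (λ i → ind (D.vert i ∈? edge H e))
      cores = sum-cong-≗ (λ i → ind-cong (D′.vert i ∈? edge H′ (πᴱ ⟨$⟩ʳ e)) (D.vert i ∈? edge H e) meets-π⁻ meets-π⁺)

    vertex-bijection : ∃[ π ] ∀ v → L′.label (π ⟨$⟩ʳ v) ≡ L.label v
    vertex-bijection = labelled-bijection L._≟ᴸ_ L.label L′.label
      λ { (inj₁ i) → trans (L.count-inj₁ i) (sym (L′.count-inj₁ i))
        ; (inj₂ e′) → subst (λ f → sum (λ v → ind (L.label v L.≟ᴸ inj₂ f)) ≡ sum (λ v → ind (L′.label v L′.≟ᴸ inj₂ f)))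
            (Perm.inverseʳ πᴱ) (count-home (πᴱ ⟨$⟩ˡ e′)) }

    πⱽ : Permutation (order H) (order H′)
    πⱽ = proj₁ vertex-bijection

    label-πⱽ : ∀ v → L′.label (πⱽ ⟨$⟩ʳ v) ≡ L.label v
    label-πⱽ = proj₂ vertex-bijection

    incidence⁺ : ∀ v e → v ∈ edge H e → (πⱽ ⟨$⟩ʳ v) ∈ edge H′ (πᴱ ⟨$⟩ʳ e)
    incidence⁺ v e v∈e with image? D.vert D.vert-inj v
    ... | yes (i , refl) = subst (_∈ edge H′ (πᴱ ⟨$⟩ʳ e))
      (L′.label-inj₁ (trans (label-πⱽ v) (L.label-on refl))) (meets-π⁺ v∈e)
    ... | no off = home′⇒∈ (trans (proj₂ (L′.label-inj₂ (trans (label-πⱽ v) (L.label-off off)))) (∈⇒home off v∈e))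

    incidence⁻ : ∀ v e → (πⱽ ⟨$⟩ʳ v) ∈ edge H′ (πᴱ ⟨$⟩ʳ e) → v ∈ edge H e
    incidence⁻ v e v∈e with image? D.vert D.vert-inj v
    ... | yes (i , refl) = meets-π⁻ (subst (_∈ edge H′ (πᴱ ⟨$⟩ʳ e))
      (sym (L′.label-inj₁ (trans (label-πⱽ v) (L.label-on refl)))) v∈e)
    ... | no off with off′ , eq ← L′.label-inj₂ (trans (label-πⱽ v) (L.label-off off)) =
      home⇒∈ (trans (sym eq) (∈⇒home′ off′ v∈e))

  pendantCycles-isomorphic : Isomorphic H H′
  pendantCycles-isomorphic = record
    { vertices = πⱽ ; edges = πᴱ ; incidence = λ v e → mk⇔ (incidence⁺ v e) (incidence⁻ v e) }

anchored⇒pendantCycle : ∀ {H r p g′} → Uniform (suc r) H → Unicyclic H → size H ≡ p + suc g′ →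
  (c : Cycle H (suc g′)) → ∀ i → p + 2 ≤ degree H (Cycle.vert c i) → PendantCycle (suc r) p g′ H
anchored⇒pendantCycle {H} {r} {p} {g′} unif uni size≡ c i deg≥ with c′ , eq ← rotate-to i c = record
  { cycle = c′ ; uniform = unif ; edgeAt = edgeAt ; pendants = pendants ; cored = cored
  ; vert∈hedge⁻ = vert∈hedge⁻ ; pendant-anchor = pendant-anchor
  ; pendant-only = pendant-only }
  where
  open DegreeExcess H r p g′ unif uni size≡ c′
  open Concentrated (subst (λ v → p + 2 ≤ degree H v) (sym eq) deg≥)
  pendant-only : ∀ {i e} → ¬ (∃[ j ] Cycle.hedge c′ j ≡ e) → Cycle.vert c′ i ∈ edge H e → i ≡ zero
  pendant-only {i} off v∈e with zero ≟ i
  ... | yes 0≡i = sym 0≡i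
  ... | no 0≢i with j , eq , _ ← non-anchor-edges 0≢i v∈e = contradiction (j , eq) off

-- Closed walks and traces

Arc : ℕ → Set
Arc n = Fin n × Fin n

Walk : ∀ {n} → Fin n → List (Arc n) → Fin n → Set
Walk a []            b = a ≡ b
Walk a ((s , t) ∷ w) b = s ≡ a × Walk t w b

arcs : ∀ {n r} → Fin n → Vec (Fin n) r → List (Arc n) → List (Arc n)
arcs i []      D = D
arcs i (j ∷ γ) D = arcs i γ ((i , j) ∷ D)

arcs-All : ∀ {n r p} {P : Arc n → Set p} {i} (γ : Vec (Fin n) r) {D} →
           Allⱽ (λ x → P (i , x)) γ → All P D → All P (arcs i γ D)
arcs-All []      []       PD = PD
arcs-All (j ∷ γ) (Pj ∷ Pγ) PD = arcs-All γ Pγ (Pj ∷ PD)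

∈-arcsʳ : ∀ {n r i} (γ : Vec (Fin n) r) {D d} → d ∈ᴸ D → d ∈ᴸ arcs i γ D
∈-arcsʳ []      d∈ = d∈
∈-arcsʳ (j ∷ γ) d∈ = ∈-arcsʳ γ (there d∈)

∈-arcsˡ : ∀ {n r i x} {γ : Vec (Fin n) r} {D} → x ∈ⱽ γ → (i , x) ∈ᴸ arcs i γ D
∈-arcsˡ {γ = _ ∷ γ} (here refl) = ∈-arcsʳ γ (here refl)
∈-arcsˡ             (there x∈)  = ∈-arcsˡ x∈

arcs-replicate : ∀ {n} (i : Fin n) r m →
  arcs i (replicate r i) (List.replicate m (i , i)) ≡ List.replicate (r + m) (i , i)
arcs-replicate i zero    m = refl
arcs-replicate i (suc r) m =
  trans (arcs-replicate i r (suc m)) (cong (λ N → List.replicate N (i , i)) (ℕ.+-suc r m))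

module _ {n p} {P : Fin n → Set p} where

  walk-targets : ∀ {a b} w → Walk a w b → P b → All (P ∘ proj₁) w → All (P ∘ proj₂) w
  walk-targets []                        _                Pb []            = []
  walk-targets (_ ∷ [])                  (_ , refl)       Pb (_ ∷ [])      = Pb ∷ []
  walk-targets (_ ∷ w@(_ ∷ _)) (_ , walk@(refl , _)) Pb (_ ∷ Ps@(Pt ∷ _)) = Pt ∷ walk-targets w walk Pb Ps

  -- On a closed walk each target is the source of the next arc, cyclically; a property of all
  -- sources thus passes to all targets.
  closed-walk-targets : ∀ {a} w → Walk a w a → All (P ∘ proj₁) w → All (P ∘ proj₂) w
  closed-walk-targets []      _                 []         = []
  closed-walk-targets (_ ∷ w) walk@(refl , _) Ps@(Pa ∷ _) = walk-targets (_ ∷ w) walk Pa Ps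

module _ {n} {i : Fin n} where

  -- If every arc out of `i` is a loop, a walk that is at `i` never leaves it; by contraposition, in
  -- `untrapped`, a walk ending elsewhere never uses an arc from `i`.
  trapped : ∀ w {b} → Walk i w b → All (λ d → proj₁ d ≡ i → proj₂ d ≡ i) w →
            All (λ d → proj₁ d ≡ i) w × b ≡ i
  trapped []            refl            []        = [] , refl
  trapped ((_ , t) ∷ w) (refl , walk) (stay ∷ stays)
    with refl ← stay refl
    with all , b≡i ← trapped w walk stays = refl ∷ all , b≡i

  untrapped : ∀ w {a b} → Walk a w b → b ≢ i → All (λ d → proj₁ d ≡ i → proj₂ d ≡ i) w →
              All (λ d → proj₁ d ≢ i) w
  untrapped []            _             b≢i []             = []
  untrapped ((s , t) ∷ w) (refl , walk) b≢i (stay ∷ stays) =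
    (λ s≡i → b≢i (proj₂ (trapped w (subst (λ x → Walk x w _) (stay s≡i) walk) stays)))
    ∷ untrapped w walk b≢i stays

≢replicate⇒∃≢ : ∀ {n r} {i : Fin n} (γ : Vec (Fin n) r) → γ ≢ replicate r i → ∃[ x ] x ∈ⱽ γ × x ≢ i
≢replicate⇒∃≢         []      γ≢ = contradiction refl γ≢
≢replicate⇒∃≢ {i = i} (x ∷ γ) γ≢ with x ≟ i
... | no x≢i   = x , here refl , x≢i
... | yes refl with y , y∈ , y≢i ← ≢replicate⇒∃≢ γ (γ≢ ∘ cong (x ∷_)) = y , there y∈ , y≢i

replicate-All : ∀ {n p} {P : Fin n → Set p} {i} r → P i → Allⱽ P (replicate r i)
replicate-All zero    Pi = []
replicate-All (suc r) Pi = Pi ∷ replicate-All r Pi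

always : ∀ {n r p} {P : Fin n → Set p} (γ : Vec (Fin n) r) → (∀ x → P x) → Allⱽ P γ
always γ Px = VAll.universal Px γ

units : ∀ {n} → Fin n → Vec ℕ n
units zero    = 1 ∷ replicate _ 0
units (suc i) = 0 ∷ units i

-- e_i + e_j
units₂ : ∀ {n} → Fin n → Fin n → Vec ℕ n
units₂ zero    zero    = 2 ∷ replicate _ 0
units₂ zero    (suc j) = 1 ∷ units j
units₂ (suc i) zero    = 1 ∷ units i
units₂ (suc i) (suc j) = 0 ∷ units₂ i j

module _ {a ℓ} (M : CommutativeMonoid a ℓ) where
  private module M = CommutativeMonoid M
  open MonoidSum M using () renaming (sum to sumᴹ; sum-cong-≋ to sumᴹ-cong)

  -- The sum over all i < j.
  pairSum : ∀ {n} → (Fin n → Fin n → M.Carrier) → M.Carrier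
  pairSum {zero}  f = M.ε
  pairSum {suc n} f = sumᴹ (λ j → f zero (suc j)) M.∙ pairSum (λ i j → f (suc i) (suc j))

  pairSum-cong : ∀ {n} {f g : Fin n → Fin n → M.Carrier} →
    (∀ i j → toℕ i < toℕ j → f i j M.≈ g i j) → pairSum f M.≈ pairSum g
  pairSum-cong {zero}  f≈g = M.refl
  pairSum-cong {suc n} f≈g = M.∙-cong (sumᴹ-cong (λ j → f≈g zero (suc j) (s≤s z≤n)))
    (pairSum-cong (λ i j i<j → f≈g (suc i) (suc j) (s≤s i<j)))

  pairSum-zero : ∀ {n} {f : Fin n → Fin n → M.Carrier} →
    (∀ i j → toℕ i < toℕ j → f i j M.≈ M.ε) → pairSum f M.≈ M.ε
  pairSum-zero {zero}  z = M.refl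
  pairSum-zero {suc n} z = M.trans
    (M.∙-cong (sum-zero M (λ j → z zero (suc j) (s≤s z≤n)))
      (pairSum-zero (λ i j i<j → z (suc i) (suc j) (s≤s i<j))))
    (M.identityˡ M.ε)

pairSumℕ : ∀ {n} → (Fin n → Fin n → ℕ) → ℕ
pairSumℕ = pairSum ℕ.+-0-commutativeMonoid

pairSum-symmetric : ∀ {n} (f : Fin n → Fin n → ℕ) → (∀ i j → f i j ≡ f j i) → (∀ i → f i i ≡ 0) →
                    sum (λ i → sum (f i)) ≡ pairSumℕ (λ i j → f i j + f i j)
pairSum-symmetric {zero}  f f-sym f-diag = refl
pairSum-symmetric {suc n} f f-sym f-diag = begin
  (f zero zero + row) + sum (λ i → f (suc i) zero + sum (λ j → f (suc i) (suc j)))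
    ≡⟨ cong₂ _+_ (cong (_+ row) (f-diag zero)) (∑-distrib-+ (λ i → f (suc i) zero) _) ⟩
  row + (sum (λ i → f (suc i) zero) + sum (λ i → sum (λ j → f (suc i) (suc j))))
    ≡⟨ cong (row +_) (cong₂ _+_ (sum-cong-≗ (λ i → f-sym (suc i) zero))
         (pairSum-symmetric (λ i j → f (suc i) (suc j)) (λ i j → f-sym (suc i) (suc j)) (f-diag ∘ suc))) ⟩
  row + (row + pairs)
    ≡⟨ ℕ.+-assoc row row pairs ⟨
  (row + row) + pairs
    ≡⟨ cong (_+ pairs) (∑-distrib-+ (λ j → f zero (suc j)) (λ j → f zero (suc j))) ⟨
  sum (λ j → f zero (suc j) + f zero (suc j)) + pairs ∎
  where
  open ≡-Reasoning
  row = sum (λ j → f zero (suc j))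
  pairs = pairSumℕ (λ i j → f (suc i) (suc j) + f (suc i) (suc j))

∣⁅i⁆∪⁅j⁆∣≤2 : ∀ {n} (i j : Fin n) → ∣ ⁅ i ⁆ ∪ ⁅ j ⁆ ∣ ≤ 2
∣⁅i⁆∪⁅j⁆∣≤2 i j = ℕ.≤-trans (ℕ.m≤m+n _ _)
  (ℕ.≤-reflexive (trans (∣p∪q∣+∣p∩q∣ ⁅ i ⁆ ⁅ j ⁆) (cong₂ _+_ (∣⁅x⁆∣≡1 i) (∣⁅x⁆∣≡1 j))))

∣p∣≥2⇒∃≢ : ∀ {n} {p : Subset n} i → 2 ≤ ∣ p ∣ → ∃[ w ] w ∈ p × w ≢ i
∣p∣≥2⇒∃≢ {p = p} i 2≤ with any? (λ w → (w ∈? p) ×-dec (¬? (w ≟ i)))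
... | yes found = found
... | no none   = contradiction (ℕ.≤-trans 2≤ (ℕ.≤-trans (p⊆q⇒∣p∣≤∣q∣ p⊆⁅i⁆) (ℕ.≤-reflexive (∣⁅x⁆∣≡1 i))))
  ℕ.1+n≰n
  where
  p⊆⁅i⁆ : p ⊆ ⁅ i ⁆
  p⊆⁅i⁆ {x} x∈p with x ≟ i
  ... | yes refl = x∈⁅x⁆ i
  ... | no x≢i   = contradiction (x , x∈p , x≢i) none

-- Iterated derivatives of the trace of a power, evaluated at 0

module Traces {c ℓ₁ ℓ₂ ℓ₃} (R : RealNumbers c ℓ₁ ℓ₂ ℓ₃) where
  open RealNumbers R renaming (fromℕ to fromℕᴿ)
  open Spectral R
  module ℛ = CommutativeRing commutativeRing
  module ℛMult = SemiringMult ℛ.semiring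
  module Σᴿ = SemiringSum ℛ.semiring
  open Σᴿ using () renaming (sum to sumᴿ)
  open SetoidReasoning ℛ.setoid

  -- The derivative along the arcs of `D`, evaluated at 0: up to factorials of multiplicities, the
  -- coefficient of the monomial that `D` spells out.
  E : ∀ {n} → List (Arc n) → Poly n → Carrier
  E []            p = constantTerm p
  E ((i , j) ∷ D) p = E D (∂ i j p)

  infix 4 _≋_
  -- `Poly` consists of expressions, so equality of all derivatives at 0 takes the place of equality
  -- of polynomials; row operators respect it by `E-row-cong`.
  _≋_ : ∀ {n} → Poly n → Poly n → Set _
  p ≋ q = ∀ D → E D p ≈ E D q

  sumᴸ : ∀ {a} {A : Set a} → List A → (A → Carrier) → Carrier
  sumᴸ xs f = foldr (λ x s → f x +ᴿ s) 0# xs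

  module _ {a} {A : Set a} where

    sumᴸ-cong : ∀ (xs : List A) {f g} → (∀ x → f x ≈ g x) → sumᴸ xs f ≈ sumᴸ xs g
    sumᴸ-cong []       f≈g = ℛ.refl
    sumᴸ-cong (x ∷ xs) f≈g = ℛ.+-cong (f≈g x) (sumᴸ-cong xs f≈g)

    sumᴸ-zero : ∀ (xs : List A) {f} → (∀ x → f x ≈ 0#) → sumᴸ xs f ≈ 0#
    sumᴸ-zero []       z = ℛ.refl
    sumᴸ-zero (x ∷ xs) z = ℛ.trans (ℛ.+-cong (z x) (sumᴸ-zero xs z)) (ℛ.+-identityˡ 0#)

    sumᴸ-++ : ∀ (xs ys : List A) f → sumᴸ (xs List.++ ys) f ≈ sumᴸ xs f +ᴿ sumᴸ ys f
    sumᴸ-++ []       ys f = ℛ.sym (ℛ.+-identityˡ _)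
    sumᴸ-++ (x ∷ xs) ys f = ℛ.trans (ℛ.+-congˡ (sumᴸ-++ xs ys f)) (ℛ.sym (ℛ.+-assoc _ _ _))

    sumᴸ-map : ∀ {b} {B : Set b} (g : B → A) xs f → sumᴸ (List.map g xs) f ≡ sumᴸ xs (f ∘ g)
    sumᴸ-map g []       f = refl
    sumᴸ-map g (x ∷ xs) f = cong (f (g x) +ᴿ_) (sumᴸ-map g xs f)

    sumᴸ-cartesian : ∀ {b} {B : Set b} {d} {D : Set d} (h : D → B → A) xs ys f →
      sumᴸ (cartesianProductWith h xs ys) f ≈ sumᴸ xs (λ x → sumᴸ ys (λ y → f (h x y)))
    sumᴸ-cartesian h []       ys f = ℛ.refl
    sumᴸ-cartesian h (x ∷ xs) ys f = ℛ.trans (sumᴸ-++ (List.map (h x) ys) _ f)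
      (ℛ.+-cong (ℛ.reflexive (sumᴸ-map (h x) ys f)) (sumᴸ-cartesian h xs ys f))

    sumᴸ-filter : ∀ {p} {P : A → Set p} (P? : ∀ x → Dec (P x)) xs f →
      sumᴸ (filter P? xs) f ≈ sumᴸ xs (λ x → if does (P? x) then f x else 0#)
    sumᴸ-filter P? []       f = ℛ.refl
    sumᴸ-filter P? (x ∷ xs) f with does (P? x)
    ... | false = ℛ.trans (sumᴸ-filter P? xs f) (ℛ.sym (ℛ.+-identityˡ _))
    ... | true  = ℛ.+-congˡ (sumᴸ-filter P? xs f)

    sumᴸ-tabulate : ∀ {n} (g : Fin n → A) f → sumᴸ (List.tabulate g) f ≡ sumᴿ (f ∘ g)
    sumᴸ-tabulate {zero}  g f = refl
    sumᴸ-tabulate {suc n} g f = cong (f (g zero) +ᴿ_) (sumᴸ-tabulate (g ∘ suc) f)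

  sumᴸ-allFin : ∀ {n} (f : Fin n → Carrier) → sumᴸ (allFin n) f ≈ sumᴿ f
  sumᴸ-allFin {n} f = ℛ.reflexive (sumᴸ-tabulate {n = n} id f)

  sumᴸ-vectors-single : ∀ {n} r (F : Vec (Fin n) r → Carrier) γ₀ → (∀ γ → γ₀ ≢ γ → F γ ≈ 0#) →
                        sumᴸ (vectors (allFin n) r) F ≈ F γ₀
  sumᴸ-vectors-single         zero    F []       z = ℛ.+-identityʳ _
  sumᴸ-vectors-single {n = n} (suc r) F (i ∷ γ₀) z = begin
    sumᴸ (vectors (allFin n) (suc r)) F
      ≈⟨ sumᴸ-cartesian _∷_ (allFin n) (vectors (allFin n) r) F ⟩
    sumᴸ (allFin n) (λ j → sumᴸ (vectors (allFin n) r) (λ γ → F (j ∷ γ)))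
      ≈⟨ sumᴸ-allFin (λ j → sumᴸ (vectors (allFin n) r) (λ γ → F (j ∷ γ))) ⟩
    sumᴿ (λ j → sumᴸ (vectors (allFin n) r) (λ γ → F (j ∷ γ)))
      ≈⟨ sum-single ℛ.+-commutativeMonoid _ i (λ j i≢j →
           sumᴸ-zero (vectors (allFin n) r) (λ γ → z (j ∷ γ) λ { refl → i≢j refl })) ⟩
    sumᴸ (vectors (allFin n) r) (λ γ → F (i ∷ γ))
      ≈⟨ sumᴸ-vectors-single r (λ γ → F (i ∷ γ)) γ₀ (λ γ γ₀≢γ → z (i ∷ γ) λ { refl → γ₀≢γ refl }) ⟩
    F (i ∷ γ₀) ∎

  E-con0 : ∀ {n} (D : List (Arc n)) → E D (con 0#) ≈ 0#
  E-con0 []      = ℛ.refl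
  E-con0 (_ ∷ D) = E-con0 D

  E-⊞ : ∀ {n} D (p q : Poly n) → E D (p ⊞ q) ≈ E D p +ᴿ E D q
  E-⊞ []      p q = ℛ.refl
  E-⊞ (_ ∷ D) p q = E-⊞ D _ _

  E-∑ : ∀ {n a} {A : Set a} D (xs : List A) (f : A → Poly n) → E D (∑ xs f) ≈ sumᴸ xs (E D ∘ f)
  E-∑ D []       f = E-con0 D
  E-∑ D (x ∷ xs) f = ℛ.trans (E-⊞ D _ _) (ℛ.+-congˡ (E-∑ D xs f))

  E-con⊠ : ∀ {n} D x (q : Poly n) → E D (con x ⊠ q) ≈ x *ᴿ E D q
  E-con⊠ []            x q = ℛ.refl
  E-con⊠ ((i , j) ∷ D) x q = begin
    E D ((con 0# ⊠ q) ⊞ (con x ⊠ ∂ i j q))        ≈⟨ E-⊞ D _ _ ⟩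
    E D (con 0# ⊠ q) +ᴿ E D (con x ⊠ ∂ i j q)     ≈⟨ ℛ.+-cong (E-con⊠ D 0# q) (E-con⊠ D x (∂ i j q)) ⟩
    0# *ᴿ E D q +ᴿ x *ᴿ E D (∂ i j q)             ≈⟨ ℛ.+-congʳ (ℛ.zeroˡ _) ⟩
    0# +ᴿ x *ᴿ E D (∂ i j q)                      ≈⟨ ℛ.+-identityˡ _ ⟩
    x *ᴿ E D (∂ i j q)                            ∎

  E-0⊠ : ∀ {n} D (q : Poly n) → E D (con 0# ⊠ q) ≈ 0#
  E-0⊠ D q = ℛ.trans (E-con⊠ D 0# q) (ℛ.zeroˡ _)

  E-1⊠ : ∀ {n} D (q : Poly n) → E D (con 1# ⊠ q) ≈ E D q
  E-1⊠ D q = ℛ.trans (E-con⊠ D 1# q) (ℛ.*-identityˡ _)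

  E-var-hit : ∀ {n} D (a b : Fin n) q →
              E ((a , b) ∷ D) (var a b ⊠ q) ≈ E D q +ᴿ E D (var a b ⊠ ∂ a b q)
  E-var-hit D a b q with a ≟ a | b ≟ b
  ... | yes _  | yes _  = ℛ.trans (E-⊞ D _ _) (ℛ.+-congʳ (E-1⊠ D q))
  ... | no a≢a | _      = contradiction refl a≢a
  ... | yes _  | no b≢b = contradiction refl b≢b

  E-var-miss : ∀ {n} D (i j a b : Fin n) q → (i , j) ≢ (a , b) →
               E ((i , j) ∷ D) (var a b ⊠ q) ≈ E D (var a b ⊠ ∂ i j q)
  E-var-miss D i j a b q d≢ with i ≟ a | j ≟ b
  ... | yes refl | yes refl = contradiction refl d≢
  ... | no _     | _        = ℛ.trans (E-⊞ D _ _) (ℛ.trans (ℛ.+-congʳ (E-0⊠ D q)) (ℛ.+-identityˡ _))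
  ... | yes _    | no _     = ℛ.trans (E-⊞ D _ _) (ℛ.trans (ℛ.+-congʳ (E-0⊠ D q)) (ℛ.+-identityˡ _))

  -- By the product rule and evaluation at 0, exactly one derivative has to consume the factor
  -- `var a b`; `D′` is what remains to act on `q`.
  E-var-vanish : ∀ {n} D (a b : Fin n) q → (∀ D′ → D ↭ (a , b) ∷ D′ → E D′ q ≈ 0#) →
                 E D (var a b ⊠ q) ≈ 0#
  E-var-vanish []            a b q z = ℛ.zeroˡ _
  E-var-vanish ((i , j) ∷ D) a b q z = go (i ≟ a) (j ≟ b)
    where
    rest : E D (var a b ⊠ ∂ i j q) ≈ 0#
    rest = E-var-vanish D a b (∂ i j q) (λ D′ D↭ → z ((i , j) ∷ D′)
      (↭.trans (↭.prep (i , j) D↭) (↭.swap (i , j) (a , b) ↭.refl)))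
    go : Dec (i ≡ a) → Dec (j ≡ b) → E ((i , j) ∷ D) (var a b ⊠ q) ≈ 0#
    go (yes refl) (yes refl) = ℛ.trans (E-var-hit D i j q)
      (ℛ.trans (ℛ.+-cong (z D ↭.refl) rest) (ℛ.+-identityˡ 0#))
    go (no i≢a) _        = ℛ.trans (E-var-miss D i j a b q (λ { refl → i≢a refl })) rest
    go (yes _)  (no j≢b) = ℛ.trans (E-var-miss D i j a b q (λ { refl → j≢b refl })) rest

  -- The (a , b) entry of A^N is the generating function of the walks of
  -- length N from a to b.
  E-genericPower-vanish : ∀ {n} N (a b : Fin n) D → (∀ w → w ↭ D → ¬ Walk a w b) →
                          E D (genericPower N a b) ≈ 0#
  E-genericPower-vanish zero a b D none with a ≟ b
  ... | no _ = E-con0 D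
  E-genericPower-vanish zero a b []      none | yes a≡b = contradiction a≡b (none [] ↭.refl)
  E-genericPower-vanish zero a b (d ∷ D) none | yes a≡b = E-con0 D
  E-genericPower-vanish {n} (suc N) a b D none = ℛ.trans
    (E-∑ D (allFin n) (λ s → var a s ⊠ genericPower N s b))
    (sumᴸ-zero (allFin n) (λ s → E-var-vanish D a s _ (λ D′ D↭ →
      E-genericPower-vanish N s b D′ (λ w w↭D′ walk →
        none ((a , s) ∷ w) (↭.trans (↭.prep (a , s) w↭D′) (↭-sym D↭)) (refl , walk)))))

  E-tracePower : ∀ {n} N (D : List (Arc n)) →
                 E D (tracePower n N) ≈ sumᴿ (λ a → E D (genericPower N a a))
  E-tracePower {n} N D = ℛ.trans (E-∑ D (allFin n) _) (sumᴸ-allFin (λ a → E D (genericPower N a a)))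

  E-trace-vanish : ∀ {n} N (D : List (Arc n)) → (∀ a w → w ↭ D → ¬ Walk a w a) →
                   E D (tracePower n N) ≈ 0#
  E-trace-vanish N D none = ℛ.trans (E-tracePower N D)
    (sum-zero ℛ.+-commutativeMonoid (λ a → E-genericPower-vanish N a a D (none a)))

  -- An arc that ends where no arc starts cannot lie on a closed walk.
  E-trace-escape : ∀ {n p} {P : Fin n → Set p} N (D : List (Arc n)) {d} →
    All (P ∘ proj₁) D → d ∈ᴸ D → ¬ P (proj₂ d) → E D (tracePower n N) ≈ 0#
  E-trace-escape N D sources d∈ ¬Pt = E-trace-vanish N D (λ a w w↭D walk →
    ¬Pt (All.lookup (closed-walk-targets w walk (All-resp-↭ (↭-sym w↭D) sources))
      (∈-resp-↭ (↭-sym w↭D) d∈)))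

  -- A closed walk would have to use an arc at `i` and an arc starting elsewhere, but from `i` there
  -- is no way out.
  E-trace-trap : ∀ {n} N (D : List (Arc n)) {i : Fin n} {d d′} →
    All (λ d → proj₁ d ≡ i → proj₂ d ≡ i) D → d ∈ᴸ D → proj₁ d ≡ i → d′ ∈ᴸ D → proj₁ d′ ≢ i →
    E D (tracePower n N) ≈ 0#
  E-trace-trap {n} N D {i} {d} {d′} stays d∈ d≡i d′∈ d′≢i = E-trace-vanish N D λ a w w↭D walk →
    go w w↭D walk (a ≟ i)
    where
    go : ∀ {a} w → w ↭ D → Walk a w a → ¬ Dec (a ≡ i)
    go w w↭D walk (yes refl) = d′≢i (All.lookup
      (proj₁ (trapped w walk (All-resp-↭ (↭-sym w↭D) stays))) (∈-resp-↭ (↭-sym w↭D) d′∈))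
    go w w↭D walk (no a≢i) = All.lookup
      (untrapped w walk a≢i (All-resp-↭ (↭-sym w↭D) stays)) (∈-resp-↭ (↭-sym w↭D) d∈) d≡i

  -- Any one of the `suc M` equal derivatives may consume the factor, and the other `M` then act on
  -- `q`.
  E-loops-var : ∀ {n} (i : Fin n) M q →
    E (List.replicate (suc M) (i , i)) (var i i ⊠ q) ≈ fromℕᴿ (suc M) *ᴿ E (List.replicate M (i , i)) q
  E-loops-var i zero q = begin
    E ((i , i) ∷ []) (var i i ⊠ q)                           ≈⟨ E-var-hit [] i i q ⟩
    E [] q +ᴿ 0# *ᴿ constantTerm (∂ i i q)                   ≈⟨ ℛ.+-congˡ (ℛ.zeroˡ _) ⟩
    E [] q +ᴿ 0#                                             ≈⟨ ℛ.+-identityʳ _ ⟩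
    E [] q                                                   ≈⟨ ℛ.*-identityˡ _ ⟨
    1# *ᴿ E [] q                                             ≈⟨ ℛ.*-congʳ (ℛ.+-identityʳ 1#) ⟨
    fromℕᴿ 1 *ᴿ E [] q                                        ∎
  E-loops-var i (suc M) q = begin
    E (List.replicate (suc (suc M)) (i , i)) (var i i ⊠ q)
      ≈⟨ E-var-hit (List.replicate (suc M) (i , i)) i i q ⟩
    x +ᴿ E (List.replicate (suc M) (i , i)) (var i i ⊠ ∂ i i q)
      ≈⟨ ℛ.+-cong (ℛ.sym (ℛ.*-identityˡ x)) (E-loops-var i M (∂ i i q)) ⟩
    1# *ᴿ x +ᴿ fromℕᴿ (suc M) *ᴿ x
      ≈⟨ ℛ.distribʳ x 1# (fromℕᴿ (suc M)) ⟨
    fromℕᴿ (suc (suc M)) *ᴿ x ∎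
    where x = E (List.replicate (suc M) (i , i)) q

  loops-sources : ∀ {n} (i : Fin n) N → All (λ d → proj₁ d ≡ i) (List.replicate N (i , i))
  loops-sources i zero    = []
  loops-sources i (suc N) = refl ∷ loops-sources i N

  -- Only the repeated loop contributes; it is the monomial `a_ii^N`, whose derivative of order `N`
  -- is the factorial that `recip!` later cancels.
  E-loops-power : ∀ {n} (i : Fin n) N → E (List.replicate N (i , i)) (genericPower N i i) ≈ fromℕᴿ (N !)
  E-loops-power i zero with i ≟ i
  ... | yes _  = ℛ.sym (ℛ.+-identityʳ 1#)
  ... | no i≢i = contradiction refl i≢i
  E-loops-power {n} i (suc N) = begin
    E D (genericPower (suc N) i i)
      ≈⟨ E-∑ D (allFin n) _ ⟩
    sumᴸ (allFin n) (λ s → E D (var i s ⊠ genericPower N s i))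
      ≈⟨ sumᴸ-allFin (λ s → E D (var i s ⊠ genericPower N s i)) ⟩
    sumᴿ (λ s → E D (var i s ⊠ genericPower N s i))
      ≈⟨ sum-single ℛ.+-commutativeMonoid _ i (λ s i≢s → E-var-vanish D i s _ (λ D′ D↭ →
           contradiction (∈-resp-↭ (↭-sym D↭) (here refl)) (no-arc (suc N) i≢s))) ⟩
    E D (var i i ⊠ genericPower N i i)
      ≈⟨ E-loops-var i N _ ⟩
    fromℕᴿ (suc N) *ᴿ E (List.replicate N (i , i)) (genericPower N i i)
      ≈⟨ ℛ.*-congˡ (E-loops-power i N) ⟩
    fromℕᴿ (suc N) *ᴿ fromℕᴿ (N !)
      ≈⟨ ℛMult.×1-homo-* (suc N) (N !) ⟨
    fromℕᴿ (suc N !) ∎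
    where
    D = List.replicate (suc N) (i , i)
    no-arc : ∀ M {s} → i ≢ s → ¬ (i , s) ∈ᴸ List.replicate M (i , i)
    no-arc (suc M) i≢s (here refl) = i≢s refl
    no-arc (suc M) i≢s (there ∈)   = no-arc M i≢s ∈

  E-loops-trace : ∀ {n} (i : Fin n) N → E (List.replicate (suc N) (i , i)) (tracePower n (suc N)) ≈ fromℕᴿ (suc N !)
  E-loops-trace i N = ℛ.trans (E-tracePower (suc N) D)
    (ℛ.trans (sum-single ℛ.+-commutativeMonoid (λ a → E D (genericPower (suc N) a a)) i
        (λ a i≢a → E-genericPower-vanish (suc N) a a D (none i≢a)))
      (E-loops-power i (suc N)))
    where
    D = List.replicate (suc N) (i , i)
    none : ∀ {a} → i ≢ a → ∀ w → w ↭ D → ¬ Walk a w a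
    none i≢a []      []↭ _ with () ← ∈-resp-↭ (↭-sym []↭) (here refl)
    none i≢a (_ ∷ w) w↭  (s≡a , _) with s≡i ∷ _ ← All-resp-↭ (↭-sym w↭) (loops-sources i (suc N)) =
      i≢a (trans (sym s≡i) s≡a)

  -- Two closed walks use these arcs, one starting at `i` and one at `j`, and each contributes 1.
  E-edge-trace : ∀ {n} (i j : Fin n) → i ≢ j → E ((i , j) ∷ (j , i) ∷ []) (tracePower n 2) ≈ fromℕᴿ 2
  E-edge-trace {n} i j i≢j = begin
    E D (tracePower n 2)
      ≈⟨ E-tracePower 2 D ⟩
    sumᴿ (λ a → E D (genericPower 2 a a))
      ≈⟨ Σᴿ.sum-cong-≋ pointwise ⟩
    sumᴿ (λ a → δ i a +ᴿ δ j a)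
      ≈⟨ Σᴿ.∑-distrib-+ (δ i) (δ j) ⟩
    sumᴿ (δ i) +ᴿ sumᴿ (δ j)
      ≈⟨ ℛ.+-cong (sum-δᴿ i) (sum-δᴿ j) ⟩
    1# +ᴿ 1#
      ≈⟨ ℛ.+-congˡ (ℛ.+-identityʳ 1#) ⟨
    fromℕᴿ 2 ∎
    where
    D = (i , j) ∷ (j , i) ∷ []
    δ : Fin n → Fin n → Carrier
    δ i a = if does (i ≟ a) then 1# else 0#
    δ-refl : ∀ i → δ i i ≈ 1#
    δ-refl i with i ≟ i
    ... | yes _  = ℛ.refl
    ... | no i≢i = contradiction refl i≢i
    δ-off : ∀ {i a} → i ≢ a → δ i a ≈ 0#
    δ-off {i} {a} i≢a with i ≟ a
    ... | yes i≡a = contradiction i≡a i≢a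
    ... | no _    = ℛ.refl
    sum-δᴿ : ∀ i → sumᴿ (δ i) ≈ 1#
    sum-δᴿ i = ℛ.trans (sum-single ℛ.+-commutativeMonoid (δ i) i (λ a → δ-off)) (δ-refl i)

    only : ∀ D a s (q : Fin n → Poly n) → (∀ b → s ≢ b → ¬ (a , b) ∈ᴸ D) →
      E D (∑ (allFin n) (λ b → var a b ⊠ q b)) ≈ E D (var a s ⊠ q s)
    only D a s q none = ℛ.trans (E-∑ D (allFin n) _) (ℛ.trans (sumᴸ-allFin (λ b → E D (var a b ⊠ q b)))
      (sum-single ℛ.+-commutativeMonoid _ s (λ b s≢b → E-var-vanish D a b (q b) (λ D′ D↭ →
        contradiction (∈-resp-↭ (↭-sym D↭) (here refl)) (none b s≢b)))))

    step₁ : ∀ a b → E ((a , b) ∷ []) (genericPower 1 a b) ≈ 1#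
    step₁ a b = begin
      E ((a , b) ∷ []) (genericPower 1 a b)
        ≈⟨ only ((a , b) ∷ []) a b (λ t → genericPower 0 t b) (λ { t b≢t (here refl) → b≢t refl }) ⟩
      E ((a , b) ∷ []) (var a b ⊠ genericPower 0 b b)
        ≈⟨ E-var-hit [] a b (genericPower 0 b b) ⟩
      constantTerm (genericPower 0 b b) +ᴿ 0# *ᴿ _
        ≈⟨ ℛ.+-cong (E-loops-power b 0) (ℛ.zeroˡ _) ⟩
      fromℕᴿ 1 +ᴿ 0#
        ≈⟨ ℛ.+-identityʳ _ ⟩
      fromℕᴿ 1
        ≈⟨ ℛ.+-identityʳ 1# ⟩
      1# ∎

    at-i : E D (genericPower 2 i i) ≈ 1#
    at-i = begin
      E D (genericPower 2 i i)
        ≈⟨ only D i j (λ s → genericPower 1 s i)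
             (λ { b j≢b (here refl) → j≢b refl ; b j≢b (there (here refl)) → i≢j refl }) ⟩
      E D (var i j ⊠ genericPower 1 j i)
        ≈⟨ E-var-hit ((j , i) ∷ []) i j (genericPower 1 j i) ⟩
      E ((j , i) ∷ []) (genericPower 1 j i) +ᴿ E ((j , i) ∷ []) (var i j ⊠ ∂ i j (genericPower 1 j i))
        ≈⟨ ℛ.+-cong (step₁ j i) (E-var-vanish ((j , i) ∷ []) i j (∂ i j (genericPower 1 j i)) (λ D′ D↭ →
             contradiction (∈-resp-↭ (↭-sym D↭) (here refl)) (λ { (here refl) → i≢j refl }))) ⟩
      1# +ᴿ 0#
        ≈⟨ ℛ.+-identityʳ 1# ⟩
      1# ∎

    at-j : E D (genericPower 2 j j) ≈ 1#
    at-j = begin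
      E D (genericPower 2 j j)
        ≈⟨ only D j i (λ s → genericPower 1 s j)
             (λ { b i≢b (here refl) → i≢j refl ; b i≢b (there (here refl)) → i≢b refl }) ⟩
      E D (var j i ⊠ genericPower 1 i j)
        ≈⟨ E-var-miss ((j , i) ∷ []) i j j i (genericPower 1 i j) (λ { refl → i≢j refl }) ⟩
      E ((j , i) ∷ []) (var j i ⊠ ∂ i j (genericPower 1 i j))
        ≈⟨ E-var-hit [] j i (∂ i j (genericPower 1 i j)) ⟩
      E ((i , j) ∷ []) (genericPower 1 i j) +ᴿ 0# *ᴿ _
        ≈⟨ ℛ.+-cong (step₁ i j) (ℛ.zeroˡ _) ⟩
      1# +ᴿ 0#
        ≈⟨ ℛ.+-identityʳ 1# ⟩
      1# ∎

    pointwise : ∀ a → E D (genericPower 2 a a) ≈ δ i a +ᴿ δ j a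
    pointwise a = go (i ≟ a) (j ≟ a)
      where
      go : Dec (i ≡ a) → Dec (j ≡ a) → E D (genericPower 2 a a) ≈ δ i a +ᴿ δ j a
      go (yes refl) _ = ℛ.trans at-i (ℛ.sym (ℛ.trans
        (ℛ.+-cong (δ-refl i) (δ-off (i≢j ∘ sym))) (ℛ.+-identityʳ 1#)))
      go (no i≢a) (yes refl) = ℛ.trans at-j (ℛ.sym (ℛ.trans
        (ℛ.+-cong (δ-off i≢j) (δ-refl j)) (ℛ.+-identityˡ 1#)))
      go (no i≢a) (no j≢a) = ℛ.trans
        (E-genericPower-vanish 2 a a D λ { w w↭D walk → starts w w↭D walk })
        (ℛ.sym (ℛ.trans (ℛ.+-cong (δ-off i≢a) (δ-off j≢a)) (ℛ.+-identityʳ 0#)))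
        where
        starts : ∀ w → w ↭ D → ¬ Walk a w a
        starts [] []↭ _ with () ← ∈-resp-↭ (↭-sym []↭) (here refl)
        starts (_ ∷ w) w↭ (refl , _) with ∈-resp-↭ w↭ (here refl)
        ... | here refl         = i≢a refl
        ... | there (here refl) = j≢a refl

  pairSumᴿ : ∀ {n} → (Fin n → Fin n → Carrier) → Carrier
  pairSumᴿ = pairSum ℛ.+-commutativeMonoid

  recip!-inverse : ∀ n → recip! n *ᴿ fromℕᴿ (n !) ≈ 1#
  recip!-inverse n = ℛ.trans (ℛ.*-congˡ (ℛ.sym x-0≈x)) (proj₁ (proj₂
    (HeytingField.#⇒invertible heytingField
      (HeytingField.#-sym heytingField (<⇒# (0<fromℕ (n !) (ℕ.1≤n! n)))))))
    where
    x-0≈x : fromℕᴿ (n !) -ᴿ 0# ≈ fromℕᴿ (n !)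
    x-0≈x = ℛ.trans (ℛ.+-congˡ (RingProperties.-0#≈0# ℛ.ring)) (ℛ.+-identityʳ _)

  recip!1≈1 : recip! 1 ≈ 1#
  recip!1≈1 = ℛ.trans (ℛ.sym (ℛ.*-identityʳ _))
    (ℛ.trans (ℛ.*-congˡ (ℛ.sym (ℛ.+-identityʳ 1#))) (recip!-inverse 1))

  recip!0≈1 : recip! 0 ≈ 1#
  recip!0≈1 = ℛ.trans (ℛ.sym (ℛ.*-identityʳ _))
    (ℛ.trans (ℛ.*-congˡ (ℛ.sym (ℛ.+-identityʳ 1#))) (recip!-inverse 0))

  -- The sum over weak compositions, with the parts a priori bounded by b.
  weakSum : ℕ → ∀ n → ℕ → (Vec ℕ n → Carrier) → Carrier
  weakSum b n d G =
    sumᴸ (vectors (upTo b) n) (λ ds → if does (Vec.sum ds ℕ.≟ d) then G ds else 0#)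

  sumᴸ-applyUpTo-zero : ∀ b (h : ℕ → ℕ) {F : ℕ → Carrier} → (∀ c → F (h c) ≈ 0#) → sumᴸ (applyUpTo h b) F ≈ 0#
  sumᴸ-applyUpTo-zero zero    h z = ℛ.refl
  sumᴸ-applyUpTo-zero (suc b) h z = ℛ.trans
    (ℛ.+-cong (z 0) (sumᴸ-applyUpTo-zero b (h ∘ suc) (z ∘ suc))) (ℛ.+-identityˡ 0#)

  weakSum-0 : ∀ b n G → weakSum (suc b) n 0 G ≈ G (replicate n 0)
  weakSum-0 b zero    G = ℛ.+-identityʳ _
  weakSum-0 b (suc n) G = begin
    weakSum (suc b) (suc n) 0 G
      ≈⟨ sumᴸ-cartesian _∷_ (upTo (suc b)) (vectors (upTo (suc b)) n) _ ⟩
    weakSum (suc b) n 0 (λ ds → G (0 ∷ ds)) +ᴿ sumᴸ (applyUpTo suc b) _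
      ≈⟨ ℛ.+-cong (weakSum-0 b n (λ ds → G (0 ∷ ds)))
           (sumᴸ-applyUpTo-zero b suc (λ c → sumᴸ-zero (vectors (upTo (suc b)) n) (λ ds → ℛ.refl))) ⟩
    G (0 ∷ replicate n 0) +ᴿ 0#
      ≈⟨ ℛ.+-identityʳ _ ⟩
    G (0 ∷ replicate n 0) ∎

  weakSum-1 : ∀ b n G → weakSum (2 + b) n 1 G ≈ sumᴿ (λ i → G (units i))
  weakSum-1 b zero    G = ℛ.+-identityʳ _
  weakSum-1 b (suc n) G = begin
    weakSum (2 + b) (suc n) 1 G
      ≈⟨ sumᴸ-cartesian _∷_ (upTo (2 + b)) (vectors (upTo (2 + b)) n) _ ⟩
    weakSum (2 + b) n 1 (λ ds → G (0 ∷ ds)) +ᴿ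
      (weakSum (2 + b) n 0 (λ ds → G (1 ∷ ds)) +ᴿ sumᴸ (applyUpTo (2 +_) b) _)
      ≈⟨ ℛ.+-cong (weakSum-1 b n (λ ds → G (0 ∷ ds)))
           (ℛ.+-cong (weakSum-0 (suc b) n (λ ds → G (1 ∷ ds)))
           (sumᴸ-applyUpTo-zero b (2 +_) (λ c → sumᴸ-zero (vectors (upTo (2 + b)) n) (λ ds → ℛ.refl)))) ⟩
    sumᴿ (λ i → G (units (suc i))) +ᴿ (G (units zero) +ᴿ 0#)
      ≈⟨ ℛ.+-comm _ _ ⟩
    (G (units zero) +ᴿ 0#) +ᴿ sumᴿ (λ i → G (units (suc i)))
      ≈⟨ ℛ.+-congʳ (ℛ.+-identityʳ _) ⟩
    sumᴿ (λ i → G (units i)) ∎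

  -- A total of 2 comes from one part equal to 2 or from two parts equal to 1; the bound 3 admits
  -- the parts 0, 1 and 2.
  weakSum-2 : ∀ n G → weakSum 3 n 2 G ≈
    sumᴿ (λ i → G (units₂ i i)) +ᴿ pairSumᴿ (λ i j → G (units₂ i j))
  weakSum-2 zero    G = ℛ.refl
  weakSum-2 (suc n) G = begin
    weakSum 3 (suc n) 2 G
      ≈⟨ sumᴸ-cartesian _∷_ (upTo 3) (vectors (upTo 3) n) _ ⟩
    weakSum 3 n 2 (λ ds → G (0 ∷ ds)) +ᴿ (weakSum 3 n 1 (λ ds → G (1 ∷ ds)) +ᴿ
      (weakSum 3 n 0 (λ ds → G (2 ∷ ds)) +ᴿ 0#))
      ≈⟨ ℛ.+-cong (weakSum-2 n (λ ds → G (0 ∷ ds))) (ℛ.+-cong (weakSum-1 1 n (λ ds → G (1 ∷ ds)))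
           (ℛ.+-congʳ (weakSum-0 2 n (λ ds → G (2 ∷ ds))))) ⟩
    (squares +ᴿ pairs) +ᴿ (cross +ᴿ (square₀ +ᴿ 0#))
      ≈⟨ S.solve 4 (λ a b c d → ((a S.⊕ b) S.⊕ (c S.⊕ (d S.⊕ S.id))) S.⊜ ((d S.⊕ a) S.⊕ (c S.⊕ b)))
           ℛ.refl squares pairs cross square₀ ⟩
    (square₀ +ᴿ squares) +ᴿ (cross +ᴿ pairs) ∎
    where
    module S = CommutativeMonoidSolver ℛ.+-commutativeMonoid
    squares = sumᴿ (λ i → G (units₂ (suc i) (suc i)))
    pairs = pairSumᴿ (λ i j → G (units₂ (suc i) (suc j)))
    cross = sumᴿ (λ j → G (units₂ zero (suc j)))
    square₀ = G (units₂ zero zero)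

  weakCompositions-sum : ∀ n d G → sumᴸ (weakCompositions n d) G ≈ weakSum (suc d) n d G
  weakCompositions-sum n d G = sumᴸ-filter (λ ds → Vec.sum ds ℕ.≟ d) (vectors (upTo (suc d)) n) G

  E-∂ᵞ : ∀ {n r} D i (γ : Vec (Fin n) r) p → E D (∂ᵞ i γ p) ≡ E (arcs i γ D) p
  E-∂ᵞ D i []      p = refl
  E-∂ᵞ D i (j ∷ γ) p = E-∂ᵞ ((i , j) ∷ D) i γ p

  -- The first two traces of a tensor

  module _ {n r} (T : Fin n → Vec (Fin n) r → Carrier) where
    private
      row : Fin n → Poly n → Poly n
      row = rowOperator {suc r} T

      γs : List (Vec (Fin n) r)
      γs = vectors (allFin n) r

    E-row : ∀ D i p → E D (row i p) ≈ sumᴸ γs (λ γ → T i γ *ᴿ E (arcs i γ D) p)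
    E-row D i p = ℛ.trans (E-∑ D γs _) (sumᴸ-cong γs (λ γ →
      ℛ.trans (E-con⊠ D (T i γ) (∂ᵞ i γ p)) (ℛ.*-congˡ (ℛ.reflexive (E-∂ᵞ D i γ p)))))

    E-row-cong : ∀ i {p q} → p ≋ q → row i p ≋ row i q
    E-row-cong i {p} {q} p≋q D = ℛ.trans (E-row D i p) (ℛ.trans
      (sumᴸ-cong γs (λ γ → ℛ.*-congˡ (p≋q (arcs i γ D)))) (ℛ.sym (E-row D i q)))

    -- The product operator by recursion on the exponents instead of a fold over indices, so that
    -- zero exponents can be peeled off one at a time; `f` remembers the original indices.
    productAlong : ∀ {m} → (Fin m → Fin n) → Vec ℕ m → Poly n → Poly n
    productAlong f []       p = p
    productAlong f (e ∷ es) p =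
      con (recip! (e * r)) ⊠ fold (productAlong (f ∘ suc) es p) (row (f zero)) e

    productOperator≡ : ∀ ds p → productOperator {suc r} T ds p ≡ productAlong id ds p
    productOperator≡ ds p = go id ds (λ i → refl)
      where
      go : ∀ {m} (f : Fin m → Fin n) es → (∀ i → lookup ds (f i) ≡ lookup es i) →
        foldr (λ i q → con (recip! (lookup ds i * r)) ⊠ fold q (row i) (lookup ds i)) p (List.tabulate f)
          ≡ productAlong f es p
      go f []       eq = refl
      go f (e ∷ es) eq = cong₂ (λ x q → con (recip! (x * r)) ⊠ fold q (row (f zero)) x)
        (eq zero) (go (f ∘ suc) es (eq ∘ suc))

    E-trivial-factor : ∀ (D : List (Arc n)) p → E D (con (recip! 0) ⊠ p) ≈ E D p
    E-trivial-factor D p = ℛ.trans (E-con⊠ D _ p) (ℛ.trans (ℛ.*-congʳ recip!0≈1) (ℛ.*-identityˡ _))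

    productAlong-0 : ∀ {m} (f : Fin m → Fin n) p → productAlong f (replicate m 0) p ≋ p
    productAlong-0 {zero}  f p D = ℛ.refl
    productAlong-0 {suc m} f p D = ℛ.trans (E-trivial-factor D (productAlong (f ∘ suc) (replicate m 0) p)) (productAlong-0 (f ∘ suc) p D)

    productAlong-1 : ∀ {m} (f : Fin m → Fin n) p i →
      productAlong f (units i) p ≋ con (recip! (1 * r)) ⊠ row (f i) p
    productAlong-1 f p zero D = ℛ.trans (E-con⊠ D _ _) (ℛ.trans
      (ℛ.*-congˡ (E-row-cong (f zero) (productAlong-0 (f ∘ suc) p) D))
      (ℛ.sym (E-con⊠ D _ _)))
    productAlong-1 f p (suc i) D = 
      ℛ.trans (E-trivial-factor D (productAlong (f ∘ suc) (units i) p)) (productAlong-1 (f ∘ suc) p i D)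

    productAlong-square : ∀ {m} (f : Fin m → Fin n) p i →
      productAlong f (units₂ i i) p ≋ con (recip! (2 * r)) ⊠ row (f i) (row (f i) p)
    productAlong-square f p zero D = ℛ.trans (E-con⊠ D _ _) (ℛ.trans
      (ℛ.*-congˡ (E-row-cong (f zero) (E-row-cong (f zero) (productAlong-0 (f ∘ suc) p)) D))
      (ℛ.sym (E-con⊠ D _ _)))
    productAlong-square f p (suc i) D =
      ℛ.trans (E-trivial-factor D (productAlong (f ∘ suc) (units₂ i i) p)) (productAlong-square (f ∘ suc) p i D)

    productAlong-2 : ∀ {m} (f : Fin m → Fin n) p i j → toℕ i < toℕ j → productAlong f (units₂ i j) p ≋
      con (recip! (1 * r)) ⊠ row (f i) (con (recip! (1 * r)) ⊠ row (f j) p)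
    productAlong-2 f p zero (suc j) _ D = ℛ.trans (E-con⊠ D _ _) (ℛ.trans
      (ℛ.*-congˡ (E-row-cong (f zero) (productAlong-1 (f ∘ suc) p j) D))
      (ℛ.sym (E-con⊠ D _ _)))
    productAlong-2 f p (suc i) (suc j) (s≤s i<j) D =
      ℛ.trans (E-trivial-factor D (productAlong (f ∘ suc) (units₂ i j) p)) (productAlong-2 (f ∘ suc) p i j i<j D)

    weakSum-productOperator : ∀ d p →
      constantTerm (∑ (weakCompositions n d) (λ ds → productOperator {suc r} T ds p)) ≈
      weakSum (suc d) n d (λ ds → E [] (productAlong id ds p))
    weakSum-productOperator d p = begin
      E [] (∑ (weakCompositions n d) (λ ds → productOperator {suc r} T ds p))
        ≈⟨ E-∑ [] (weakCompositions n d) _ ⟩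
      sumᴸ (weakCompositions n d) (λ ds → E [] (productOperator {suc r} T ds p))
        ≈⟨ sumᴸ-cong (weakCompositions n d) (λ ds → ℛ.reflexive (cong (E []) (productOperator≡ ds p))) ⟩
      sumᴸ (weakCompositions n d) (λ ds → E [] (productAlong id ds p))
        ≈⟨ weakCompositions-sum n d _ ⟩
      weakSum (suc d) n d (λ ds → E [] (productAlong id ds p)) ∎

    -- All arcs start at `i`, so an entry `x ≢ i` of `γ` gives an arc from which no walk continues;
    -- only the diagonal entry of `T` survives.
    row-single : ∀ i N D → All (λ d → proj₁ d ≡ i) D →
      sumᴸ γs (λ γ → T i γ *ᴿ E (arcs i γ D) (tracePower n N)) ≈
      T i (replicate r i) *ᴿ E (arcs i (replicate r i) D) (tracePower n N)
    row-single i N D sources = sumᴸ-vectors-single r _ (replicate r i) λ γ rep≢γ →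
      let x , x∈γ , x≢i = ≢replicate⇒∃≢ γ (rep≢γ ∘ sym) in
      ℛ.trans (ℛ.*-congˡ (E-trace-escape {P = _≡ i} N (arcs i γ D)
        (arcs-All γ (always γ (λ _ → refl)) sources) (∈-arcsˡ x∈γ) x≢i)) (ℛ.zeroʳ _)

  module _ {n r′} (T : Fin n → Vec (Fin n) (suc r′) → Carrier) where
    private
      r = suc r′

      row : Fin n → Poly n → Poly n
      row = rowOperator {suc r} T

      γs : List (Vec (Fin n) r)
      γs = vectors (allFin n) r

      diagonal : Fin n → Carrier
      diagonal i = T i (replicate r i)

    Tr-1 : Tr {suc r} 1 T ≈ fromℕᴿ (r ^ (n ∸ 1)) *ᴿ sumᴿ diagonal
    Tr-1 = ℛ.*-congˡ (ℛ.trans (weakSum-productOperator T 1 p)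
      (ℛ.trans (weakSum-1 0 n _) (Σᴿ.sum-cong-≋ term)))
      where
      p = tracePower n (1 * r)
      term : ∀ i → E [] (productAlong T id (units i) p) ≈ diagonal i
      term i = begin
        E [] (productAlong T id (units i) p)
          ≈⟨ productAlong-1 T id p i [] ⟩
        recip! (1 * r) *ᴿ E [] (row i p)
          ≈⟨ ℛ.*-congˡ (ℛ.trans (E-row T [] i p) (row-single T i (1 * r) [] [])) ⟩
        recip! (1 * r) *ᴿ (diagonal i *ᴿ E (arcs i (replicate r i) []) p)
          ≈⟨ ℛ.*-congˡ (ℛ.*-congˡ (ℛ.trans (ℛ.reflexive (cong (λ D → E D p) (arcs-replicate i r 0)))
               -- `1 * r` computes to `suc (r′ + 0)`.
               (E-loops-trace i (r′ + 0)))) ⟩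
        recip! (1 * r) *ᴿ (diagonal i *ᴿ fromℕᴿ ((1 * r) !))
          ≈⟨ ℛ.*-congˡ (ℛ.*-comm _ _) ⟩
        recip! (1 * r) *ᴿ (fromℕᴿ ((1 * r) !) *ᴿ diagonal i)
          ≈⟨ ℛ.*-assoc _ _ _ ⟨
        (recip! (1 * r) *ᴿ fromℕᴿ ((1 * r) !)) *ᴿ diagonal i
          ≈⟨ ℛ.*-congʳ (recip!-inverse (1 * r)) ⟩
        1# *ᴿ diagonal i
          ≈⟨ ℛ.*-identityˡ _ ⟩
        diagonal i ∎

    -- The summand of the second trace for the composition with parts 1 at `i` and at `j`, where the
    -- two rows are different.
    mixed : Fin n → Fin n → Carrier
    mixed i j = recip! (1 * r) *ᴿ sumᴸ γs (λ γ → T i γ *ᴿ (recip! (1 * r) *ᴿ sumᴸ γs (λ δ →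
      T j δ *ᴿ E (arcs j δ (arcs i γ [])) (tracePower n (2 * r)))))

    Tr-2 : Tr {suc r} 2 T ≈
      fromℕᴿ (r ^ (n ∸ 1)) *ᴿ (sumᴿ (λ i → diagonal i *ᴿ diagonal i) +ᴿ pairSumᴿ mixed)
    Tr-2 = ℛ.*-congˡ (ℛ.trans (weakSum-productOperator T 2 p) (ℛ.trans (weakSum-2 n _)
      (ℛ.+-cong (Σᴿ.sum-cong-≋ term) (pairSum-cong ℛ.+-commutativeMonoid term₂))))
      where
      p = tracePower n (2 * r)

      term₂ : ∀ i j → toℕ i < toℕ j → E [] (productAlong T id (units₂ i j) p) ≈ mixed i j
      term₂ i j i<j = ℛ.trans (productAlong-2 T id p i j i<j [])
        (ℛ.*-congˡ (ℛ.trans (E-row T [] i _) (sumᴸ-cong γs (λ γ → ℛ.*-congˡ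
          (ℛ.trans (E-con⊠ (arcs i γ []) (recip! (1 * r)) (row j p))
            (ℛ.*-congˡ (E-row T (arcs i γ []) j p)))))))

      term : ∀ i → E [] (productAlong T id (units₂ i i) p) ≈ diagonal i *ᴿ diagonal i
      term i = begin
        E [] (productAlong T id (units₂ i i) p)
          ≈⟨ productAlong-square T id p i [] ⟩
        recip! (2 * r) *ᴿ E [] (row i (row i p))
          ≈⟨ ℛ.*-congˡ (E-row T [] i (row i p)) ⟩
        recip! (2 * r) *ᴿ sumᴸ γs (λ γ → T i γ *ᴿ E (arcs i γ []) (row i p))
          ≈⟨ ℛ.*-congˡ (sumᴸ-vectors-single r _ (replicate r i) off) ⟩
        recip! (2 * r) *ᴿ (diagonal i *ᴿ E (arcs i (replicate r i) []) (row i p))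
          ≈⟨ ℛ.*-congˡ (ℛ.*-congˡ (inner (replicate r i))) ⟩
        recip! (2 * r) *ᴿ (diagonal i *ᴿ (diagonal i *ᴿ E (arcs i (replicate r i) (arcs i (replicate r i) [])) p))
          ≈⟨ ℛ.*-congˡ (ℛ.*-congˡ (ℛ.*-congˡ (ℛ.trans (ℛ.reflexive (cong (λ D → E D p) loops))
               (E-loops-trace i (r′ + (r + 0)))))) ⟩
        recip! (2 * r) *ᴿ (diagonal i *ᴿ (diagonal i *ᴿ fromℕᴿ ((2 * r) !)))
          ≈⟨ ℛ.*-congˡ (ℛ.*-assoc _ _ _) ⟨
        recip! (2 * r) *ᴿ ((diagonal i *ᴿ diagonal i) *ᴿ fromℕᴿ ((2 * r) !))
          ≈⟨ ℛ.*-congˡ (ℛ.*-comm _ _) ⟩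
        recip! (2 * r) *ᴿ (fromℕᴿ ((2 * r) !) *ᴿ (diagonal i *ᴿ diagonal i))
          ≈⟨ ℛ.*-assoc _ _ _ ⟨
        (recip! (2 * r) *ᴿ fromℕᴿ ((2 * r) !)) *ᴿ (diagonal i *ᴿ diagonal i)
          ≈⟨ ℛ.*-congʳ (recip!-inverse (2 * r)) ⟩
        1# *ᴿ (diagonal i *ᴿ diagonal i)
          ≈⟨ ℛ.*-identityˡ _ ⟩
        diagonal i *ᴿ diagonal i ∎
        where
        inner : ∀ γ → E (arcs i γ []) (row i p) ≈ diagonal i *ᴿ E (arcs i (replicate r i) (arcs i γ [])) p
        inner γ = ℛ.trans (E-row T (arcs i γ []) i p)
          (row-single T i (2 * r) (arcs i γ []) (arcs-All γ (always γ (λ _ → refl)) []))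

        off : ∀ γ → replicate r i ≢ γ → T i γ *ᴿ E (arcs i γ []) (row i p) ≈ 0#
        off γ rep≢γ = let x , x∈γ , x≢i = ≢replicate⇒∃≢ γ (rep≢γ ∘ sym) in
          ℛ.trans (ℛ.*-congˡ (ℛ.trans (inner γ) (ℛ.trans (ℛ.*-congˡ
            (E-trace-escape {P = _≡ i} (2 * r) (arcs i (replicate r i) (arcs i γ []))
              (arcs-All (replicate r i) (always _ (λ _ → refl)) (arcs-All γ (always γ (λ _ → refl)) []))
              (∈-arcsʳ (replicate r i) (∈-arcsˡ x∈γ)) x≢i)) (ℛ.zeroʳ _)))) (ℛ.zeroʳ _)

        loops : arcs i (replicate r i) (arcs i (replicate r i) []) ≡ List.replicate (2 * r) (i , i)
        loops = trans (cong (arcs i (replicate r i)) (arcs-replicate i r 0)) (arcs-replicate i r (r + 0))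

  -- Entries of the hypergraph tensor and its second trace

  support⊆ : ∀ {n r} {p : Subset n} (γ : Vec (Fin n) r) → Allⱽ (_∈ p) γ → support γ ⊆ p
  support⊆ []      []         x∈ = contradiction x∈ ∉⊥
  support⊆ (i ∷ γ) (i∈p ∷ γ∈p) x∈ with x∈p∪q⁻ ⁅ i ⁆ (support γ) x∈
  ... | inj₁ x∈⁅i⁆ = subst (_∈ _) (sym (x∈⁅y⁆⇒x≡y i x∈⁅i⁆)) i∈p
  ... | inj₂ x∈γ   = support⊆ γ γ∈p x∈γ

  inside⊎outside : ∀ {n r} (p : Subset n) (γ : Vec (Fin n) r) →
                   Allⱽ (_∈ p) γ ⊎ ∃[ x ] x ∈ⱽ γ × x ∉ p
  inside⊎outside p []      = inj₁ []
  inside⊎outside p (x ∷ γ) with x ∈? p | inside⊎outside p γ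
  ... | no x∉p  | _                      = inj₂ (x , here refl , x∉p)
  ... | yes _   | inj₂ (y , y∈γ , y∉p)   = inj₂ (y , there y∈γ , y∉p)
  ... | yes x∈p | inj₁ all               = inj₁ (x∈p ∷ all)

  ∈support₂ : ∀ {n} (i j : Fin n) {x} → x ∈ support (i ∷ j ∷ []) → x ≡ i ⊎ x ≡ j
  ∈support₂ i j x∈ with x∈p∪q⁻ ⁅ i ⁆ _ x∈
  ... | inj₁ x∈i = inj₁ (x∈⁅y⁆⇒x≡y i x∈i)
  ... | inj₂ x∈′ with x∈p∪q⁻ ⁅ j ⁆ _ x∈′
  ...   | inj₁ x∈j = inj₂ (x∈⁅y⁆⇒x≡y j x∈j)
  ...   | inj₂ x∈⊥ = contradiction x∈⊥ ∉⊥

  i∈support₂ : ∀ {n} (i j : Fin n) → i ∈ support (i ∷ j ∷ [])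
  i∈support₂ i j = x∈p∪q⁺ (inj₁ (x∈⁅x⁆ i))

  j∈support₂ : ∀ {n} (i j : Fin n) → j ∈ support (i ∷ j ∷ [])
  j∈support₂ i j = x∈p∪q⁺ (inj₂ (x∈p∪q⁺ (inj₁ (x∈⁅x⁆ j))))

  support₂-comm : ∀ {n} (i j : Fin n) → support (i ∷ j ∷ []) ≡ support (j ∷ i ∷ [])
  support₂-comm i j = ⊆-antisym
    (support⊆ (i ∷ j ∷ []) (j∈support₂ j i ∷ i∈support₂ j i ∷ []))
    (support⊆ (j ∷ i ∷ []) (j∈support₂ i j ∷ i∈support₂ i j ∷ []))

  -- For a 2-uniform hypergraph this is the adjacency matrix of the graph.
  adjacent : (H : Hypergraph) → Fin (order H) → Fin (order H) → ℕ
  adjacent H i j = ind (isEdge? H (support (i ∷ j ∷ [])))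

  module _ (H : Hypergraph) (unif : Uniform 2 H) where

    adjacent-diagonal : ∀ i → adjacent H i i ≡ 0
    adjacent-diagonal i = ind-no (isEdge? H _) λ (e , eq) → contradiction
      (ℕ.≤-trans (ℕ.≤-reflexive (trans (sym (unif e)) (cong ∣_∣ eq)))
        (ℕ.≤-trans (p⊆q⇒∣p∣≤∣q∣ (support⊆ (i ∷ i ∷ []) (x∈⁅x⁆ i ∷ x∈⁅x⁆ i ∷ [])))
          (ℕ.≤-reflexive (∣⁅x⁆∣≡1 i))))
      ℕ.1+n≰n

    adjacent-comm : ∀ i j → adjacent H i j ≡ adjacent H j i
    adjacent-comm i j = cong (λ S → ind (isEdge? H S)) (support₂-comm i j)

    private
      _≟ˢ_ : (p q : Subset (order H)) → Dec (p ≡ q)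
      _≟ˢ_ = ≡-dec Bool._≟_

      edge-pair : ∀ e i w → i ∈ edge H e → w ∈ edge H e → w ≢ i → edge H e ≡ support (i ∷ w ∷ [])
      edge-pair e i w i∈e w∈e w≢i = ⊆-antisym e⊆ (support⊆ (i ∷ w ∷ []) (i∈e ∷ w∈e ∷ []))
        where
        e⊆ : edge H e ⊆ support (i ∷ w ∷ [])
        e⊆ {x} x∈e with x ≟ i | x ≟ w
        ... | yes refl | _        = i∈support₂ i w
        ... | no _     | yes refl = j∈support₂ i w
        ... | no x≢i   | no x≢w   = contradiction
          (ℕ.≤-trans (three-distinct⇒3≤ (_∈? edge H e) x≢i x≢w (w≢i ∘ sym) x∈e i∈e w∈e)
            (ℕ.≤-reflexive (trans (sym (∣p∣≡sum (edge H e))) (unif e))))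
          ℕ.1+n≰n

      -- In a 2-uniform hypergraph an edge through `i` has exactly one other endpoint, hence exactly
      -- one `j` spells it.
      edges-through : ∀ (i : Fin (order H)) (e : Fin (size H)) → sum (λ j → ind (edge H e ≟ˢ support (i ∷ j ∷ []))) ≡ ind (i ∈? edge H e)
      edges-through i e with i ∈? edge H e
      ... | no i∉e = sum-zero ℕ.+-0-commutativeMonoid (λ j →
        ind-no (edge H e ≟ˢ _) (λ eq → i∉e (subst (i ∈_) (sym eq) (i∈support₂ i j))))
      ... | yes i∈e with w , w∈e , w≢i ← ∣p∣≥2⇒∃≢ {p = edge H e} i (ℕ.≤-reflexive (sym (unif e))) = trans
        (sum-single ℕ.+-0-commutativeMonoid (λ j → ind (edge H e ≟ˢ support (i ∷ j ∷ []))) w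
          (λ j w≢j → ind-no (edge H e ≟ˢ _) (λ eq →
            [ w≢i , w≢j ]′ (∈support₂ i j (subst (w ∈_) eq w∈e)))))
        (ind-yes (edge H e ≟ˢ _) (edge-pair e i w i∈e w∈e w≢i))

      adjacent≡sum : ∀ (i j : Fin (order H)) → adjacent H i j ≡ sum (λ e → ind (edge H e ≟ˢ support (i ∷ j ∷ [])))
      adjacent≡sum i j with isEdge? H (support (i ∷ j ∷ []))
      ... | no none = sym (sum-zero ℕ.+-0-commutativeMonoid (λ e → ind-no (edge H e ≟ˢ _) (λ eq → none (e , eq))))
      ... | yes (e , eq) = sym (trans
        (sum-single ℕ.+-0-commutativeMonoid (λ f → ind (edge H f ≟ˢ support (i ∷ j ∷ []))) e
          (λ f e≢f → ind-no (edge H f ≟ˢ _) (λ eq′ → e≢f (edge-injective H (trans eq (sym eq′))))))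
        (ind-yes (edge H e ≟ˢ _) eq))

    adjacent-row : ∀ i → sum (adjacent H i) ≡ degree H i
    adjacent-row i = trans (sum-cong-≗ (adjacent≡sum i))
      (trans (∑-comm (λ j e → ind (edge H e ≟ˢ support (i ∷ j ∷ []))))
        (trans (sum-cong-≗ (edges-through i)) (sym (degree≡sum H i))))

    pairSum-adjacent : pairSumℕ (λ i j → adjacent H i j + adjacent H i j) ≡ sum (degree H)
    pairSum-adjacent = trans (sym (pairSum-symmetric (adjacent H) adjacent-comm adjacent-diagonal))
      (sum-cong-≗ adjacent-row)

  sumᴿ-fromℕ : ∀ {n} x (f : Fin n → ℕ) → sumᴿ (λ i → x *ᴿ fromℕᴿ (f i)) ≈ x *ᴿ fromℕᴿ (sum f)
  sumᴿ-fromℕ {zero}  x f = ℛ.sym (ℛ.zeroʳ x)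
  sumᴿ-fromℕ {suc n} x f = begin
    x *ᴿ fromℕᴿ (f zero) +ᴿ sumᴿ (λ i → x *ᴿ fromℕᴿ (f (suc i)))
      ≈⟨ ℛ.+-congˡ (sumᴿ-fromℕ x (f ∘ suc)) ⟩
    x *ᴿ fromℕᴿ (f zero) +ᴿ x *ᴿ fromℕᴿ (sum (f ∘ suc))
      ≈⟨ ℛ.distribˡ x _ _ ⟨
    x *ᴿ (fromℕᴿ (f zero) +ᴿ fromℕᴿ (sum (f ∘ suc)))
      ≈⟨ ℛ.*-congˡ (ℛMult.×-homo-+ 1# (f zero) (sum (f ∘ suc))) ⟨
    x *ᴿ fromℕᴿ (sum f) ∎

  pairSumᴿ-fromℕ : ∀ {n} x (f : Fin n → Fin n → ℕ) →
    pairSumᴿ (λ i j → x *ᴿ fromℕᴿ (f i j)) ≈ x *ᴿ fromℕᴿ (pairSumℕ f)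
  pairSumᴿ-fromℕ {zero}  x f = ℛ.sym (ℛ.zeroʳ x)
  pairSumᴿ-fromℕ {suc n} x f = begin
    sumᴿ (λ j → x *ᴿ fromℕᴿ (f zero (suc j))) +ᴿ pairSumᴿ (λ i j → x *ᴿ fromℕᴿ (f (suc i) (suc j)))
      ≈⟨ ℛ.+-cong (sumᴿ-fromℕ x (λ j → f zero (suc j))) (pairSumᴿ-fromℕ x (λ i j → f (suc i) (suc j))) ⟩
    x *ᴿ fromℕᴿ row +ᴿ x *ᴿ fromℕᴿ rest
      ≈⟨ ℛ.distribˡ x _ _ ⟨
    x *ᴿ (fromℕᴿ row +ᴿ fromℕᴿ rest)
      ≈⟨ ℛ.*-congˡ (ℛMult.×-homo-+ 1# row rest) ⟨
    x *ᴿ fromℕᴿ (row + rest) ∎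
    where
    row = sum (λ j → f zero (suc j))
    rest = pairSumℕ (λ i j → f (suc i) (suc j))

  module _ {n} (r′ N : ℕ) {i j : Fin n} (i≢j : i ≢ j) where
    private r = suc r′

    -- A closed walk cannot use both the loop at i and an arc from j when
    -- every arc from i is a loop.
    E-loops-first : ∀ (δ : Vec (Fin n) r) →
      E (arcs j δ (arcs i (replicate r i) [])) (tracePower n N) ≈ 0#
    E-loops-first δ@(y ∷ _) = E-trace-trap N (arcs j δ (arcs i (replicate r i) [])) {i = i}
      (arcs-All δ (always δ (λ _ j≡i → contradiction (sym j≡i) i≢j))
        (arcs-All (replicate r i) (replicate-All r (λ _ → refl)) []))
      (∈-arcsʳ δ (∈-arcsˡ {x = i} {γ = replicate r i} (here refl))) refl
      (∈-arcsˡ {x = y} {γ = δ} (here refl)) (i≢j ∘ sym)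

    E-loops-second : ∀ (γ : Vec (Fin n) r) →
      E (arcs j (replicate r j) (arcs i γ [])) (tracePower n N) ≈ 0#
    E-loops-second γ@(x ∷ _) = E-trace-trap N (arcs j (replicate r j) (arcs i γ [])) {i = j}
      (arcs-All (replicate r j) (replicate-All r (λ _ → refl))
        (arcs-All γ (always γ (λ _ i≡j → contradiction i≡j i≢j)) []))
      (∈-arcsˡ {x = j} {γ = replicate r j} (here refl)) refl
      (∈-arcsʳ (replicate r j) (∈-arcsˡ {x = x} {γ = γ} (here refl))) i≢j

    private
      from-i-or-j : ∀ (γ δ : Vec (Fin n) r) → All (λ d → proj₁ d ∈ ⁅ i ⁆ ∪ ⁅ j ⁆) (arcs j δ (arcs i γ []))
      from-i-or-j γ δ = arcs-All δ (always δ (λ _ → x∈p∪q⁺ (inj₂ (x∈⁅x⁆ j))))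
        (arcs-All γ (always γ (λ _ → x∈p∪q⁺ (inj₁ (x∈⁅x⁆ i)))) [])

    E-escape-first : ∀ (γ δ : Vec (Fin n) r) {x} → x ∈ⱽ γ → x ∉ ⁅ i ⁆ ∪ ⁅ j ⁆ →
      E (arcs j δ (arcs i γ [])) (tracePower n N) ≈ 0#
    E-escape-first γ δ x∈γ x∉ = E-trace-escape {P = _∈ ⁅ i ⁆ ∪ ⁅ j ⁆} N
      (arcs j δ (arcs i γ [])) (from-i-or-j γ δ) (∈-arcsʳ δ (∈-arcsˡ x∈γ)) x∉

    E-escape-second : ∀ (γ δ : Vec (Fin n) r) {x} → x ∈ⱽ δ → x ∉ ⁅ i ⁆ ∪ ⁅ j ⁆ →
      E (arcs j δ (arcs i γ [])) (tracePower n N) ≈ 0#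
    E-escape-second γ δ x∈δ x∉ = E-trace-escape {P = _∈ ⁅ i ⁆ ∪ ⁅ j ⁆} N
      (arcs j δ (arcs i γ [])) (from-i-or-j γ δ) (∈-arcsˡ x∈δ) x∉

  ∉⁅i⁆∪⁅j⁆ : ∀ {n} {i j x : Fin n} → x ≢ i → x ≢ j → x ∉ ⁅ i ⁆ ∪ ⁅ j ⁆
  ∉⁅i⁆∪⁅j⁆ {i = i} {j} x≢i x≢j x∈ =
    [ x≢i ∘ x∈⁅y⁆⇒x≡y i , x≢j ∘ x∈⁅y⁆⇒x≡y j ]′ (x∈p∪q⁻ ⁅ i ⁆ ⁅ j ⁆ x∈)

  module _ (α : Carrier) (r′ : ℕ) (H : Hypergraph) (unif : Uniform (suc (suc r′)) H) where
    private
      r k n : ℕ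
      r = suc r′
      k = suc r
      n = order H

      T : Tensor k n
      T = Aα α k H

    adjacency-nonedge : ∀ (i : Fin n) (γ : Vec (Fin n) r) → ∣ support (i ∷ γ) ∣ ≢ k → adjacency k H i γ ≈ 0#
    adjacency-nonedge i γ ≢k = go (isEdge? H (support (i ∷ γ)))
      where
      go : (d : Dec (∃[ e ] edge H e ≡ support (i ∷ γ))) → (if does d then recip! r else 0#) ≈ 0#
      go (yes (e , eq)) = contradiction (trans (sym (cong ∣_∣ eq)) (unif e)) ≢k
      go (no _)         = ℛ.refl

    Aα-off-diagonal : ∀ (i : Fin n) (γ : Vec (Fin n) r) → γ ≢ replicate r i → T i γ ≈ (1# -ᴿ α) *ᴿ adjacency k H i γ
    Aα-off-diagonal i γ γ≢ with ≡-dec _≟_ γ (replicate r i)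
    ... | yes γ≡ = contradiction γ≡ γ≢
    ... | no _   = ℛ.trans (ℛ.+-congʳ (ℛ.zeroʳ α)) (ℛ.+-identityˡ _)

    Aα-nonedge : ∀ (i : Fin n) (γ : Vec (Fin n) r) → γ ≢ replicate r i → ∣ support (i ∷ γ) ∣ ≢ k → T i γ ≈ 0#
    Aα-nonedge i γ γ≢ ≢k = ℛ.trans (Aα-off-diagonal i γ γ≢)
      (ℛ.trans (ℛ.*-congˡ (adjacency-nonedge i γ ≢k)) (ℛ.zeroʳ _))

    -- A constant index has a support of one vertex, fewer than `k`, so the adjacency part vanishes
    -- there.
    Aα-diagonal : ∀ i → T i (replicate r i) ≈ α *ᴿ fromℕᴿ (degree H i)
    Aα-diagonal i = ℛ.trans (ℛ.+-cong (ℛ.*-congˡ degree-entry)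
        (ℛ.trans (ℛ.*-congˡ (adjacency-nonedge i (replicate r i) small)) (ℛ.zeroʳ _)))
      (ℛ.+-identityʳ _)
      where
      degree-entry : degreeTensor k H i (replicate r i) ≈ fromℕᴿ (degree H i)
      degree-entry = ℛ.reflexive (cong (λ b → if b then fromℕᴿ (degree H i) else 0#)
        (dec-true (≡-dec _≟_ (replicate r i) (replicate r i)) refl))
      small : ∣ support (i ∷ replicate r i) ∣ ≢ k
      small eq = contradiction
        (ℕ.≤-trans (ℕ.≤-reflexive (sym eq)) (ℕ.≤-trans
          (p⊆q⇒∣p∣≤∣q∣ (support⊆ (i ∷ replicate r i) (x∈⁅x⁆ i ∷ replicate-All r (x∈⁅x⁆ i))))
          (ℕ.≤-reflexive (∣⁅x⁆∣≡1 i))))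
        λ { (s≤s ()) }

    Tr-1-Aα : Tr {k} 1 T ≈ fromℕᴿ (r ^ (n ∸ 1)) *ᴿ (α *ᴿ fromℕᴿ (sum (degree H)))
    Tr-1-Aα = ℛ.trans (Tr-1 T) (ℛ.*-congˡ
      (ℛ.trans (Σᴿ.sum-cong-≋ Aα-diagonal) (sumᴿ-fromℕ α (degree H))))

  -- Three reasons cover all `γ`: constant `i` makes `i` a trap, an entry outside `{i , j}` is a
  -- dead end, and otherwise the support has at most two vertices, fewer than `k ≥ 3`, so the entry
  -- of the tensor is zero.
  mixed-zero : ∀ α r″ H → Uniform (3 + r″) H → ∀ i j → i ≢ j → mixed (Aα α (3 + r″) H) i j ≈ 0#
  mixed-zero α r″ H unif i j i≢j = ℛ.trans (ℛ.*-congˡ (sumᴸ-zero γs vanish)) (ℛ.zeroʳ _)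
    where
    r = 2 + r″
    T = Aα α (suc r) H
    γs = vectors (allFin (order H)) r
    N = 2 * r

    inner : Vec (Fin (order H)) r → Carrier
    inner γ = recip! (1 * r) *ᴿ sumᴸ γs (λ δ → T j δ *ᴿ E (arcs j δ (arcs i γ [])) (tracePower (order H) N))

    inner-zero : ∀ γ → (∀ δ → E (arcs j δ (arcs i γ [])) (tracePower (order H) N) ≈ 0#) → inner γ ≈ 0#
    inner-zero γ z = ℛ.trans (ℛ.*-congˡ (sumᴸ-zero γs (λ δ → ℛ.trans (ℛ.*-congˡ (z δ)) (ℛ.zeroʳ _)))) (ℛ.zeroʳ _)

    vanish : ∀ γ → T i γ *ᴿ inner γ ≈ 0#
    vanish γ = go (≡-dec _≟_ γ (replicate r i)) (inside⊎outside (⁅ i ⁆ ∪ ⁅ j ⁆) γ)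
      where
      go : Dec (γ ≡ replicate r i) →
           Allⱽ (_∈ ⁅ i ⁆ ∪ ⁅ j ⁆) γ ⊎ ∃[ x ] x ∈ⱽ γ × x ∉ ⁅ i ⁆ ∪ ⁅ j ⁆ → T i γ *ᴿ inner γ ≈ 0#
      go (yes refl) _ = ℛ.trans (ℛ.*-congˡ (inner-zero γ (E-loops-first (suc r″) N i≢j))) (ℛ.zeroʳ _)
      go (no _) (inj₂ (x , x∈γ , x∉)) =
        ℛ.trans (ℛ.*-congˡ (inner-zero γ (λ δ → E-escape-first (suc r″) N i≢j γ δ x∈γ x∉))) (ℛ.zeroʳ _)
      go (no γ≢) (inj₁ γ⊆) = ℛ.trans (ℛ.*-congʳ (Aα-nonedge α (suc r″) H unif i γ γ≢ small)) (ℛ.zeroˡ _)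
        where
        small : ∣ support (i ∷ γ) ∣ ≢ suc r
        small eq = contradiction
          (ℕ.≤-trans (ℕ.≤-reflexive (sym eq)) (ℕ.≤-trans
            (p⊆q⇒∣p∣≤∣q∣ (support⊆ (i ∷ γ) (x∈p∪q⁺ (inj₁ (x∈⁅x⁆ i)) ∷ γ⊆))) (∣⁅i⁆∪⁅j⁆∣≤2 i j)))
          λ { (s≤s (s≤s ())) }

  Aα-pair : ∀ α H → Uniform 2 H → ∀ i j → i ≢ j → Aα α 2 H i (j ∷ []) ≈ (1# -ᴿ α) *ᴿ fromℕᴿ (adjacent H i j)
  Aα-pair α H unif i j i≢j = ℛ.trans (Aα-off-diagonal α 0 H unif i (j ∷ []) (λ { refl → i≢j refl }))
    (ℛ.*-congˡ entry)
    where
    entry : adjacency 2 H i (j ∷ []) ≈ fromℕᴿ (adjacent H i j)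
    entry = go (isEdge? H (support (i ∷ j ∷ [])))
      where
      go : ∀ {p} {P : Set p} (d : Dec P) → (if does d then recip! 1 else 0#) ≈ fromℕᴿ (ind d)
      go (yes _) = ℛ.trans recip!1≈1 (ℛ.sym (ℛ.+-identityʳ 1#))
      go (no _)  = ℛ.refl

  -- Dead ends and traps leave only the arcs from `i` to `j` and back, that is, `γ = j` and `δ = i`.
  mixed-graph : ∀ α H → Uniform 2 H → ∀ i j → i ≢ j → mixed (Aα α 2 H) i j ≈
    ((1# -ᴿ α) *ᴿ (1# -ᴿ α)) *ᴿ fromℕᴿ (adjacent H i j + adjacent H i j)
  mixed-graph α H unif i j i≢j = begin
    recip! 1 *ᴿ sumᴸ γs (λ γ → T i γ *ᴿ inner γ)
      ≈⟨ ℛ.trans (ℛ.*-congʳ recip!1≈1) (ℛ.*-identityˡ _) ⟩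
    sumᴸ γs (λ γ → T i γ *ᴿ inner γ)
      ≈⟨ sumᴸ-vectors-single 1 (λ γ → T i γ *ᴿ inner γ) (j ∷ []) off-first ⟩
    T i (j ∷ []) *ᴿ inner (j ∷ [])
      ≈⟨ ℛ.*-congˡ (ℛ.trans (ℛ.*-congʳ recip!1≈1) (ℛ.*-identityˡ _)) ⟩
    T i (j ∷ []) *ᴿ sumᴸ γs (λ δ → T j δ *ᴿ E (arcs j δ ((i , j) ∷ [])) (tracePower (order H) 2))
      ≈⟨ ℛ.*-congˡ (sumᴸ-vectors-single 1
           (λ δ → T j δ *ᴿ E (arcs j δ ((i , j) ∷ [])) (tracePower (order H) 2)) (i ∷ []) off-second) ⟩
    T i (j ∷ []) *ᴿ (T j (i ∷ []) *ᴿ E ((j , i) ∷ (i , j) ∷ []) (tracePower (order H) 2))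
      ≈⟨ ℛ.*-cong (Aα-pair α H unif i j i≢j)
           (ℛ.*-cong (Aα-pair α H unif j i (i≢j ∘ sym)) (E-edge-trace j i (i≢j ∘ sym))) ⟩
    (β *ᴿ fromℕᴿ (adjacent H i j)) *ᴿ ((β *ᴿ fromℕᴿ (adjacent H j i)) *ᴿ fromℕᴿ 2)
      ≈⟨ ℛ.*-congˡ (ℛ.*-congʳ (ℛ.*-congˡ (ℛ.reflexive (cong fromℕᴿ (adjacent-comm H unif j i))))) ⟩
    (β *ᴿ a) *ᴿ ((β *ᴿ a) *ᴿ fromℕᴿ 2)
      ≈⟨ S.solve 3 (λ x y z → ((x S.⊕ y) S.⊕ ((x S.⊕ y) S.⊕ z)) S.⊜ ((x S.⊕ x) S.⊕ ((y S.⊕ y) S.⊕ z)))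
           ℛ.refl β a (fromℕᴿ 2) ⟩
    (β *ᴿ β) *ᴿ ((a *ᴿ a) *ᴿ fromℕᴿ 2)
      ≈⟨ ℛ.*-congˡ idempotent ⟩
    (β *ᴿ β) *ᴿ fromℕᴿ (adjacent H i j + adjacent H i j) ∎
    where
    module S = CommutativeMonoidSolver ℛ.*-commutativeMonoid
    T = Aα α 2 H
    γs = vectors (allFin (order H)) 1
    β = 1# -ᴿ α
    a = fromℕᴿ (adjacent H i j)

    inner : Vec (Fin (order H)) 1 → Carrier
    inner γ = recip! 1 *ᴿ sumᴸ γs (λ δ → T j δ *ᴿ E (arcs j δ (arcs i γ [])) (tracePower (order H) 2))

    -- `a` is 0 or 1, so `a²` is `a`; doubling it accounts for the two closed walks along the edge.
    idempotent : (a *ᴿ a) *ᴿ fromℕᴿ 2 ≈ fromℕᴿ (adjacent H i j + adjacent H i j)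
    idempotent = go (isEdge? H (support (i ∷ j ∷ [])))
      where
      go : ∀ {p} {P : Set p} (d : Dec P) →
           (fromℕᴿ (ind d) *ᴿ fromℕᴿ (ind d)) *ᴿ fromℕᴿ 2 ≈ fromℕᴿ (ind d + ind d)
      go (yes _) = ℛ.trans (ℛ.*-congʳ (ℛ.trans (ℛ.*-congʳ (ℛ.+-identityʳ 1#))
        (ℛ.trans (ℛ.*-identityˡ _) (ℛ.+-identityʳ 1#)))) (ℛ.*-identityˡ _)
      go (no _)  = ℛ.trans (ℛ.*-congʳ (ℛ.zeroˡ 0#)) (ℛ.zeroˡ _)

    off-first : ∀ γ → (j ∷ []) ≢ γ → T i γ *ᴿ inner γ ≈ 0#
    off-first (x ∷ []) j≢x = ℛ.trans (ℛ.*-congˡ (ℛ.trans (ℛ.*-congˡ (sumᴸ-zero γs (λ δ →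
      ℛ.trans (ℛ.*-congˡ (vanish δ (x ≟ i))) (ℛ.zeroʳ _)))) (ℛ.zeroʳ _))) (ℛ.zeroʳ _)
      where
      vanish : ∀ δ → Dec (x ≡ i) → E (arcs j δ (arcs i (x ∷ []) [])) (tracePower (order H) 2) ≈ 0#
      vanish δ (yes refl) = E-loops-first 0 2 i≢j δ
      vanish δ (no x≢i)   = E-escape-first 0 2 i≢j (x ∷ []) δ (here refl)
        (∉⁅i⁆∪⁅j⁆ x≢i (λ { refl → j≢x refl }))

    off-second : ∀ δ → (i ∷ []) ≢ δ → T j δ *ᴿ E (arcs j δ ((i , j) ∷ [])) (tracePower (order H) 2) ≈ 0#
    off-second (x ∷ []) i≢x with x ≟ j
    ... | yes refl = ℛ.trans (ℛ.*-congˡ (E-loops-second 0 2 i≢j (j ∷ []))) (ℛ.zeroʳ _)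
    ... | no x≢j   = ℛ.trans (ℛ.*-congˡ (E-escape-second 0 2 i≢j (j ∷ []) (x ∷ []) (here refl)
      (∉⁅i⁆∪⁅j⁆ (λ { refl → i≢x refl }) x≢j))) (ℛ.zeroʳ _)

  -- The contribution of the edges to the second trace: two closed walks
  -- run along each edge of a graph, none along larger hyperedges.
  edgeTerm : Carrier → ℕ → ℕ → Carrier
  edgeTerm α zero    s = ((1# -ᴿ α) *ᴿ (1# -ᴿ α)) *ᴿ fromℕᴿ s
  edgeTerm α (suc _) s = 0#

  pairSum-mixed : ∀ α r′ H → Uniform (2 + r′) H →
    pairSumᴿ (mixed (Aα α (2 + r′) H)) ≈ edgeTerm α r′ (sum (degree H))
  pairSum-mixed α zero H unif = begin
    pairSumᴿ (mixed (Aα α 2 H))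
      ≈⟨ pairSum-cong ℛ.+-commutativeMonoid (λ i j i<j →
           mixed-graph α H unif i j (λ i≡j → ℕ.<⇒≢ i<j (cong toℕ i≡j))) ⟩
    pairSumᴿ (λ i j → β² *ᴿ fromℕᴿ (adjacent H i j + adjacent H i j))
      ≈⟨ pairSumᴿ-fromℕ β² (λ i j → adjacent H i j + adjacent H i j) ⟩
    β² *ᴿ fromℕᴿ (pairSumℕ (λ i j → adjacent H i j + adjacent H i j))
      ≡⟨ cong (λ s → β² *ᴿ fromℕᴿ s) (pairSum-adjacent H unif) ⟩
    β² *ᴿ fromℕᴿ (sum (degree H)) ∎
    where β² = (1# -ᴿ α) *ᴿ (1# -ᴿ α)
  pairSum-mixed α (suc r″) H unif = pairSum-zero ℛ.+-commutativeMonoid (λ i j i<j →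
    mixed-zero α r″ H unif i j (λ i≡j → ℕ.<⇒≢ i<j (cong toℕ i≡j)))

  Tr-2-Aα : ∀ α r′ H → Uniform (2 + r′) H → Tr {2 + r′} 2 (Aα α (2 + r′) H) ≈
    fromℕᴿ (suc r′ ^ (order H ∸ 1)) *ᴿ
      ((α *ᴿ α) *ᴿ fromℕᴿ (sum (λ v → degree H v * degree H v)) +ᴿ edgeTerm α r′ (sum (degree H)))
  Tr-2-Aα α r′ H unif = ℛ.trans (Tr-2 (Aα α (2 + r′) H)) (ℛ.*-congˡ (ℛ.+-cong
    (ℛ.trans (Σᴿ.sum-cong-≋ square) (sumᴿ-fromℕ (α *ᴿ α) (λ v → degree H v * degree H v)))
    (pairSum-mixed α r′ H unif)))
    where
    square : ∀ i → Aα α (2 + r′) H i (replicate (suc r′) i) *ᴿ Aα α (2 + r′) H i (replicate (suc r′) i) ≈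
      (α *ᴿ α) *ᴿ fromℕᴿ (degree H i * degree H i)
    square i = begin
      Aα α (2 + r′) H i (replicate (suc r′) i) *ᴿ Aα α (2 + r′) H i (replicate (suc r′) i)
        ≈⟨ ℛ.*-cong (Aα-diagonal α r′ H unif i) (Aα-diagonal α r′ H unif i) ⟩
      (α *ᴿ d) *ᴿ (α *ᴿ d)
        ≈⟨ S.solve 2 (λ x y → ((x S.⊕ y) S.⊕ (x S.⊕ y)) S.⊜ ((x S.⊕ x) S.⊕ (y S.⊕ y))) ℛ.refl α d ⟩
      (α *ᴿ α) *ᴿ (d *ᴿ d)
        ≈⟨ ℛ.*-congˡ (ℛMult.×1-homo-* (degree H i) (degree H i)) ⟨
      (α *ᴿ α) *ᴿ fromℕᴿ (degree H i * degree H i) ∎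
      where
      module S = CommutativeMonoidSolver ℛ.*-commutativeMonoid
      d = fromℕᴿ (degree H i)

  degreeSquares<⇒precedes : ∀ α → 0# <ᴿ α → ∀ r′ H X →
    Uniform (2 + r′) H → Uniform (2 + r′) X → 3 ≤ order H → order H ≡ order X →
    sum (degree H) ≡ sum (degree X) →
    sum (λ v → degree H v * degree H v) < sum (λ v → degree X v * degree X v) →
    Precedes (2 + r′) α H X
  degreeSquares<⇒precedes α 0<α r′ H X unifH unifX 3≤n n≡ deg≡ sq< =
    n≡ , 2 , s≤s z≤n , many , lower , strict
    where
    module O = IsStrictPartialOrder isStrictPartialOrder
    r = suc r′
    K = fromℕᴿ (r ^ (order H ∸ 1))
    sq : Hypergraph → ℕ
    sq Y = sum (λ v → degree Y v * degree Y v)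
    edges = edgeTerm α r′ (sum (degree H))

    many : 2 ≤ order H * r ^ (order H ∸ 1) ∸ 1
    many = ℕ.∸-monoˡ-≤ 1 (ℕ.*-mono-≤ 3≤n (ℕ.m^n>0 r (order H ∸ 1)))

    lower : ∀ t → t < 2 → Tr {suc r} t (Aα α (suc r) H) ≈ Tr {suc r} t (Aα α (suc r) X)
    lower zero _ = ℛ.reflexive (cong (λ n → fromℕᴿ (n * r ^ (n ∸ 1))) n≡)
    lower (suc zero) _ = ℛ.trans (Tr-1-Aα α r′ H unifH) (ℛ.trans
      (ℛ.reflexive (cong₂ (λ n s → fromℕᴿ (r ^ (n ∸ 1)) *ᴿ (α *ᴿ fromℕᴿ s)) n≡ deg≡))
      (ℛ.sym (Tr-1-Aα α r′ X unifX)))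
    lower (suc (suc _)) (s≤s (s≤s ()))

    gap : ℕ
    gap = sq X ∸ sq H

    -- The exact difference of the second traces, since all other terms agree for `H` and `X`; it is
    -- positive because `α` is.
    extra : Carrier
    extra = K *ᴿ ((α *ᴿ α) *ᴿ fromℕᴿ gap)

    0<extra : 0# <ᴿ extra
    0<extra = *-pos (0<fromℕ _ (ℕ.m^n>0 r (order H ∸ 1)))
      (*-pos (*-pos 0<α 0<α) (0<fromℕ gap (ℕ.m<n⇒0<n∸m sq<)))

    decomposed : Tr {suc r} 2 (Aα α (suc r) X) ≈ Tr {suc r} 2 (Aα α (suc r) H) +ᴿ extra
    decomposed = begin
      Tr {suc r} 2 (Aα α (suc r) X)
        ≈⟨ Tr-2-Aα α r′ X unifX ⟩
      fromℕᴿ (r ^ (order X ∸ 1)) *ᴿ ((α *ᴿ α) *ᴿ fromℕᴿ (sq X) +ᴿ edgeTerm α r′ (sum (degree X)))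
        ≡⟨ cong₂ (λ n s → fromℕᴿ (r ^ (n ∸ 1)) *ᴿ ((α *ᴿ α) *ᴿ fromℕᴿ (sq X) +ᴿ edgeTerm α r′ s)) (sym n≡) (sym deg≡) ⟩
      K *ᴿ ((α *ᴿ α) *ᴿ fromℕᴿ (sq X) +ᴿ edges)
        ≡⟨ cong (λ s → K *ᴿ ((α *ᴿ α) *ᴿ fromℕᴿ s +ᴿ edges)) (sym (ℕ.m+[n∸m]≡n (ℕ.<⇒≤ sq<))) ⟩
      K *ᴿ ((α *ᴿ α) *ᴿ fromℕᴿ (sq H + gap) +ᴿ edges)
        ≈⟨ ℛ.*-congˡ (ℛ.+-congʳ (ℛ.trans (ℛ.*-congˡ (ℛMult.×-homo-+ 1# (sq H) gap)) (ℛ.distribˡ _ _ _))) ⟩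
      K *ᴿ (((α *ᴿ α) *ᴿ fromℕᴿ (sq H) +ᴿ (α *ᴿ α) *ᴿ fromℕᴿ gap) +ᴿ edges)
        ≈⟨ ℛ.*-congˡ (S.solve 3 (λ x y z → ((x S.⊕ y) S.⊕ z) S.⊜ ((x S.⊕ z) S.⊕ y)) ℛ.refl
             ((α *ᴿ α) *ᴿ fromℕᴿ (sq H)) ((α *ᴿ α) *ᴿ fromℕᴿ gap) edges) ⟩
      K *ᴿ (((α *ᴿ α) *ᴿ fromℕᴿ (sq H) +ᴿ edges) +ᴿ (α *ᴿ α) *ᴿ fromℕᴿ gap)
        ≈⟨ ℛ.distribˡ K _ _ ⟩
      K *ᴿ ((α *ᴿ α) *ᴿ fromℕᴿ (sq H) +ᴿ edges) +ᴿ extra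
        ≈⟨ ℛ.+-congʳ (Tr-2-Aα α r′ H unifH) ⟨
      Tr {suc r} 2 (Aα α (suc r) H) +ᴿ extra ∎
      where module S = CommutativeMonoidSolver ℛ.+-commutativeMonoid

    strict : Tr {suc r} 2 (Aα α (suc r) H) <ᴿ Tr {suc r} 2 (Aα α (suc r) X)
    strict = O.<-respʳ-≈ (ℛ.sym decomposed)
      (O.<-respˡ-≈ (ℛ.+-identityʳ _) (+-monoʳ-< _ 0<extra))

-- Comparison within the class

linearUnicyclic-order : ∀ {r m g H} → LinearUnicyclic (suc r) m g H → order H ≡ m * r
linearUnicyclic-order {r} {H = H} H∈ =
  trans (unicyclic-order H r uniform unicyclic) (cong (_* r) size≡m)
  where open LinearUnicyclic H∈

linearUnicyclic-sum-degree : ∀ {k m g H} → LinearUnicyclic k m g H → sum (degree H) ≡ m * k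
linearUnicyclic-sum-degree {k} {H = H} H∈ = trans (handshake k H uniform) (cong (_* k) size≡m)
  where open LinearUnicyclic H∈

module _ {r p g′ H X v} (H∈ : LinearUnicyclic (suc r) (p + suc g′) (suc g′) H)
  (A : Anchored (suc r) (p + suc g′) (suc g′) (p + 2) X v) where
  private
    module A = Anchored A
    module H∈ = LinearUnicyclic H∈
    module X∈ = LinearUnicyclic A.linearUnicyclic
    module H = DegreeExcess H r p g′ H∈.uniform H∈.unicyclic H∈.size≡m (proj₁ H∈.girth)
    module X = DegreeExcess X r p g′ X∈.uniform X∈.unicyclic X∈.size≡m A.cycle

    anchor-degree : p + 2 ≤ degree X (Cycle.vert A.cycle A.position)
    anchor-degree = subst (λ v → p + 2 ≤ degree X v) (sym A.anchor) A.degree≥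

  -- If a cycle vertex of `H` has degree at least `p + 2`, then `H` and `X` are both a
  -- `PendantCycle` with the same parameters, hence isomorphic. Otherwise the concentration of `H`
  -- is below `p * (2 + p)`, which `X` attains.
  degreeSquares-maximal : ¬ Isomorphic H X →
    sum (λ v → degree H v * degree H v) < sum (λ v → degree X v * degree X v)
  degreeSquares-maximal ¬iso with H.concentration-dichotomy
  ... | inj₁ (i , deg≥) = contradiction
    (pendantCycles-isomorphic
      (anchored⇒pendantCycle H∈.uniform H∈.unicyclic H∈.size≡m (proj₁ H∈.girth) i deg≥)
      (anchored⇒pendantCycle X∈.uniform X∈.unicyclic X∈.size≡m A.cycle A.position anchor-degree))
    ¬iso
  ... | inj₂ small = begin-strict
    sum (λ v → degree H v * degree H v)                        ≡⟨ H.sum-degree² ⟩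
    (order H + 3 * suc g′) + (2 * p + H.concentration)         <⟨ ℕ.+-monoʳ-< (order H + 3 * suc g′) (ℕ.+-monoʳ-< (2 * p)
                                                                    (ℕ.<-≤-trans small (X.concentration≥ A.position anchor-degree))) ⟩
    (order H + 3 * suc g′) + (2 * p + X.concentration)         ≡⟨ cong (λ n → (n + 3 * suc g′) + (2 * p + X.concentration))
                                                                    (trans (linearUnicyclic-order H∈) (sym (linearUnicyclic-order A.linearUnicyclic))) ⟩
    (order X + 3 * suc g′) + (2 * p + X.concentration)         ≡⟨ X.sum-degree² ⟨
    sum (λ v → degree X v * degree X v)                        ∎
    where open ℕ.≤-Reasoning

theorem5p1 : ∀ {c ℓ₁ ℓ₂ ℓ₃} (R : RealNumbers c ℓ₁ ℓ₂ ℓ₃) →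
    let open RealNumbers R in
    (k m g : ℕ) (2≤k : 2 ≤ k) → 3 ≤ m → (3≤g : 3 ≤ g) → g ≤ m →
    (α : Carrier) → 0# <ᴿ α → α <ᴿ 1# →
    IsLast (LinearUnicyclic k m g) (Spectral.Precedes R k α) (C[ k , g ]⊙S[ m ∸ g ] 2≤k 3≤g)
theorem5p1 R (suc (suc q)) m (suc g′) (s≤s (s≤s z≤n)) 3≤m 3≤g g≤m α 0<α α<1 = X∈ , last
  where
  p : ℕ
  p = m ∸ suc g′

  p+g≡m : p + suc g′ ≡ m
  p+g≡m = ℕ.m∸n+n≡m g≤m

  X : Hypergraph
  X = C[ 2 + q , suc g′ ]⊙S[ p ] (s≤s (s≤s z≤n)) 3≤g

  A : Anchored (2 + q) (p + suc g′) (suc g′) (p + 2) X _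
  A = proj₂ (C⊙S-anchored q g′ p 3≤g)

  X∈ : LinearUnicyclic (2 + q) m (suc g′) X
  X∈ = subst (λ m → LinearUnicyclic (2 + q) m (suc g′) X) p+g≡m (Anchored.linearUnicyclic A)

  last : ∀ H → LinearUnicyclic (2 + q) m (suc g′) H → ¬ Isomorphic H X → Spectral.Precedes R (2 + q) α H X
  last H H∈ ¬iso = Traces.degreeSquares<⇒precedes R α 0<α q H X
    (LinearUnicyclic.uniform H∈) (LinearUnicyclic.uniform X∈)
    -- A cycle of length at least three has as many distinct vertices.
    (ℕ.≤-trans 3≤g (injective⇒≤ (Cycle.vert-inj (proj₁ (LinearUnicyclic.girth H∈)))))
    (trans (linearUnicyclic-order H∈) (sym (linearUnicyclic-order X∈)))
    (trans (linearUnicyclic-sum-degree H∈) (sym (linearUnicyclic-sum-degree X∈)))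
    (degreeSquares-maximal
      (subst (λ m → LinearUnicyclic (2 + q) m (suc g′) H) (sym p+g≡m) H∈) A ¬iso)
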